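{- Let $D>2$ and $n\ge 1$ be integers and let $\alpha>1$ be a real number. Let $\mathcal{F}\subseteq \mathbb{Z}_D^n$ be a sunflower-free family in $\mathbb{Z}_D^n$. Then there exists a constant $K(\alpha)>0$, depending only on $\alpha$ (not on $D$, $n$ or $\mathcal{F}$), such that $$ |\mathcal{F}|\le K(\alpha)\, n!\left(\frac{(\log\log\log n)^2}{\alpha\log\log n}\right)^n . $$
   Context: Here $\mathbb{Z}_D=\mathbb{Z}/D\mathbb{Z}$ and $\log$ is the natural logarithm. Three distinct vectors $x,y,z\in \mathbb{Z}_D^n$ form a sunflower if for every coordinate $i\in\{1,\dots,n\}$ either $x_i=y_i=z_i$ or $x_i,y_i,z_i$ are pairwise different. A family $\mathcal{F}\subseteq \mathbb{Z}_D^n$ is sunflower-free if it contains no three distinct vectors forming a sunflower. -}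

module Defs where

open import Data.Nat.Base as ℕ using (ℕ; zero; suc)
import Data.Nat.Properties as ℕ
open import Data.Integer.Base as ℤ using (+_)
import Data.Integer.Properties as ℤ
open import Data.Rational.Base
  using (ℚ; mkℚ; 0ℚ; 1ℚ; ½; 1/_; ∣_∣;
         positive; nonNegative; >-nonZero; ≢-nonZero)
  renaming (_+_ to _+ʳ_; _*_ to _*ʳ_; _-_ to _-ʳ_; -_ to -ʳ_; _/_ to _/ʳ_; _≤_ to _≤ʳ_; _<_ to _<ʳ_)
import Data.Rational.Properties as ℚ
open import Data.Rational.Unnormalised.Base as ℚᵘ using (mkℚᵘ)
import Data.Rational.Unnormalised.Properties as ℚᵘ
open import Data.Rational.Solver using (module +-*-Solver)
open import Data.Fin.Base using (Fin)
open import Data.Vec.Base using (Vec; lookup)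
open import Data.List.Base using (List; length)
open import Data.List.Membership.Propositional using (_∈_)
open import Data.List.Relation.Unary.Unique.Propositional using (Unique)
open import Data.Product using (∃; _×_; _,_)
open import Data.Sum.Base using (_⊎_; inj₁; inj₂)
open import Relation.Nullary using (¬_; yes; no; contradiction)
open import Relation.Binary.PropositionalEquality
  using (_≡_; _≢_; refl; sym; trans; cong; cong₂; subst; subst₂)

fromℕʳ : ℕ → ℚ
fromℕʳ n = + n /ʳ 1

Cauchy : (ℕ → ℚ) → Set
Cauchy x = ∀ ε → 0ℚ <ʳ ε → ∃ λ N → ∀ m n → N ℕ.≤ m → N ℕ.≤ n → ∣ x m -ʳ x n ∣ ≤ʳ ε

-- Real numbers as Cauchy sequences of rationals; equality of reals is _≈_ below.
record ℝ : Set where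
  constructor mkℝ
  field
    seq    : ℕ → ℚ
    cauchy : Cauchy seq

open ℝ public

infix 4 _≈_ _≤_ _<_

_≈_ : ℝ → ℝ → Set
x ≈ y = ∀ ε → 0ℚ <ʳ ε → ∃ λ N → ∀ n → N ℕ.≤ n → ∣ seq x n -ʳ seq y n ∣ ≤ʳ ε

_≤_ : ℝ → ℝ → Set
x ≤ y = ∀ ε → 0ℚ <ʳ ε → ∃ λ N → ∀ n → N ℕ.≤ n → seq x n ≤ʳ seq y n +ʳ ε

_<_ : ℝ → ℝ → Set
x < y = ∃ λ ε → 0ℚ <ʳ ε × ∃ λ N → ∀ n → N ℕ.≤ n → seq x n +ʳ ε ≤ʳ seq y n

-- expTerm q k = qᵏ / k!
expTerm : ℚ → ℕ → ℚ
expTerm q zero    = 1ℚ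
expTerm q (suc k) = expTerm q k *ʳ (q *ʳ (+ 1 /ʳ suc k))

expSum : ℚ → ℕ → ℚ
expSum q zero    = 0ℚ
expSum q (suc n) = expSum q n +ʳ expTerm q n

-- Reciprocal made total by the value 0 at 0.
recip : ℚ → ℚ
recip q with q ℚ.≟ 0ℚ
... | yes _  = 0ℚ
... | no q≢0 = (1/ q) {{≢-nonZero q≢0}}

-- Rational estimates showing that the operations on reals below preserve
-- Cauchy sequences.

module Estimates where

  unpack : ∀ {A : Set} {P : A → Set} {C : Set} → ∃ P → (∀ a → P a → C) → C
  unpack (a , p) f = f a p

  ring-sub-split : ∀ a b c d → (a +ʳ b) -ʳ (c +ʳ d) ≡ (a -ʳ c) +ʳ (b -ʳ d)
  ring-sub-split = solve 4 (λ a b c d → (a :+ b) :- (c :+ d) := (a :- c) :+ (b :- d)) refl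
    where open +-*-Solver

  ring-mul-split : ∀ a b c d → (a *ʳ b) -ʳ (c *ʳ d) ≡ a *ʳ (b -ʳ d) +ʳ (a -ʳ c) *ʳ d
  ring-mul-split = solve 4 (λ a b c d → (a :* b) :- (c :* d) := a :* (b :- d) :+ (a :- c) :* d) refl
    where open +-*-Solver

  ring-insert : ∀ a b c → a -ʳ c ≡ (a -ʳ b) +ʳ (b -ʳ c)
  ring-insert = solve 3 (λ a b c → a :- c := (a :- b) :+ (b :- c)) refl
    where open +-*-Solver

  ½+½ : ∀ ε → ½ *ʳ ε +ʳ ½ *ʳ ε ≡ ε
  ½+½ ε = trans (sym (ℚ.*-distribʳ-+ ε ½ ½)) (ℚ.*-identityˡ ε)

  0<½* : ∀ {ε} → 0ℚ <ʳ ε → 0ℚ <ʳ ½ *ʳ ε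
  0<½* {ε} p = subst (_<ʳ ½ *ʳ ε) (ℚ.*-zeroʳ ½) (ℚ.*-monoʳ-<-pos ½ p)

  0<1 : 0ℚ <ʳ 1ℚ
  0<1 = ℚ.positive⁻¹ 1ℚ

  *-mono-≤ʳ : ∀ {a b c d} → 0ℚ ≤ʳ b → 0ℚ ≤ʳ c → a ≤ʳ b → c ≤ʳ d → a *ʳ c ≤ʳ b *ʳ d
  *-mono-≤ʳ {a} {b} {c} {d} 0≤b 0≤c a≤b c≤d = ℚ.≤-trans
    (ℚ.*-monoʳ-≤-nonNeg c {{nonNegative 0≤c}} a≤b)
    (ℚ.*-monoˡ-≤-nonNeg b {{nonNegative 0≤b}} c≤d)

  0≤* : ∀ {a b} → 0ℚ ≤ʳ a → 0ℚ ≤ʳ b → 0ℚ ≤ʳ a *ʳ b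
  0≤* {a} {b} p q = subst (_≤ʳ a *ʳ b) (ℚ.*-zeroˡ b) (ℚ.*-monoʳ-≤-nonNeg b {{nonNegative q}} p)

  0<* : ∀ {a b} → 0ℚ <ʳ a → 0ℚ <ʳ b → 0ℚ <ʳ a *ʳ b
  0<* {a} {b} p q = subst (_<ʳ a *ʳ b) (ℚ.*-zeroˡ b) (ℚ.*-monoˡ-<-pos b {{positive q}} p)

  ∣-∣-sym : ∀ a b → ∣ a -ʳ b ∣ ≡ ∣ b -ʳ a ∣
  ∣-∣-sym a b = trans (cong ∣_∣ (solve 2 (λ a b → a :- b := :- (b :- a)) refl a b)) (ℚ.∣-p∣≡∣p∣ (b -ʳ a))
    where open +-*-Solver

  triangle : ∀ a b c {δ ε} → ∣ a -ʳ b ∣ ≤ʳ δ → ∣ b -ʳ c ∣ ≤ʳ ε → ∣ a -ʳ c ∣ ≤ʳ δ +ʳ ε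
  triangle a b c p q = ℚ.≤-trans (ℚ.≤-reflexive (cong ∣_∣ (ring-insert a b c)))
    (ℚ.≤-trans (ℚ.∣p+q∣≤∣p∣+∣q∣ (a -ʳ b) (b -ʳ c)) (ℚ.+-mono-≤ p q))

  p≤∣p∣ : ∀ p → p ≤ʳ ∣ p ∣
  p≤∣p∣ p with ℚ.≤-total 0ℚ p
  ... | inj₁ 0≤p = ℚ.≤-reflexive (sym (ℚ.0≤p⇒∣p∣≡p 0≤p))
  ... | inj₂ p≤0 = ℚ.≤-trans p≤0 (ℚ.0≤∣p∣ p)

  scale : ∀ A ε → 0ℚ <ʳ A → 0ℚ <ʳ ε → ∃ λ δ → 0ℚ <ʳ δ × A *ʳ δ ≡ ε
  scale A ε 0<A 0<ε = A⁻¹ *ʳ ε , 0<* 0<A⁻¹ 0<ε ,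
    trans (sym (ℚ.*-assoc A A⁻¹ ε)) (trans (cong (_*ʳ ε) (ℚ.*-inverseʳ A {{>-nonZero 0<A}})) (ℚ.*-identityˡ ε))
    where
    A⁻¹ : ℚ
    A⁻¹ = (1/ A) {{>-nonZero 0<A}}
    0<A⁻¹ : 0ℚ <ʳ A⁻¹
    0<A⁻¹ = ℚ.positive⁻¹ A⁻¹ {{ℚ.1/pos⇒pos A {{positive 0<A}}}}

  bounded : ∀ {x} → Cauchy x → ∃ λ B → 0ℚ <ʳ B × ∃ λ N → ∀ n → N ℕ.≤ n → ∣ x n ∣ ≤ʳ B
  bounded {x} c with c 1ℚ 0<1
  ... | N , h = ∣ x N ∣ +ʳ 1ℚ , ℚ.<-≤-trans 0<1 (ℚ.≤-trans (ℚ.≤-reflexive (sym (ℚ.+-identityˡ 1ℚ))) (ℚ.+-monoˡ-≤ 1ℚ (ℚ.0≤∣p∣ (x N)))) , N , bound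
    where
    bound : ∀ n → N ℕ.≤ n → ∣ x n ∣ ≤ʳ ∣ x N ∣ +ʳ 1ℚ
    bound n N≤n = ℚ.≤-trans (ℚ.≤-reflexive (cong ∣_∣ (solve 2 (λ a b → a := b :+ (a :- b)) refl (x n) (x N))))
      (ℚ.≤-trans (ℚ.∣p+q∣≤∣p∣+∣q∣ (x N) (x n -ʳ x N)) (ℚ.+-monoʳ-≤ ∣ x N ∣ (h n N N≤n ℕ.≤-refl)))
      where open +-*-Solver

  const-cauchy : ∀ q → Cauchy (λ _ → q)
  const-cauchy q ε 0<ε = 0 , λ _ _ _ _ → subst (λ d → ∣ d ∣ ≤ʳ ε) (sym (ℚ.+-inverseʳ q)) (ℚ.<⇒≤ 0<ε)

  +-cauchy : ∀ x y → Cauchy x → Cauchy y → Cauchy (λ n → x n +ʳ y n)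
  +-cauchy x y cx cy ε 0<ε with cx (½ *ʳ ε) (0<½* 0<ε) | cy (½ *ʳ ε) (0<½* 0<ε)
  ... | N , hx | M , hy = N ℕ.⊔ M , λ m n p q →
    ℚ.≤-trans (ℚ.≤-reflexive (cong ∣_∣ (ring-sub-split (x m) (y m) (x n) (y n))))
    (ℚ.≤-trans (ℚ.∣p+q∣≤∣p∣+∣q∣ (x m -ʳ x n) (y m -ʳ y n))
    (ℚ.≤-trans (ℚ.+-mono-≤ (hx m n (ℕ.m⊔n≤o⇒m≤o N M p) (ℕ.m⊔n≤o⇒m≤o N M q))
                           (hy m n (ℕ.m⊔n≤o⇒n≤o N M p) (ℕ.m⊔n≤o⇒n≤o N M q)))
    (ℚ.≤-reflexive (½+½ ε))))

  *-cauchy : ∀ x y → Cauchy x → Cauchy y → Cauchy (λ n → x n *ʳ y n)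
  *-cauchy x y cx cy ε 0<ε =
    unpack (bounded cx) λ { A (0<A , N₁ , bx) →
    unpack (bounded cy) λ { B (0<B , N₂ , by) →
    unpack (scale A (½ *ʳ ε) 0<A (0<½* 0<ε)) λ { δ (0<δ , Aδ) →
    unpack (scale B (½ *ʳ ε) 0<B (0<½* 0<ε)) λ { η (0<η , Bη) →
    unpack (cy δ 0<δ) λ N₃ hy →
    unpack (cx η 0<η) λ N₄ hx →
    (N₁ ℕ.⊔ N₂) ℕ.⊔ (N₃ ℕ.⊔ N₄) , Bounds.bound A B N₁ N₂ 0<A 0<B bx by δ η Aδ Bη N₃ N₄ hy hx }}}}
    where
    module Bounds (A B : ℚ) (N₁ N₂ : ℕ) (0<A : 0ℚ <ʳ A) (0<B : 0ℚ <ʳ B)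
      (bx : ∀ n → N₁ ℕ.≤ n → ∣ x n ∣ ≤ʳ A) (by : ∀ n → N₂ ℕ.≤ n → ∣ y n ∣ ≤ʳ B)
      (δ η : ℚ) (Aδ : A *ʳ δ ≡ ½ *ʳ ε) (Bη : B *ʳ η ≡ ½ *ʳ ε) (N₃ N₄ : ℕ)
      (hy : ∀ m n → N₃ ℕ.≤ m → N₃ ℕ.≤ n → ∣ y m -ʳ y n ∣ ≤ʳ δ)
      (hx : ∀ m n → N₄ ℕ.≤ m → N₄ ℕ.≤ n → ∣ x m -ʳ x n ∣ ≤ʳ η) where
      left : ∀ m n → N₁ ℕ.≤ m → N₃ ℕ.≤ m → N₃ ℕ.≤ n → ∣ x m *ʳ (y m -ʳ y n) ∣ ≤ʳ ½ *ʳ ε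
      left m n p q r = begin
        ∣ x m *ʳ (y m -ʳ y n) ∣       ≡⟨ ℚ.∣p*q∣≡∣p∣*∣q∣ (x m) (y m -ʳ y n) ⟩
        ∣ x m ∣ *ʳ ∣ y m -ʳ y n ∣     ≤⟨ *-mono-≤ʳ {∣ x m ∣} {A} {∣ y m -ʳ y n ∣} {δ} (ℚ.<⇒≤ 0<A) (ℚ.0≤∣p∣ (y m -ʳ y n)) (bx m p) (hy m n q r) ⟩
        A *ʳ δ                        ≡⟨ Aδ ⟩
        ½ *ʳ ε                        ∎
        where open ℚ.≤-Reasoning
      right : ∀ m n → N₂ ℕ.≤ n → N₄ ℕ.≤ m → N₄ ℕ.≤ n → ∣ (x m -ʳ x n) *ʳ y n ∣ ≤ʳ ½ *ʳ ε
      right m n p q r = begin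
        ∣ (x m -ʳ x n) *ʳ y n ∣       ≡⟨ ℚ.∣p*q∣≡∣p∣*∣q∣ (x m -ʳ x n) (y n) ⟩
        ∣ x m -ʳ x n ∣ *ʳ ∣ y n ∣     ≡⟨ ℚ.*-comm ∣ x m -ʳ x n ∣ ∣ y n ∣ ⟩
        ∣ y n ∣ *ʳ ∣ x m -ʳ x n ∣     ≤⟨ *-mono-≤ʳ {∣ y n ∣} {B} {∣ x m -ʳ x n ∣} {η} (ℚ.<⇒≤ 0<B) (ℚ.0≤∣p∣ (x m -ʳ x n)) (by n p) (hx m n q r) ⟩
        B *ʳ η                        ≡⟨ Bη ⟩
        ½ *ʳ ε                        ∎
        where open ℚ.≤-Reasoning
      bound : ∀ m n → (N₁ ℕ.⊔ N₂) ℕ.⊔ (N₃ ℕ.⊔ N₄) ℕ.≤ m → (N₁ ℕ.⊔ N₂) ℕ.⊔ (N₃ ℕ.⊔ N₄) ℕ.≤ n →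
              ∣ x m *ʳ y m -ʳ x n *ʳ y n ∣ ≤ʳ ε
      bound m n p q = begin
        ∣ x m *ʳ y m -ʳ x n *ʳ y n ∣                            ≡⟨ cong ∣_∣ (ring-mul-split (x m) (y m) (x n) (y n)) ⟩
        ∣ x m *ʳ (y m -ʳ y n) +ʳ (x m -ʳ x n) *ʳ y n ∣          ≤⟨ ℚ.∣p+q∣≤∣p∣+∣q∣ (x m *ʳ (y m -ʳ y n)) ((x m -ʳ x n) *ʳ y n) ⟩
        ∣ x m *ʳ (y m -ʳ y n) ∣ +ʳ ∣ (x m -ʳ x n) *ʳ y n ∣      ≤⟨ ℚ.+-mono-≤ (left m n (ℕ.m⊔n≤o⇒m≤o N₁ N₂ p₁₂) (ℕ.m⊔n≤o⇒m≤o N₃ N₄ p₃₄) (ℕ.m⊔n≤o⇒m≤o N₃ N₄ q₃₄)) (right m n (ℕ.m⊔n≤o⇒n≤o N₁ N₂ q₁₂) (ℕ.m⊔n≤o⇒n≤o N₃ N₄ p₃₄) (ℕ.m⊔n≤o⇒n≤o N₃ N₄ q₃₄)) ⟩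
        ½ *ʳ ε +ʳ ½ *ʳ ε                                        ≡⟨ ½+½ ε ⟩
        ε                                                       ∎
        where
        open ℚ.≤-Reasoning
        p₁₂ : N₁ ℕ.⊔ N₂ ℕ.≤ m
        p₁₂ = ℕ.m⊔n≤o⇒m≤o (N₁ ℕ.⊔ N₂) (N₃ ℕ.⊔ N₄) p
        p₃₄ : N₃ ℕ.⊔ N₄ ℕ.≤ m
        p₃₄ = ℕ.m⊔n≤o⇒n≤o (N₁ ℕ.⊔ N₂) (N₃ ℕ.⊔ N₄) p
        q₁₂ : N₁ ℕ.⊔ N₂ ℕ.≤ n
        q₁₂ = ℕ.m⊔n≤o⇒m≤o (N₁ ℕ.⊔ N₂) (N₃ ℕ.⊔ N₄) q
        q₃₄ : N₃ ℕ.⊔ N₄ ℕ.≤ n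
        q₃₄ = ℕ.m⊔n≤o⇒n≤o (N₁ ℕ.⊔ N₂) (N₃ ℕ.⊔ N₄) q

  recip-inverse : ∀ {q} → 0ℚ <ʳ q → q *ʳ recip q ≡ 1ℚ
  recip-inverse {q} 0<q with q ℚ.≟ 0ℚ
  ... | yes q≡0 = contradiction (sym q≡0) (ℚ.<⇒≢ 0<q)
  ... | no  q≢0 = ℚ.*-inverseʳ q {{≢-nonZero q≢0}}

  recip-pos : ∀ {q} → 0ℚ <ʳ q → 0ℚ <ʳ recip q
  recip-pos {q} 0<q = ℚ.*-cancelˡ-<-nonNeg q {{nonNegative (ℚ.<⇒≤ 0<q)}}
    (subst₂ _<ʳ_ (sym (ℚ.*-zeroʳ q)) (sym (recip-inverse 0<q)) 0<1)

  recip-anti : ∀ {e q} → 0ℚ <ʳ e → e ≤ʳ q → recip q ≤ʳ recip e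
  recip-anti {e} {q} 0<e e≤q = ℚ.*-cancelˡ-≤-pos e {{positive 0<e}}
    (ℚ.≤-trans (ℚ.*-monoʳ-≤-nonNeg (recip q) {{nonNegative (ℚ.<⇒≤ (recip-pos 0<q))}} e≤q)
      (ℚ.≤-reflexive (trans (recip-inverse 0<q) (sym (recip-inverse 0<e)))))
    where
    0<q : 0ℚ <ʳ q
    0<q = ℚ.<-≤-trans 0<e e≤q

  recip-sub : ∀ {a b} → 0ℚ <ʳ a → 0ℚ <ʳ b → recip a -ʳ recip b ≡ (recip a *ʳ recip b) *ʳ (b -ʳ a)
  recip-sub {a} {b} 0<a 0<b = trans
    (cong₂ _-ʳ_ (trans (sym (ℚ.*-identityʳ r)) (cong (r *ʳ_) (sym (recip-inverse 0<b))))
                (trans (sym (ℚ.*-identityʳ s)) (cong (s *ʳ_) (sym (recip-inverse 0<a)))))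
    (solve 4 (λ a b r s → r :* (b :* s) :- s :* (a :* r) := (r :* s) :* (b :- a)) refl a b r s)
    where
    open +-*-Solver
    r s : ℚ
    r = recip a
    s = recip b

  recip-cauchy : ∀ x e → 0ℚ <ʳ e → ∀ N → (∀ n → N ℕ.≤ n → e ≤ʳ x n) → Cauchy x → Cauchy (λ n → recip (x n))
  recip-cauchy x e 0<e N e≤x cx ε 0<ε =
    unpack (scale (recip e *ʳ recip e) ε (0<* (recip-pos 0<e) (recip-pos 0<e)) 0<ε) λ { δ (0<δ , Aδ) →
    unpack (cx δ 0<δ) λ M hx →
    N ℕ.⊔ M , Bounds.bound δ Aδ M hx }
    where
    module Bounds (δ : ℚ) (Aδ : (recip e *ʳ recip e) *ʳ δ ≡ ε) (M : ℕ)
      (hx : ∀ m n → M ℕ.≤ m → M ℕ.≤ n → ∣ x m -ʳ x n ∣ ≤ʳ δ) where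
      bound : ∀ m n → N ℕ.⊔ M ℕ.≤ m → N ℕ.⊔ M ℕ.≤ n → ∣ recip (x m) -ʳ recip (x n) ∣ ≤ʳ ε
      bound m n p q = begin
          ∣ recip (x m) -ʳ recip (x n) ∣                          ≡⟨ cong ∣_∣ (recip-sub 0<xm 0<xn) ⟩
          ∣ (recip (x m) *ʳ recip (x n)) *ʳ (x n -ʳ x m) ∣        ≡⟨ ℚ.∣p*q∣≡∣p∣*∣q∣ (recip (x m) *ʳ recip (x n)) (x n -ʳ x m) ⟩
          ∣ recip (x m) *ʳ recip (x n) ∣ *ʳ ∣ x n -ʳ x m ∣        ≡⟨ cong (_*ʳ ∣ x n -ʳ x m ∣) (ℚ.0≤p⇒∣p∣≡p (ℚ.<⇒≤ (0<* (recip-pos 0<xm) (recip-pos 0<xn)))) ⟩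
          (recip (x m) *ʳ recip (x n)) *ʳ ∣ x n -ʳ x m ∣          ≤⟨ *-mono-≤ʳ (ℚ.<⇒≤ (0<* (recip-pos 0<e) (recip-pos 0<e))) (ℚ.0≤∣p∣ (x n -ʳ x m))
                                                                       (*-mono-≤ʳ (ℚ.<⇒≤ (recip-pos 0<e)) (ℚ.<⇒≤ (recip-pos 0<xn)) (recip-anti 0<e e≤xm) (recip-anti 0<e e≤xn))
                                                                       (hx n m (ℕ.m⊔n≤o⇒n≤o N M q) (ℕ.m⊔n≤o⇒n≤o N M p)) ⟩
          (recip e *ʳ recip e) *ʳ δ                               ≡⟨ Aδ ⟩
          ε                                                       ∎
        where
        open ℚ.≤-Reasoning
        e≤xm : e ≤ʳ x m
        e≤xm = e≤x m (ℕ.m⊔n≤o⇒m≤o N M p)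
        e≤xn : e ≤ʳ x n
        e≤xn = e≤x n (ℕ.m⊔n≤o⇒m≤o N M q)
        0<xm : 0ℚ <ʳ x m
        0<xm = ℚ.<-≤-trans 0<e e≤xm
        0<xn : 0ℚ <ʳ x n
        0<xn = ℚ.<-≤-trans 0<e e≤xn

  fromℕʳ-mono : ∀ {m n} → m ℕ.≤ n → fromℕʳ m ≤ʳ fromℕʳ n
  fromℕʳ-mono {m} {n} m≤n = ℚ.toℚᵘ-cancel-≤
    (ℚᵘ.≤-respˡ-≃ (ℚᵘ.≃-sym (ℚ.toℚᵘ-fromℚᵘ (mkℚᵘ (+ m) 0)))
    (ℚᵘ.≤-respʳ-≃ (ℚᵘ.≃-sym (ℚ.toℚᵘ-fromℚᵘ (mkℚᵘ (+ n) 0)))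
    (ℚᵘ.*≤* (ℤ.*-monoʳ-≤-nonNeg (+ 1) (ℤ.+≤+ m≤n)))))

  archimedean : ∀ p → ∃ λ N → p ≤ʳ fromℕʳ N
  archimedean p@(mkℚ a d _) = ℤ.∣ a ∣ , ℚ.toℚᵘ-cancel-≤
    (ℚᵘ.≤-respʳ-≃ (ℚᵘ.≃-sym (ℚ.toℚᵘ-fromℚᵘ (mkℚᵘ (+ ℤ.∣ a ∣) 0)))
    (ℚᵘ.*≤* (ℤ.≤-trans (ℤ.*-monoʳ-≤-nonNeg (+ 1) (i≤∣i∣ a))
                      (ℤ.*-monoˡ-≤-nonNeg (+ ℤ.∣ a ∣) (ℤ.+≤+ (ℕ.s≤s (ℕ.z≤n {d})))))))
    where
    i≤∣i∣ : ∀ i → i ℤ.≤ + ℤ.∣ i ∣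
    i≤∣i∣ (+ n)      = ℤ.≤-refl
    i≤∣i∣ ℤ.-[1+ n ] = ℤ.-≤+

  suc*1/suc : ∀ k → fromℕʳ (suc k) *ʳ (+ 1 /ʳ suc k) ≡ 1ℚ
  suc*1/suc k = ℚ.toℚᵘ-injective
    (ℚᵘ.≃-trans (ℚ.toℚᵘ-homo-* (fromℕʳ (suc k)) (+ 1 /ʳ suc k))
    (ℚᵘ.≃-trans (ℚᵘ.*-cong (ℚ.toℚᵘ-fromℚᵘ (mkℚᵘ (+ suc k) 0)) (ℚ.toℚᵘ-fromℚᵘ (mkℚᵘ (+ 1) k)))
    (ℚᵘ.*≡* (trans (ℤ.*-identityʳ _) (trans (ℤ.*-identityʳ _)
      (sym (trans (ℤ.*-identityˡ _) (cong +_ (ℕ.*-identityˡ (suc k))))))))))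

  0<1/suc : ∀ k → 0ℚ <ʳ + 1 /ʳ suc k
  0<1/suc k = ℚ.positive⁻¹ (+ 1 /ʳ suc k) {{ℚ.normalize-pos 1 (suc k)}}

  vanishing : ∀ B ε → 0ℚ <ʳ ε → ∃ λ N → ∀ k → N ℕ.≤ k → B *ʳ (+ 1 /ʳ suc k) ≤ʳ ε
  vanishing B ε 0<ε = unpack (archimedean (recip ε *ʳ B)) λ N h → N , bound N h
    where
    bound : ∀ N → recip ε *ʳ B ≤ʳ fromℕʳ N → ∀ k → N ℕ.≤ k → B *ʳ (+ 1 /ʳ suc k) ≤ʳ ε
    bound N h k N≤k = begin
      B *ʳ u                              ≡⟨ cong (_*ʳ u) (ℚ.*-identityˡ B) ⟨
      (1ℚ *ʳ B) *ʳ u                      ≡⟨ cong (λ z → (z *ʳ B) *ʳ u) (recip-inverse 0<ε) ⟨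
      ((ε *ʳ recip ε) *ʳ B) *ʳ u          ≡⟨ cong (_*ʳ u) (ℚ.*-assoc ε (recip ε) B) ⟩
      (ε *ʳ (recip ε *ʳ B)) *ʳ u          ≤⟨ ℚ.*-monoʳ-≤-nonNeg u {{nonNegative (ℚ.<⇒≤ (0<1/suc k))}}
                                               (ℚ.*-monoˡ-≤-nonNeg ε {{nonNegative (ℚ.<⇒≤ 0<ε)}}
                                                 (ℚ.≤-trans h (fromℕʳ-mono (ℕ.m≤n⇒m≤1+n N≤k)))) ⟩
      (ε *ʳ fromℕʳ (suc k)) *ʳ u          ≡⟨ ℚ.*-assoc ε (fromℕʳ (suc k)) u ⟩
      ε *ʳ (fromℕʳ (suc k) *ʳ u)          ≡⟨ cong (ε *ʳ_) (suc*1/suc k) ⟩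
      ε *ʳ 1ℚ                             ≡⟨ ℚ.*-identityʳ ε ⟩
      ε                                   ∎
      where
      open ℚ.≤-Reasoning
      u : ℚ
      u = + 1 /ʳ suc k

  module _ {M : ℚ} (0≤M : 0ℚ ≤ʳ M) where

    0≤expTerm : ∀ k → 0ℚ ≤ʳ expTerm M k
    0≤expTerm zero    = ℚ.<⇒≤ 0<1
    0≤expTerm (suc k) = 0≤* (0≤expTerm k) (0≤* 0≤M (ℚ.<⇒≤ (0<1/suc k)))

    ∣expTerm∣≤ : ∀ {q} → ∣ q ∣ ≤ʳ M → ∀ k → ∣ expTerm q k ∣ ≤ʳ expTerm M k
    ∣expTerm∣≤ {q} q≤M zero    = ℚ.≤-refl
    ∣expTerm∣≤ {q} q≤M (suc k) = ℚ.≤-trans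
      (ℚ.≤-reflexive (trans (ℚ.∣p*q∣≡∣p∣*∣q∣ (expTerm q k) (q *ʳ u))
        (cong (∣ expTerm q k ∣ *ʳ_) (trans (ℚ.∣p*q∣≡∣p∣*∣q∣ q u) (cong (∣ q ∣ *ʳ_) (ℚ.0≤p⇒∣p∣≡p 0≤u))))))
      (*-mono-≤ʳ (0≤expTerm k) (0≤* (ℚ.0≤∣p∣ q) 0≤u) (∣expTerm∣≤ q≤M k)
        (ℚ.*-monoʳ-≤-nonNeg u {{nonNegative 0≤u}} q≤M))
      where
      u : ℚ
      u = + 1 /ʳ suc k
      0≤u : 0ℚ ≤ʳ u
      0≤u = ℚ.<⇒≤ (0<1/suc k)

    Halving : ℕ → Set
    Halving N = ∀ k → N ℕ.≤ k → expTerm M (suc k) +ʳ expTerm M (suc k) ≤ʳ expTerm M k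

    halving : ∃ Halving
    halving = unpack (vanishing M ½ (ℚ.positive⁻¹ ½)) λ N h → N , bound N h
      where
      bound : ∀ N → (∀ k → N ℕ.≤ k → M *ʳ (+ 1 /ʳ suc k) ≤ʳ ½) → Halving N
      bound N h k N≤k = begin
        expTerm M (suc k) +ʳ expTerm M (suc k)          ≤⟨ ℚ.+-mono-≤ t≤ t≤ ⟩
        expTerm M k *ʳ ½ +ʳ expTerm M k *ʳ ½            ≡⟨ ℚ.*-distribˡ-+ (expTerm M k) ½ ½ ⟨
        expTerm M k *ʳ (½ +ʳ ½)                         ≡⟨ ℚ.*-identityʳ (expTerm M k) ⟩
        expTerm M k                                     ∎
        where
        open ℚ.≤-Reasoning
        t≤ : expTerm M (suc k) ≤ʳ expTerm M k *ʳ ½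
        t≤ = ℚ.*-monoˡ-≤-nonNeg (expTerm M k) {{nonNegative (0≤expTerm k)}} (h k N≤k)

    tail : ∀ N → Halving N →
           ∀ {q} → ∣ q ∣ ≤ʳ M → ∀ K → N ℕ.≤ K → ∀ j →
           ∣ expSum q (j ℕ.+ K) -ʳ expSum q K ∣ +ʳ (expTerm M (j ℕ.+ K) +ʳ expTerm M (j ℕ.+ K)) ≤ʳ
           expTerm M K +ʳ expTerm M K
    tail N h {q} q≤M K N≤K zero = ℚ.≤-reflexive
      (trans (cong (λ d → ∣ d ∣ +ʳ (expTerm M K +ʳ expTerm M K)) (ℚ.+-inverseʳ (expSum q K))) (ℚ.+-identityˡ _))
    tail N h {q} q≤M K N≤K (suc j) = ℚ.≤-trans
      (ℚ.+-mono-≤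
        (ℚ.≤-trans (ℚ.≤-reflexive (cong ∣_∣
            (solve 3 (λ s t r → (s :+ t) :- r := (s :- r) :+ t) refl (expSum q m) (expTerm q m) (expSum q K))))
          (ℚ.≤-trans (ℚ.∣p+q∣≤∣p∣+∣q∣ (expSum q m -ʳ expSum q K) (expTerm q m))
            (ℚ.+-monoʳ-≤ ∣ expSum q m -ʳ expSum q K ∣ (∣expTerm∣≤ q≤M m))))
        (h m (ℕ.≤-trans N≤K (ℕ.m≤n+m K j))))
      (ℚ.≤-trans (ℚ.≤-reflexive (ℚ.+-assoc ∣ expSum q m -ʳ expSum q K ∣ (expTerm M m) (expTerm M m)))
        (tail N h q≤M K N≤K j))
      where
      open +-*-Solver
      m : ℕ
      m = j ℕ.+ K

    term-bound : ∀ N → Halving N →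
                 ∀ j → expTerm M (j ℕ.+ N) ≤ʳ expTerm M N
    term-bound N h zero    = ℚ.≤-refl
    term-bound N h (suc j) = ℚ.≤-trans
      (ℚ.≤-trans (ℚ.≤-reflexive (sym (ℚ.+-identityʳ _))) (ℚ.+-monoʳ-≤ (expTerm M (suc j ℕ.+ N)) (0≤expTerm (suc j ℕ.+ N))))
      (ℚ.≤-trans (h (j ℕ.+ N) (ℕ.m≤n+m N j)) (term-bound N h j))

    uniform : ∀ ε → 0ℚ <ʳ ε → ∃ λ K → ∀ q → ∣ q ∣ ≤ʳ M → ∀ m → K ℕ.≤ m → ∣ expSum q m -ʳ expSum q K ∣ ≤ʳ ε
    uniform ε 0<ε =
      unpack halving λ N h →
      unpack (vanishing (expTerm M N *ʳ M) (½ *ʳ ε) (0<½* 0<ε)) λ L small →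
      suc (L ℕ.+ N) , Bounds.bound N h L small
      where
      module Bounds (N : ℕ) (h : Halving N) (L : ℕ)
        (small : ∀ k → L ℕ.≤ k → expTerm M N *ʳ M *ʳ (+ 1 /ʳ suc k) ≤ʳ ½ *ʳ ε) where
        k₀ : ℕ
        k₀ = L ℕ.+ N
        u : ℚ
        u = + 1 /ʳ suc k₀
        last≤ : expTerm M (suc k₀) ≤ʳ ½ *ʳ ε
        last≤ = ℚ.≤-trans
          (ℚ.*-monoʳ-≤-nonNeg (M *ʳ u) {{nonNegative (0≤* 0≤M (ℚ.<⇒≤ (0<1/suc k₀)))}} (term-bound N h L))
          (ℚ.≤-trans (ℚ.≤-reflexive (sym (ℚ.*-assoc (expTerm M N) M u))) (small k₀ (ℕ.m≤m+n L N)))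
        bound : ∀ q → ∣ q ∣ ≤ʳ M → ∀ m → suc k₀ ℕ.≤ m → ∣ expSum q m -ʳ expSum q (suc k₀) ∣ ≤ʳ ε
        bound q q≤M m K≤m = subst (λ i → ∣ expSum q i -ʳ expSum q (suc k₀) ∣ ≤ʳ ε) (ℕ.m∸n+n≡m K≤m)
          (ℚ.≤-trans
            (ℚ.≤-trans (ℚ.≤-reflexive (sym (ℚ.+-identityʳ _)))
              (ℚ.+-monoʳ-≤ ∣ expSum q (j ℕ.+ suc k₀) -ʳ expSum q (suc k₀) ∣
                (ℚ.+-mono-≤ (0≤expTerm (j ℕ.+ suc k₀)) (0≤expTerm (j ℕ.+ suc k₀)))))
            (ℚ.≤-trans (tail N h q≤M (suc k₀) (ℕ.m≤n⇒m≤1+n (ℕ.m≤n+m N L)) j)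
              (ℚ.≤-trans (ℚ.+-mono-≤ last≤ last≤) (ℚ.≤-reflexive (½+½ ε)))))
          where
          j : ℕ
          j = m ℕ.∸ suc k₀

  expTerm-cauchy : ∀ x → Cauchy x → ∀ k → Cauchy (λ n → expTerm (x n) k)
  expTerm-cauchy x c zero    = const-cauchy 1ℚ
  expTerm-cauchy x c (suc k) =
    *-cauchy (λ n → expTerm (x n) k) (λ n → x n *ʳ (+ 1 /ʳ suc k)) (expTerm-cauchy x c k)
      (*-cauchy x (λ _ → + 1 /ʳ suc k) c (const-cauchy (+ 1 /ʳ suc k)))

  expSum-cauchy : ∀ x → Cauchy x → ∀ K → Cauchy (λ n → expSum (x n) K)
  expSum-cauchy x c zero    = const-cauchy 0ℚ
  expSum-cauchy x c (suc K) =
    +-cauchy (λ n → expSum (x n) K) (λ n → expTerm (x n) K) (expSum-cauchy x c K) (expTerm-cauchy x c K)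

  exp-cauchy : ∀ x → Cauchy x → Cauchy (λ n → expSum (x n) n)
  exp-cauchy x c ε 0<ε =
    unpack (bounded c) λ { B (0<B , N₁ , bx) →
    unpack (uniform (ℚ.<⇒≤ 0<B) (½ *ʳ (½ *ʳ ε)) (0<½* (0<½* 0<ε))) λ K tails →
    unpack (expSum-cauchy x c K (½ *ʳ ε) (0<½* 0<ε)) λ N₂ head →
    (N₁ ℕ.⊔ N₂) ℕ.⊔ K , Bounds.bound B N₁ bx K tails N₂ head }
    where
    module Bounds (B : ℚ) (N₁ : ℕ) (bx : ∀ n → N₁ ℕ.≤ n → ∣ x n ∣ ≤ʳ B) (K : ℕ)
      (tails : ∀ q → ∣ q ∣ ≤ʳ B → ∀ m → K ℕ.≤ m → ∣ expSum q m -ʳ expSum q K ∣ ≤ʳ ½ *ʳ (½ *ʳ ε)) (N₂ : ℕ)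
      (head : ∀ m n → N₂ ℕ.≤ m → N₂ ℕ.≤ n → ∣ expSum (x m) K -ʳ expSum (x n) K ∣ ≤ʳ ½ *ʳ ε) where
      bound : ∀ m n → (N₁ ℕ.⊔ N₂) ℕ.⊔ K ℕ.≤ m → (N₁ ℕ.⊔ N₂) ℕ.⊔ K ℕ.≤ n →
              ∣ expSum (x m) m -ʳ expSum (x n) n ∣ ≤ʳ ε
      bound m n p q = ℚ.≤-trans
        (triangle (expSum (x m) m) (expSum (x m) K) (expSum (x n) n)
          (tails (x m) (bx m (ℕ.m⊔n≤o⇒m≤o N₁ N₂ p₁₂)) m (ℕ.m⊔n≤o⇒n≤o (N₁ ℕ.⊔ N₂) K p))
          (triangle (expSum (x m) K) (expSum (x n) K) (expSum (x n) n)
            (head m n (ℕ.m⊔n≤o⇒n≤o N₁ N₂ p₁₂) (ℕ.m⊔n≤o⇒n≤o N₁ N₂ q₁₂))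
            (ℚ.≤-trans (ℚ.≤-reflexive (∣-∣-sym (expSum (x n) K) (expSum (x n) n)))
              (tails (x n) (bx n (ℕ.m⊔n≤o⇒m≤o N₁ N₂ q₁₂)) n (ℕ.m⊔n≤o⇒n≤o (N₁ ℕ.⊔ N₂) K q)))))
        (ℚ.≤-reflexive (trans (solve 2 (λ a b → a :+ (b :+ a) := (a :+ a) :+ b) refl (½ *ʳ (½ *ʳ ε)) (½ *ʳ ε))
          (trans (cong (_+ʳ ½ *ʳ ε) (½+½ (½ *ʳ ε))) (½+½ ε))))
        where
        open +-*-Solver
        p₁₂ : N₁ ℕ.⊔ N₂ ℕ.≤ m
        p₁₂ = ℕ.m⊔n≤o⇒m≤o (N₁ ℕ.⊔ N₂) K p
        q₁₂ : N₁ ℕ.⊔ N₂ ℕ.≤ n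
        q₁₂ = ℕ.m⊔n≤o⇒m≤o (N₁ ℕ.⊔ N₂) K q

open Estimates

fromℕ : ℕ → ℝ
fromℕ n = mkℝ (λ _ → fromℕʳ n) (const-cauchy (fromℕʳ n))

0ℝ 1ℝ : ℝ
0ℝ = fromℕ 0
1ℝ = fromℕ 1

infixl 7 _*_ _/_[_]
infixr 8 _^_

_*_ : ℝ → ℝ → ℝ
x * y = mkℝ (λ n → seq x n *ʳ seq y n) (*-cauchy (seq x) (seq y) (cauchy x) (cauchy y))

_^_ : ℝ → ℕ → ℝ
x ^ zero  = 1ℝ
x ^ suc n = x * x ^ n

inv : (x : ℝ) → 0ℝ < x → ℝ
seq    (inv x _) n = recip (seq x n)
cauchy (inv x (ε , 0<ε , N , h)) =
  recip-cauchy (seq x) ε 0<ε N (λ n N≤n → subst (_≤ʳ seq x n) (ℚ.+-identityˡ ε) (h n N≤n)) (cauchy x)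

_/_[_] : (x y : ℝ) → 0ℝ < y → ℝ
x / y [ 0<y ] = x * inv y 0<y

exp : ℝ → ℝ
exp x = mkℝ (λ n → expSum (seq x n) n) (exp-cauchy (seq x) (cauchy x))

-- IsLog y x says that y = log x: the logarithm of x is defined, and y is the
-- real number with exp y = x.
record IsLog (y x : ℝ) : Set where
  field
    positive-arg : 0ℝ < x
    exp-log      : exp y ≈ x

open IsLog public

1<⇒0< : ∀ x → 1ℝ < x → 0ℝ < x
1<⇒0< x (ε , 0<ε , N , h) = ε , 0<ε , N , λ n N≤n →
  ℚ.≤-trans (ℚ.+-monoˡ-≤ ε (ℚ.<⇒≤ 0<1)) (h n N≤n)

*-pos : ∀ x y → 0ℝ < x → 0ℝ < y → 0ℝ < x * y
*-pos x y (ε , 0<ε , N , h) (δ , 0<δ , M , g) = ε *ʳ δ , 0<* 0<ε 0<δ , N ℕ.⊔ M , λ n p →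
  let ε≤ = subst (_≤ʳ seq x n) (ℚ.+-identityˡ ε) (h n (ℕ.m⊔n≤o⇒m≤o N M p))
      δ≤ = subst (_≤ʳ seq y n) (ℚ.+-identityˡ δ) (g n (ℕ.m⊔n≤o⇒n≤o N M p))
  in ℚ.≤-trans (ℚ.≤-reflexive (ℚ.+-identityˡ (ε *ʳ δ)))
       (*-mono-≤ʳ (ℚ.≤-trans (ℚ.<⇒≤ 0<ε) ε≤) (ℚ.<⇒≤ 0<δ) ε≤ δ≤)

-- Only equality of coordinates matters, so ℤ/Dℤ is represented by its set of
-- residues Fin D.
ℤ/_^_ : ℕ → ℕ → Set
ℤ/ D ^ n = Vec (Fin D) n

record Sunflower {D n : ℕ} (x y z : ℤ/ D ^ n) : Set where
  field
    x≢y : x ≢ y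
    y≢z : y ≢ z
    x≢z : x ≢ z
    coordinates : ∀ i →
      (lookup x i ≡ lookup y i × lookup y i ≡ lookup z i) ⊎
      (lookup x i ≢ lookup y i × lookup y i ≢ lookup z i × lookup x i ≢ lookup z i)

-- A family is a list without repetitions.
record Family (D n : ℕ) : Set where
  field
    members : List (ℤ/ D ^ n)
    unique  : Unique members

open Family public

∥_∥ : ∀ {D n} → Family D n → ℕ
∥ F ∥ = length (members F)

SunflowerFree : ∀ {D n} → Family D n → Set
SunflowerFree F = ∀ {x y z} → x ∈ members F → y ∈ members F → z ∈ members F → ¬ Sunflower x y z

{-# OPTIONS --safe #-}

-- Passing to a link, one may assume that F is spread: at most |F| / r^|S| members contain a given set S. Colour the
-- points at random with six colours and reserve a pair of colour classes U, V for each of the three petals. For a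
-- member A let S ⊆ A ∖ U be minimal such that U ∪ S contains a member. After recolouring S by U, the set S is a subset
-- of a member chosen from the new colouring alone; together with spreadness this makes |S| > t very rare, for t and r
-- of order n / log n. Repeating the argument with V and the remaining sets S, |S| ≤ t, already makes every nonempty
-- fragment unlikely. Hence some colouring has, for each of the three pairs, a member inside U ∪ V, and these members
-- are disjoint. So a sunflower-free family has size at most (C n / log n)ⁿ. Since eᵉ is not an integer, log log log n
-- is bounded away from 0, and log log n = o(log n) makes the bound smaller than the claimed one.
module Submission where

-- Two rounds are used because a single one loses the logarithm. After recolouring, the fragments
-- inside a fixed set T have total relative weight at most the sum of m^(-|S|) over the admissible S
-- ⊆ T. For nonempty S this is (1 + 1/m)^|T| - 1, which is small only when m is a large multiple of
-- |T|; with |T| = n that would force m of order n and a bound no better than Cⁿ n!. For |S| > t the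
-- weight is at most 2ⁿ / m^(t+1), small once m^t exceeds 2ⁿ, so t of order n / log n suffices. The
-- first round thus shortens T from n to t, and the second only needs m ≥ 8t. Expectations are
-- written as sums over all colourings, cleared of denominators. There are six ways to fail, two
-- rounds for each of three petals; each gets average weight at most |F| / 7, so together they stay
-- below |F|.

module Combinatorics where

  open import Defs using (ℤ/_^_; Family; members; unique; ∥_∥; Sunflower; SunflowerFree)
  open import Data.Bool.Base using (true; false; if_then_else_)
  open import Data.Bool.Properties using (∨-zeroʳ; ∨-identityʳ)
  open import Data.Fin using (#_)
  open import Data.Fin.Base using (Fin; zero; suc; combine)
  import Data.Fin.Properties as Fin
  open import Data.Fin.Subset renaming (_∈_ to _∈ₛ_) hiding (_-_; ⊤; _∉_)
  open import Data.Fin.Subset.Properties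
  open import Data.List.Base using (List; []; _∷_; map; _++_; length; filter; allFin; cartesianProductWith)
  open import Data.List.Extrema.Nat using (argmax; f[xs]≤f[argmax])
  open import Data.List.Membership.Propositional using (_∈_; find; lose)
  open import Data.List.Membership.Propositional.Properties
    using (∈-cartesianProductWith⁺; ∈-filter⁺; ∈-filter⁻; ∈-allFin; ∈-map⁻)
  open import Data.List.Properties using (length-map)
  import Data.List.Relation.Unary.All as All
  open import Data.List.Relation.Unary.AllPairs using ([]; _∷_)
  open import Data.List.Relation.Unary.All using ([]; _∷_)
  open import Data.List.Relation.Unary.Any as Any using (Any; here; there; any?)
  open import Data.List.Relation.Unary.Unique.Propositional using (Unique)
  import Data.List.Relation.Unary.Unique.Propositional.Properties as Unique
  open import Data.Nat.Base
  open import Data.Nat.DivMod using (_/_; m/n*n≤m; m≡m%n+[m/n]*n; m%n≤n)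
  open import Data.Nat.Induction using (<-wellFounded)
  open import Data.Nat.ListAction using (sum)
  open import Data.Nat.Properties
  open import Data.Nat.Tactic.RingSolver using (solve-∀)
  open import Data.Product using (∃; _×_; _,_; proj₁; proj₂)
  open import Data.Sum.Base using (_⊎_; inj₁; inj₂)
  open import Data.Vec.Base as Vec using (Vec; []; _∷_; zipWith; lookup; concat; here; there)
  open import Data.Vec.Properties
    using ([]=⇒lookup; lookup⇒[]=; lookup-++ˡ; lookup-++ʳ; tabulate∘lookup; tabulate-cong)
  open import Function.Base using (_∘_; case_of_)
  open import Induction.WellFounded using (Acc; acc)
  open import Level using (0ℓ)
  open import Relation.Binary.PropositionalEquality
  open import Relation.Nullary using (¬_; Dec; yes; no; does; contradiction)
  open import Relation.Nullary.Decidable using (_×-dec_)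
  open import Relation.Unary using (Pred; Decidable)

  private variable
    X Y P Q : Set
    N n D q : ℕ

  -- Indicators and finite sums

  ⟦_⟧ : Dec P → ℕ
  ⟦ p? ⟧ = if does p? then 1 else 0

  ⟦⟧-mono : (p? : Dec P) (q? : Dec Q) → (P → Q) → ⟦ p? ⟧ ≤ ⟦ q? ⟧
  ⟦⟧-mono (no _)  _       _   = z≤n
  ⟦⟧-mono (yes _) (yes _) _   = ≤-refl
  ⟦⟧-mono (yes p) (no ¬q) P⇒Q = contradiction (P⇒Q p) ¬q

  ⟦⟧-yes : (p? : Dec P) → P → ⟦ p? ⟧ ≡ 1
  ⟦⟧-yes (yes _) _ = refl
  ⟦⟧-yes (no ¬p) p = contradiction p ¬p

  ⟦⟧-no : (p? : Dec P) → ¬ P → ⟦ p? ⟧ ≡ 0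
  ⟦⟧-no (no _)  _  = refl
  ⟦⟧-no (yes p) ¬p = contradiction p ¬p

  ⟦⟧*-≤ : (p? : Dec P) {x y : ℕ} → (P → x ≤ y) → ⟦ p? ⟧ * x ≤ y
  ⟦⟧*-≤ (yes p) {x} h = ≤-trans (≤-reflexive (*-identityˡ x)) (h p)
  ⟦⟧*-≤ (no _)      h = z≤n

  ∑ : List X → (X → ℕ) → ℕ
  ∑ xs f = sum (map f xs)

  ∑-mono : (xs : List X) {f g : X → ℕ} → (∀ x → f x ≤ g x) → ∑ xs f ≤ ∑ xs g
  ∑-mono []       h = z≤n
  ∑-mono (x ∷ xs) h = +-mono-≤ (h x) (∑-mono xs h)

  ∑-cong : (xs : List X) {f g : X → ℕ} → (∀ x → f x ≡ g x) → ∑ xs f ≡ ∑ xs g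
  ∑-cong []       h = refl
  ∑-cong (x ∷ xs) h = cong₂ _+_ (h x) (∑-cong xs h)

  ∑-++ : (xs ys : List X) (f : X → ℕ) → ∑ (xs ++ ys) f ≡ ∑ xs f + ∑ ys f
  ∑-++ []       ys f = refl
  ∑-++ (x ∷ xs) ys f = trans (cong (f x +_) (∑-++ xs ys f)) (sym (+-assoc (f x) _ _))

  ∑-map : (h : X → Y) (xs : List X) (f : Y → ℕ) → ∑ (map h xs) f ≡ ∑ xs (f ∘ h)
  ∑-map h []       f = refl
  ∑-map h (x ∷ xs) f = cong (f (h x) +_) (∑-map h xs f)

  ∑-+ : (xs : List X) (f g : X → ℕ) → ∑ xs (λ x → f x + g x) ≡ ∑ xs f + ∑ xs g
  ∑-+ []       f g = refl
  ∑-+ (x ∷ xs) f g = trans (cong (f x + g x +_) (∑-+ xs f g)) (exchange (f x) (g x) _ _)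
    where
    exchange : ∀ a b c d → a + b + (c + d) ≡ a + c + (b + d)
    exchange = solve-∀

  ∑-*ˡ : (xs : List X) (k : ℕ) (f : X → ℕ) → ∑ xs (λ x → k * f x) ≡ k * ∑ xs f
  ∑-*ˡ []       k f = sym (*-zeroʳ k)
  ∑-*ˡ (x ∷ xs) k f = trans (cong (k * f x +_) (∑-*ˡ xs k f)) (sym (*-distribˡ-+ k (f x) _))

  ∑-*ʳ : (xs : List X) (k : ℕ) (f : X → ℕ) → ∑ xs (λ x → f x * k) ≡ ∑ xs f * k
  ∑-*ʳ xs k f = trans (∑-cong xs (λ x → *-comm (f x) k)) (trans (∑-*ˡ xs k f) (*-comm k _))

  ∑-0 : (xs : List X) → ∑ xs (λ _ → 0) ≡ 0
  ∑-0 []       = refl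
  ∑-0 (_ ∷ xs) = ∑-0 xs

  ∑-swap : (xs : List X) (ys : List Y) (f : X → Y → ℕ) → ∑ xs (λ x → ∑ ys (f x)) ≡ ∑ ys (λ y → ∑ xs (λ x → f x y))
  ∑-swap []       ys f = sym (∑-0 ys)
  ∑-swap (x ∷ xs) ys f = trans (cong (∑ ys (f x) +_) (∑-swap xs ys f)) (sym (∑-+ ys (f x) _))

  ∑-const : (xs : List X) (k : ℕ) → ∑ xs (λ _ → k) ≡ length xs * k
  ∑-const []       k = refl
  ∑-const (_ ∷ xs) k = cong (k +_) (∑-const xs k)

  ∑-∈ : {x : X} {xs : List X} (f : X → ℕ) → x ∈ xs → f x ≤ ∑ xs f
  ∑-∈ f (here refl)                = m≤m+n _ _
  ∑-∈ f (there {x = y} x∈xs) = ≤-trans (∑-∈ f x∈xs) (m≤n+m _ (f y))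

  -- Sums over vectors, recolourings and subsets

  vecs : List X → ∀ N → List (Vec X N)
  vecs xs zero    = [] ∷ []
  vecs xs (suc N) = cartesianProductWith _∷_ xs (vecs xs N)

  ∑-vecs : (xs : List X) (f : Vec X (suc N) → ℕ) → ∑ (vecs xs (suc N)) f ≡ ∑ xs (λ x → ∑ (vecs xs N) (λ v → f (x ∷ v)))
  ∑-vecs {N = N} xs f = go xs
    where
    go : ∀ ys → ∑ (cartesianProductWith _∷_ ys (vecs xs N)) f ≡ ∑ ys (λ x → ∑ (vecs xs N) (λ v → f (x ∷ v)))
    go []       = refl
    go (y ∷ ys) = trans (∑-++ (map (y ∷_) (vecs xs N)) _ f)
      (cong₂ _+_ (∑-map (y ∷_) (vecs xs N) f) (go ys))

  ∑-vecs-const : (xs : List X) (N k : ℕ) → ∑ (vecs xs N) (λ _ → k) ≡ length xs ^ N * k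
  ∑-vecs-const xs zero    k = refl
  ∑-vecs-const xs (suc N) k = begin
    ∑ (vecs xs (suc N)) (λ _ → k)              ≡⟨ ∑-vecs xs (λ _ → k) ⟩
    ∑ xs (λ _ → ∑ (vecs xs N) (λ _ → k))       ≡⟨ ∑-const xs _ ⟩
    length xs * ∑ (vecs xs N) (λ _ → k)        ≡⟨ cong (length xs *_) (∑-vecs-const xs N k) ⟩
    length xs * (length xs ^ N * k)            ≡⟨ *-assoc (length xs) (length xs ^ N) k ⟨
    length xs ^ suc N * k                      ∎
    where open ≡-Reasoning

  recolour : Vec X N → Subset N → X → Vec X N
  recolour c S v = zipWith (λ a s → if s then v else a) c S

  -- Recolouring forgets only the old colours on `S`, so each colouring arises from at most
  -- `length xs ^ ∣ S ∣` others.
  ∑-recolour : {v : X} {xs : List X} → v ∈ xs → (S : Subset N) (f : Vec X N → ℕ) →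
               ∑ (vecs xs N) (λ c → f (recolour c S v)) ≤ length xs ^ ∣ S ∣ * ∑ (vecs xs N) f
  ∑-recolour {xs = xs} v∈xs [] f = ≤-reflexive (sym (*-identityˡ _))
  ∑-recolour {N = suc N} {v = v} {xs = xs} v∈xs (outside ∷ S) f = begin
    ∑ (vecs xs (suc N)) (λ c → f (recolour c (outside ∷ S) v))          ≡⟨ ∑-vecs xs _ ⟩
    ∑ xs (λ x → ∑ (vecs xs N) (λ c → f (x ∷ recolour c S v)))           ≤⟨ ∑-mono xs (λ x → ∑-recolour v∈xs S (λ c → f (x ∷ c))) ⟩
    ∑ xs (λ x → length xs ^ ∣ S ∣ * ∑ (vecs xs N) (λ c → f (x ∷ c)))    ≡⟨ ∑-*ˡ xs (length xs ^ ∣ S ∣) _ ⟩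
    length xs ^ ∣ S ∣ * ∑ xs (λ x → ∑ (vecs xs N) (λ c → f (x ∷ c)))    ≡⟨ cong (length xs ^ ∣ S ∣ *_) (∑-vecs xs f) ⟨
    length xs ^ ∣ S ∣ * ∑ (vecs xs (suc N)) f                           ∎
    where open ≤-Reasoning
  ∑-recolour {N = suc N} {v = v} {xs = xs} v∈xs (inside ∷ S) f = begin
    ∑ (vecs xs (suc N)) (λ c → f (recolour c (inside ∷ S) v))                     ≡⟨ ∑-vecs xs _ ⟩
    ∑ xs (λ _ → ∑ (vecs xs N) (λ c → f (v ∷ recolour c S v)))                     ≡⟨ ∑-const xs _ ⟩
    length xs * ∑ (vecs xs N) (λ c → f (v ∷ recolour c S v))                      ≤⟨ *-monoʳ-≤ (length xs) (∑-recolour v∈xs S (λ c → f (v ∷ c))) ⟩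
    length xs * (length xs ^ ∣ S ∣ * ∑ (vecs xs N) (λ c → f (v ∷ c)))             ≤⟨ *-monoʳ-≤ (length xs) (*-monoʳ-≤ (length xs ^ ∣ S ∣) (∑-∈ (λ x → ∑ (vecs xs N) (λ c → f (x ∷ c))) v∈xs)) ⟩
    length xs * (length xs ^ ∣ S ∣ * ∑ xs (λ x → ∑ (vecs xs N) (λ c → f (x ∷ c)))) ≡⟨ cong (λ k → length xs * (length xs ^ ∣ S ∣ * k)) (∑-vecs xs f) ⟨
    length xs * (length xs ^ ∣ S ∣ * ∑ (vecs xs (suc N)) f)                       ≡⟨ *-assoc (length xs) _ _ ⟨
    length xs ^ ∣ inside ∷ S ∣ * ∑ (vecs xs (suc N)) f                            ∎
    where open ≤-Reasoning

  subsets : ∀ N → List (Subset N)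
  subsets = vecs (outside ∷ inside ∷ [])

  ∑-subsets : (f : Subset (suc N) → ℕ) →
              ∑ (subsets (suc N)) f ≡ ∑ (subsets N) (λ S → f (outside ∷ S)) + ∑ (subsets N) (λ S → f (inside ∷ S))
  ∑-subsets f = trans (∑-vecs (outside ∷ inside ∷ []) f) (cong (∑ (subsets _) (λ S → f (outside ∷ S)) +_) (+-identityʳ _))

  ∈-subsets : (S : Subset N) → S ∈ subsets N
  ∈-subsets []            = here refl
  ∈-subsets (outside ∷ S) = ∈-cartesianProductWith⁺ _∷_ {xs = outside ∷ inside ∷ []} (here refl) (∈-subsets S)
  ∈-subsets (inside ∷ S)  = ∈-cartesianProductWith⁺ _∷_ {xs = outside ∷ inside ∷ []} (there (here refl)) (∈-subsets S)

  -- The binomial theorem. The weight m^(-|S|) is scaled by m^|T| to stay in ℕ; m = 1 counts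
  -- subsets.
  ∑-⊆ : (m : ℕ) (T : Subset N) → ∑ (subsets N) (λ S → ⟦ S ⊆? T ⟧ * m ^ ∣ T ─ S ∣) ≤ (m + 1) ^ ∣ T ∣
  ∑-⊆ m []            = ≤-refl
  ∑-⊆ {N = suc N} m (outside ∷ T) = begin
    ∑ (subsets (suc N)) (λ S → ⟦ S ⊆? (outside ∷ T) ⟧ * m ^ ∣ (outside ∷ T) ─ S ∣)    ≡⟨ ∑-subsets {N = N} _ ⟩
    ∑ (subsets N) (λ S → ⟦ (outside ∷ S) ⊆? (outside ∷ T) ⟧ * m ^ ∣ T ─ S ∣) +
      ∑ (subsets N) (λ S → ⟦ (inside ∷ S) ⊆? (outside ∷ T) ⟧ * m ^ ∣ T ─ S ∣)         ≤⟨ +-mono-≤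
        (∑-mono (subsets N) (λ S → *-monoˡ-≤ (m ^ ∣ T ─ S ∣) (⟦⟧-mono ((outside ∷ S) ⊆? (outside ∷ T)) (S ⊆? T) drop-∷-⊆)))
        (≤-reflexive (trans (∑-cong (subsets N) (λ S → cong (_* m ^ ∣ T ─ S ∣) (⟦⟧-no ((inside ∷ S) ⊆? (outside ∷ T)) λ S⊆T → case S⊆T here of λ ()))) (∑-0 (subsets N)))) ⟩
    ∑ (subsets N) (λ S → ⟦ S ⊆? T ⟧ * m ^ ∣ T ─ S ∣) + 0                              ≡⟨ +-identityʳ _ ⟩
    ∑ (subsets N) (λ S → ⟦ S ⊆? T ⟧ * m ^ ∣ T ─ S ∣)                                  ≤⟨ ∑-⊆ m T ⟩
    (m + 1) ^ ∣ T ∣                                                                   ∎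
    where open ≤-Reasoning
  ∑-⊆ {N = suc N} m (inside ∷ T) = begin
    ∑ (subsets (suc N)) (λ S → ⟦ S ⊆? (inside ∷ T) ⟧ * m ^ ∣ (inside ∷ T) ─ S ∣)      ≡⟨ ∑-subsets {N = N} _ ⟩
    ∑ (subsets N) (λ S → ⟦ (outside ∷ S) ⊆? (inside ∷ T) ⟧ * (m * m ^ ∣ T ─ S ∣)) +
      ∑ (subsets N) (λ S → ⟦ (inside ∷ S) ⊆? (inside ∷ T) ⟧ * m ^ ∣ T ─ S ∣)          ≤⟨ +-mono-≤
        (∑-mono (subsets N) (λ S → ≤-trans (*-monoˡ-≤ (m * m ^ ∣ T ─ S ∣) (⟦⟧-mono ((outside ∷ S) ⊆? (inside ∷ T)) (S ⊆? T) drop-∷-⊆)) (≤-reflexive (pull ⟦ S ⊆? T ⟧ m _))))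
        (∑-mono (subsets N) (λ S → *-monoˡ-≤ (m ^ ∣ T ─ S ∣) (⟦⟧-mono ((inside ∷ S) ⊆? (inside ∷ T)) (S ⊆? T) drop-∷-⊆))) ⟩
    ∑ (subsets N) (λ S → m * (⟦ S ⊆? T ⟧ * m ^ ∣ T ─ S ∣)) + Σ′                        ≡⟨ cong (_+ Σ′) (∑-*ˡ (subsets N) m _) ⟩
    m * Σ′ + Σ′                                                                       ≡⟨ cong (m * Σ′ +_) (*-identityˡ Σ′) ⟨
    m * Σ′ + 1 * Σ′                                                                   ≡⟨ *-distribʳ-+ Σ′ m 1 ⟨
    (m + 1) * Σ′                                                                      ≤⟨ *-monoʳ-≤ (m + 1) (∑-⊆ m T) ⟩
    (m + 1) * (m + 1) ^ ∣ T ∣                                                         ∎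
    where
    open ≤-Reasoning
    Σ′ : ℕ
    Σ′ = ∑ (subsets N) (λ S → ⟦ S ⊆? T ⟧ * m ^ ∣ T ─ S ∣)
    pull : ∀ a b c → a * (b * c) ≡ b * (a * c)
    pull = solve-∀

  -- Splits off the empty set: this is the subtracted 1 in (1 + 1/m)^|T| - 1, kept on the left to
  -- avoid truncated subtraction.
  ∑-nonempty : (g : Subset N → ℕ) → ∑ (subsets N) (λ S → ⟦ nonempty? S ⟧ * g S) + g ⊥ ≤ ∑ (subsets N) g
  ∑-nonempty {N = zero} g = ≤-reflexive (trans (cong (λ k → k * g [] + 0 + g []) (⟦⟧-no (nonempty? []) λ ())) (+-comm 0 (g [])))
  ∑-nonempty {N = suc N} g = begin
    ∑ (subsets (suc N)) (λ S → ⟦ nonempty? S ⟧ * g S) + g ⊥      ≡⟨ cong (_+ g ⊥) (∑-subsets {N = N} _) ⟩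
    out + inn + g ⊥                                              ≤⟨ +-monoˡ-≤ (g ⊥) (+-mono-≤
        (∑-mono (subsets N) (λ S → *-monoˡ-≤ (g (outside ∷ S)) (⟦⟧-mono (nonempty? (outside ∷ S)) (nonempty? S) λ { (suc i , there i∈S) → i , i∈S })))
        (∑-mono (subsets N) (λ S → ⟦⟧*-≤ (nonempty? (inside ∷ S)) (λ _ → ≤-refl)))) ⟩
    out′ + ∑ (subsets N) (λ S → g (inside ∷ S)) + g ⊥            ≡⟨ exchange out′ _ (g ⊥) ⟩
    out′ + g ⊥ + ∑ (subsets N) (λ S → g (inside ∷ S))            ≤⟨ +-monoˡ-≤ _ (∑-nonempty (λ S → g (outside ∷ S))) ⟩
    ∑ (subsets N) (λ S → g (outside ∷ S)) + ∑ (subsets N) (λ S → g (inside ∷ S))  ≡⟨ ∑-subsets g ⟨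
    ∑ (subsets (suc N)) g                                        ∎
    where
    open ≤-Reasoning
    out inn out′ : ℕ
    out  = ∑ (subsets N) (λ S → ⟦ nonempty? (outside ∷ S) ⟧ * g (outside ∷ S))
    inn  = ∑ (subsets N) (λ S → ⟦ nonempty? (inside ∷ S) ⟧ * g (inside ∷ S))
    out′ = ∑ (subsets N) (λ S → ⟦ nonempty? S ⟧ * g (outside ∷ S))
    exchange : ∀ a b c → a + b + c ≡ a + c + b
    exchange = solve-∀

  ∑-mono-∈ : (xs : List X) {f g : X → ℕ} → (∀ {x} → x ∈ xs → f x ≤ g x) → ∑ xs f ≤ ∑ xs g
  ∑-mono-∈ []       h = z≤n
  ∑-mono-∈ (x ∷ xs) h = +-mono-≤ (h (here refl)) (∑-mono-∈ xs (h ∘ there))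

  -- Fragments

  -- The value ⊥ when no member fits is harmless: choose is used through upper bounds on its size.
  choose : List (Subset N) → Subset N → Subset N
  choose []      Z = ⊥
  choose (T ∷ G) Z = if does (T ⊆? Z) then T else choose G Z

  choose-∈ : (G : List (Subset N)) (Z : Subset N) → Any (_⊆ Z) G → choose G Z ∈ G × choose G Z ⊆ Z
  choose-∈ (T ∷ G) Z fits with T ⊆? Z | fits
  ... | yes T⊆Z | _          = here refl , T⊆Z
  ... | no  T⊈Z | here T⊆Z   = contradiction (λ {x} → T⊆Z {x}) T⊈Z
  ... | no  _   | there fits′ with choose-∈ G Z fits′
  ...   | ∈G , ⊆Z = there ∈G , ⊆Z

  ∣choose∣≤ : ∀ {k} (G : List (Subset N)) (Z : Subset N) → (∀ {T} → T ∈ G → ∣ T ∣ ≤ k) → ∣ choose G Z ∣ ≤ k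
  ∣choose∣≤ {N = N} []      Z h = ≤-trans (≤-reflexive (∣⊥∣≡0 N)) z≤n
  ∣choose∣≤ (T ∷ G) Z h with does (T ⊆? Z)
  ... | true  = h (here refl)
  ... | false = ∣choose∣≤ G Z (h ∘ there)

  ∪-monoʳ : (W : Subset N) {S T : Subset N} → S ⊆ T → W ∪ S ⊆ W ∪ T
  ∪-monoʳ W {S} S⊆T x∈ with x∈p∪q⁻ W S x∈
  ... | inj₁ x∈W = x∈p∪q⁺ (inj₁ x∈W)
  ... | inj₂ x∈S = x∈p∪q⁺ (inj₂ (S⊆T x∈S))

  -- Take S inclusion-minimal such that W ∪ S contains a member of G.
  fragment : (G : List (Subset N)) (W S₀ : Subset N) → Any (_⊆ W ∪ S₀) G →
             ∃ λ S → S ⊆ S₀ × S ⊆ choose G (W ∪ S) × Any (_⊆ W ∪ S) G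
  fragment {N = N} G W S₀ = go S₀ (<-wellFounded ∣ S₀ ∣)
    where
    go : ∀ S₀ → Acc _<_ ∣ S₀ ∣ → Any (_⊆ W ∪ S₀) G →
         ∃ λ S → S ⊆ S₀ × S ⊆ choose G (W ∪ S) × Any (_⊆ W ∪ S) G
    go S₀ (acc rec) fits with nonempty? (S₀ ∩ ∁ (choose G (W ∪ S₀)))
    -- The search stops as soon as `S₀` lies inside the member chosen from `W ∪ S₀`, the consequence
    -- of minimality that the counting uses.
    ... | no  empty = S₀ , (λ x∈ → x∈) , (λ x∈S₀ → x∉∁p⇒x∈p λ x∈∁T → empty (_ , x∈p∩q⁺ (x∈S₀ , x∈∁T))) , fits
    ... | yes nonempty =
      let S , S⊆S₁ , rest = go S₁ (rec (p∩q≢∅⇒∣p─q∣<∣p∣ S₀ (∁ T) nonempty)) (lose (proj₁ chosen) T⊆W∪S₁)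
      in S , (λ x∈S → p─q⊆p S₀ (∁ T) (S⊆S₁ x∈S)) , rest
      where
      T S₁ : Subset N
      T = choose G (W ∪ S₀)
      -- This is S₀ ∩ T; the form of a difference gives the strict descent in cardinality.
      S₁ = S₀ ─ ∁ T
      chosen : T ∈ G × T ⊆ W ∪ S₀
      chosen = choose-∈ G (W ∪ S₀) fits
      T⊆W∪S₁ : T ⊆ W ∪ S₁
      T⊆W∪S₁ x∈T with x∈p∪q⁻ W S₀ (proj₂ chosen x∈T)
      ... | inj₁ x∈W  = x∈p∪q⁺ (inj₁ x∈W)
      ... | inj₂ x∈S₀ = x∈p∪q⁺ (inj₂ (x∈p∧x∉q⇒x∈p─q x∈S₀ (x∈p⇒x∉∁p x∈T)))

  -- Colour classes

  class : Vec (Fin q) N → Fin q → Subset N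
  class c u = Vec.map (λ a → does (a Fin.≟ u)) c

  does-≟-refl : (u : Fin q) → does (u Fin.≟ u) ≡ true
  does-≟-refl u with u Fin.≟ u
  ... | yes _  = refl
  ... | no u≢u = contradiction refl u≢u

  does-≟-≢ : {a u : Fin q} → a ≢ u → does (a Fin.≟ u) ≡ false
  does-≟-≢ {a = a} {u} a≢u with a Fin.≟ u
  ... | yes a≡u = contradiction a≡u a≢u
  ... | no _    = refl

  -- Makes the union `class c v ∪ S` visible in the new colouring, so that the member chosen from it
  -- can be found without knowing `S`.
  class-recolour : (c : Vec (Fin q) N) (S : Subset N) (v : Fin q) → class (recolour c S v) v ≡ class c v ∪ S
  class-recolour []      []            v = refl
  class-recolour (a ∷ c) (inside  ∷ S) v = cong₂ _∷_ (trans (does-≟-refl v) (sym (∨-zeroʳ _))) (class-recolour c S v)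
  class-recolour (a ∷ c) (outside ∷ S) v = cong₂ _∷_ (sym (∨-identityʳ _)) (class-recolour c S v)

  -- For the second round: its fragments avoid the class U of the first round, so painting them with
  -- `v` leaves U, and everything computed from U, intact.
  class-recolour-≢ : (c : Vec (Fin q) N) (S : Subset N) {u v : Fin q} → u ≢ v → Empty (S ∩ class c u) →
                     class (recolour c S v) u ≡ class c u
  class-recolour-≢ []      []            u≢v empty = refl
  class-recolour-≢ (a ∷ c) (outside ∷ S) u≢v empty =
    cong (_ ∷_) (class-recolour-≢ c S u≢v λ (i , i∈) → empty (suc i , there i∈))
  class-recolour-≢ (a ∷ c) (inside  ∷ S) {u} u≢v empty with a Fin.≟ u
  ... | yes _ = contradiction (zero , here) empty
  ... | no _  = cong₂ _∷_ (does-≟-≢ (u≢v ∘ sym)) (class-recolour-≢ c S u≢v λ (i , i∈) → empty (suc i , there i∈))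

  ∈-class : (c : Vec (Fin q) N) {u : Fin q} {x : Fin N} → x ∈ₛ class c u → lookup c x ≡ u
  ∈-class (a ∷ c) {u} {zero} x∈ with a Fin.≟ u | x∈
  ... | yes a≡u | _ = a≡u
  ... | no _    | ()
  ∈-class (a ∷ c) {x = suc x} (there x∈) = ∈-class c x∈

  ^-distribʳ-* : ∀ k m n → (m * n) ^ k ≡ m ^ k * n ^ k
  ^-distribʳ-* zero    m n = refl
  ^-distribʳ-* (suc k) m n = trans (cong (m * n *_) (^-distribʳ-* k m n)) (interchange m n (m ^ k) (n ^ k))
    where
    interchange : ∀ a b c d → a * b * (c * d) ≡ a * c * (b * d)
    interchange = solve-∀

  x∈p─q⇒x∉q : (p q : Subset N) {x : Fin N} → x ∈ₛ p ─ q → ¬ x ∈ₛ q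
  x∈p─q⇒x∉q (_ ∷ p) (outside ∷ q) (there x∈) (there x∈q) = x∈p─q⇒x∉q p q x∈ x∈q
  x∈p─q⇒x∉q (_ ∷ p) (inside  ∷ q) (there x∈) (there x∈q) = x∈p─q⇒x∉q p q x∈ x∈q

  -- With m = τ + a this reads (1 + 1/m)^τ ≤ m / (m - τ). The induction trades a unit of `τ` for a
  -- unit of `a`, so m stays fixed, and each step is (m + 1) a ≤ m (a + 1).
  pow-ratio : ∀ τ a → (τ + a + 1) ^ τ * a ≤ (τ + a) ^ suc τ
  pow-ratio zero    a = ≤-reflexive (*-comm 1 a)
  pow-ratio (suc τ) a = begin
    (suc τ + a + 1) * (suc τ + a + 1) ^ τ * a     ≡⟨ rearrange (suc τ + a + 1) ((suc τ + a + 1) ^ τ) a ⟩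
    (suc τ + a + 1) ^ τ * ((suc τ + a + 1) * a)   ≤⟨ *-monoʳ-≤ ((suc τ + a + 1) ^ τ) step ⟩
    (suc τ + a + 1) ^ τ * ((suc τ + a) * suc a)   ≡⟨ rearrange′ ((suc τ + a + 1) ^ τ) (suc τ + a) (suc a) ⟩
    (suc τ + a) * ((suc τ + a + 1) ^ τ * suc a)   ≡⟨ cong (λ m → m * ((m + 1) ^ τ * suc a)) (+-suc τ a) ⟨
    (τ + suc a) * ((τ + suc a + 1) ^ τ * suc a)   ≤⟨ *-monoʳ-≤ (τ + suc a) (pow-ratio τ (suc a)) ⟩
    (τ + suc a) * (τ + suc a) ^ suc τ             ≡⟨ cong (λ m → m ^ suc (suc τ)) (+-suc τ a) ⟩
    (suc τ + a) ^ suc (suc τ)                     ∎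
    where
    open ≤-Reasoning
    rearrange : ∀ x y z → x * y * z ≡ y * (x * z)
    rearrange = solve-∀
    rearrange′ : ∀ x y z → x * (y * z) ≡ y * (x * z)
    rearrange′ = solve-∀
    expandˡ : ∀ τ a → (1 + τ + a + 1) * a ≡ (1 + τ + a) * a + a
    expandˡ = solve-∀
    expandʳ : ∀ τ a → (1 + τ + a) * a + (1 + τ + a) ≡ (1 + τ + a) * (1 + a)
    expandʳ = solve-∀
    step : (suc τ + a + 1) * a ≤ (suc τ + a) * suc a
    step = begin
      (suc τ + a + 1) * a                 ≡⟨ expandˡ τ a ⟩
      (suc τ + a) * a + a                 ≤⟨ +-monoʳ-≤ ((suc τ + a) * a) (m≤n+m a (suc τ)) ⟩
      (suc τ + a) * a + (suc τ + a)       ≡⟨ expandʳ τ a ⟩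
      (suc τ + a) * suc a                 ∎

  -- For 8τ ≤ m the ratio m / (m - τ) is at most 8/7.
  7*[m+1]^τ≤8*m^τ : ∀ m τ .{{_ : NonZero m}} → 8 * τ ≤ m → 7 * (m + 1) ^ τ ≤ 8 * m ^ τ
  7*[m+1]^τ≤8*m^τ m τ 8τ≤m = *-cancelʳ-≤ _ _ m (begin
    7 * (m + 1) ^ τ * m              ≡⟨ rearrange ((m + 1) ^ τ) m ⟩
    (m + 1) ^ τ * (7 * m)            ≤⟨ *-monoʳ-≤ ((m + 1) ^ τ) 7m≤8a ⟩
    (m + 1) ^ τ * (8 * (m ∸ τ))      ≡⟨ rearrange₂ ((m + 1) ^ τ) (m ∸ τ) ⟩
    8 * ((m + 1) ^ τ * (m ∸ τ))      ≤⟨ *-monoʳ-≤ 8 (subst (λ k → (k + 1) ^ τ * (m ∸ τ) ≤ k ^ suc τ) τ+a≡m (pow-ratio τ (m ∸ τ))) ⟩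
    8 * (m * m ^ τ)                  ≡⟨ rearrange₃ m (m ^ τ) ⟩
    8 * m ^ τ * m                    ∎)
    where
    open ≤-Reasoning
    rearrange : ∀ x m → 7 * x * m ≡ x * (7 * m)
    rearrange = solve-∀
    rearrange₂ : ∀ x y → x * (8 * y) ≡ 8 * (x * y)
    rearrange₂ = solve-∀
    rearrange₃ : ∀ x y → 8 * (x * y) ≡ 8 * y * x
    rearrange₃ = solve-∀
    split : ∀ x → 8 * x ≡ x + 7 * x
    split = solve-∀
    τ+a≡m : τ + (m ∸ τ) ≡ m
    τ+a≡m = m+[n∸m]≡n (≤-trans (m≤m+n τ (7 * τ)) (≤-trans (≤-reflexive (sym (split τ))) 8τ≤m))
    7m≤8a : 7 * m ≤ 8 * (m ∸ τ)
    7m≤8a = +-cancelˡ-≤ m _ _ (begin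
      m + 7 * m                  ≡⟨ split m ⟨
      8 * m                      ≡⟨ cong (8 *_) τ+a≡m ⟨
      8 * (τ + (m ∸ τ))          ≡⟨ *-distribˡ-+ 8 τ (m ∸ τ) ⟩
      8 * τ + 8 * (m ∸ τ)        ≤⟨ +-monoˡ-≤ _ 8τ≤m ⟩
      m + 8 * (m ∸ τ)            ∎)

  ∣T∣≡∣S∣+∣T─S∣ : (S T : Subset N) → S ⊆ T → ∣ T ∣ ≡ ∣ S ∣ + ∣ T ─ S ∣
  ∣T∣≡∣S∣+∣T─S∣ []            []            S⊆T = refl
  ∣T∣≡∣S∣+∣T─S∣ (outside ∷ S) (outside ∷ T) S⊆T = ∣T∣≡∣S∣+∣T─S∣ S T (drop-∷-⊆ S⊆T)
  ∣T∣≡∣S∣+∣T─S∣ (outside ∷ S) (inside  ∷ T) S⊆T = trans (cong suc (∣T∣≡∣S∣+∣T─S∣ S T (drop-∷-⊆ S⊆T))) (sym (+-suc ∣ S ∣ _))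
  ∣T∣≡∣S∣+∣T─S∣ (inside  ∷ S) (inside  ∷ T) S⊆T = cong suc (∣T∣≡∣S∣+∣T─S∣ S T (drop-∷-⊆ S⊆T))
  ∣T∣≡∣S∣+∣T─S∣ (inside  ∷ S) (outside ∷ T) S⊆T with S⊆T here
  ... | ()

  -- Spread families contain three disjoint members

  degree : List (Subset N) → Subset N → ℕ
  degree F S = ∑ F (λ A → ⟦ S ⊆? A ⟧)

  -- Union bound: every member is charged to one of its own subsets `S` with b S ≥ 1, and `S`
  -- receives at most `degree F S` charges.
  length≤∑-degree : (F : List (Subset N)) (b : Subset N → ℕ) →
                    (∀ {A} → A ∈ F → ∃ λ S → S ⊆ A × 1 ≤ b S) →
                    length F ≤ ∑ (subsets N) (λ S → b S * degree F S)
  length≤∑-degree {N = N} F b cover = begin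
    length F                                                    ≡⟨ *-identityʳ (length F) ⟨
    length F * 1                                                ≡⟨ ∑-const F 1 ⟨
    ∑ F (λ _ → 1)                                               ≤⟨ ∑-mono-∈ F one ⟩
    ∑ F (λ A → ∑ (subsets N) (λ S → b S * ⟦ S ⊆? A ⟧))          ≡⟨ ∑-swap F (subsets N) _ ⟩
    ∑ (subsets N) (λ S → ∑ F (λ A → b S * ⟦ S ⊆? A ⟧))          ≡⟨ ∑-cong (subsets N) (λ S → ∑-*ˡ F (b S) _) ⟩
    ∑ (subsets N) (λ S → b S * degree F S)                      ∎
    where
    open ≤-Reasoning
    one : ∀ {A} → A ∈ F → 1 ≤ ∑ (subsets N) (λ S → b S * ⟦ S ⊆? A ⟧)
    one {A} A∈F with cover A∈F
    ... | S , S⊆A , 1≤b = begin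
      1                                              ≤⟨ 1≤b ⟩
      b S                                            ≡⟨ *-identityʳ (b S) ⟨
      b S * 1                                        ≡⟨ cong (b S *_) (⟦⟧-yes (S ⊆? A) S⊆A) ⟨
      b S * ⟦ S ⊆? A ⟧                               ≤⟨ ∑-∈ (λ S → b S * ⟦ S ⊆? A ⟧) (∈-subsets S) ⟩
      ∑ (subsets N) (λ S → b S * ⟦ S ⊆? A ⟧)         ∎

  colourings : ∀ N → List (Vec (Fin 6) N)
  colourings = vecs (allFin 6)

  -- Exchanging the sums fixes `S`, so the recolouring can be undone at the price 6 ^ ∣ S ∣. On the
  -- right, `S` ranges over subsets of one set `τ c` that no longer depends on `S`.
  ∑-fragments : (w : Subset N → ℕ) (v : Fin 6) (τ : Vec (Fin 6) N → Subset N) →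
    ∑ (colourings N) (λ c → ∑ (subsets N) (λ S → w S * ⟦ S ⊆? τ (recolour c S v) ⟧)) ≤
    ∑ (colourings N) (λ c → ∑ (subsets N) (λ S → w S * 6 ^ ∣ S ∣ * ⟦ S ⊆? τ c ⟧))
  ∑-fragments {N = N} w v τ = begin
    ∑ (colourings N) (λ c → ∑ (subsets N) (λ S → w S * ⟦ S ⊆? τ (recolour c S v) ⟧))   ≡⟨ ∑-swap (colourings N) (subsets N) _ ⟩
    ∑ (subsets N) (λ S → ∑ (colourings N) (λ c → w S * ⟦ S ⊆? τ (recolour c S v) ⟧))   ≤⟨ ∑-mono (subsets N) fixed ⟩
    ∑ (subsets N) (λ S → ∑ (colourings N) (λ c → w S * 6 ^ ∣ S ∣ * ⟦ S ⊆? τ c ⟧))      ≡⟨ ∑-swap (colourings N) (subsets N) _ ⟨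
    ∑ (colourings N) (λ c → ∑ (subsets N) (λ S → w S * 6 ^ ∣ S ∣ * ⟦ S ⊆? τ c ⟧))      ∎
    where
    open ≤-Reasoning
    fixed : ∀ S → ∑ (colourings N) (λ c → w S * ⟦ S ⊆? τ (recolour c S v) ⟧) ≤
                  ∑ (colourings N) (λ c → w S * 6 ^ ∣ S ∣ * ⟦ S ⊆? τ c ⟧)
    fixed S = begin
      ∑ (colourings N) (λ c → w S * ⟦ S ⊆? τ (recolour c S v) ⟧)     ≡⟨ ∑-*ˡ (colourings N) (w S) _ ⟩
      w S * ∑ (colourings N) (λ c → ⟦ S ⊆? τ (recolour c S v) ⟧)     ≤⟨ *-monoʳ-≤ (w S) (∑-recolour (∈-allFin v) S (λ c → ⟦ S ⊆? τ c ⟧)) ⟩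
      w S * (6 ^ ∣ S ∣ * ∑ (colourings N) (λ c → ⟦ S ⊆? τ c ⟧))      ≡⟨ *-assoc (w S) (6 ^ ∣ S ∣) _ ⟨
      w S * 6 ^ ∣ S ∣ * ∑ (colourings N) (λ c → ⟦ S ⊆? τ c ⟧)        ≡⟨ ∑-*ˡ (colourings N) (w S * 6 ^ ∣ S ∣) _ ⟨
      ∑ (colourings N) (λ c → w S * 6 ^ ∣ S ∣ * ⟦ S ⊆? τ c ⟧)        ∎

  -- Spreadness is required at 6 * m: the 6 pays for recolouring and leaves the weight m^(-|S|). The
  -- last two hypotheses bound the second and the first round, respectively, by a seventh.
  module Spread (F : List (Subset N)) (k t m : ℕ) .{{_ : NonZero m}}
    (∣A∣≤k : ∀ {A} → A ∈ F → ∣ A ∣ ≤ k)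
    (spread : ∀ S → degree F S * (6 * m) ^ ∣ S ∣ ≤ length F)
    (8t≤m : 8 * t ≤ m) (7*2^k≤m^1+t : 7 * 2 ^ k ≤ m ^ suc t) where

    M : ℕ
    M = length F

    d : Subset N → ℕ
    d = degree F

    w₁ w₂ : Subset N → ℕ
    w₁ S = ⟦ t <? ∣ S ∣ ⟧ * d S
    w₂ S = ⟦ nonempty? S ⟧ * d S

    spread′ : ∀ S → d S * 6 ^ ∣ S ∣ * m ^ ∣ S ∣ ≤ M
    spread′ S = begin
      d S * 6 ^ ∣ S ∣ * m ^ ∣ S ∣       ≡⟨ *-assoc (d S) _ _ ⟩
      d S * (6 ^ ∣ S ∣ * m ^ ∣ S ∣)     ≡⟨ cong (d S *_) (^-distribʳ-* ∣ S ∣ 6 m) ⟨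
      d S * (6 * m) ^ ∣ S ∣             ≤⟨ spread S ⟩
      M                                 ∎
      where open ≤-Reasoning

    -- Each counted `S` has more than t elements and so weighs at most M / m^(t+1); `T` has at most
    -- 2^k subsets.
    ∑-w₁ : (T : Subset N) → ∣ T ∣ ≤ k → 7 * ∑ (subsets N) (λ S → w₁ S * 6 ^ ∣ S ∣ * ⟦ S ⊆? T ⟧) ≤ M
    ∑-w₁ T ∣T∣≤k = *-cancelˡ-≤ (2 ^ k) {{m^n≢0 2 k}} (begin
      2 ^ k * (7 * s)                                                       ≡⟨ rearrange (2 ^ k) s ⟩
      7 * 2 ^ k * s                                                         ≤⟨ *-monoˡ-≤ s 7*2^k≤m^1+t ⟩
      m ^ suc t * s                                                         ≡⟨ ∑-*ˡ (subsets N) (m ^ suc t) _ ⟨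
      ∑ (subsets N) (λ S → m ^ suc t * (w₁ S * 6 ^ ∣ S ∣ * ⟦ S ⊆? T ⟧))     ≤⟨ ∑-mono (subsets N) term ⟩
      ∑ (subsets N) (λ S → ⟦ S ⊆? T ⟧ * 1 ^ ∣ T ─ S ∣ * M)                  ≡⟨ ∑-*ʳ (subsets N) M _ ⟩
      ∑ (subsets N) (λ S → ⟦ S ⊆? T ⟧ * 1 ^ ∣ T ─ S ∣) * M                  ≤⟨ *-monoˡ-≤ M (≤-trans (∑-⊆ 1 T) (^-monoʳ-≤ 2 ∣T∣≤k)) ⟩
      2 ^ k * M                                                             ∎)
      where
      open ≤-Reasoning
      s : ℕ
      s = ∑ (subsets N) (λ S → w₁ S * 6 ^ ∣ S ∣ * ⟦ S ⊆? T ⟧)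
      rearrange : ∀ x y → x * (7 * y) ≡ 7 * x * y
      rearrange = solve-∀
      regroup : ∀ p b x y z → p * (b * x * y * z) ≡ z * (b * (x * y * p))
      regroup = solve-∀
      term : ∀ S → m ^ suc t * (w₁ S * 6 ^ ∣ S ∣ * ⟦ S ⊆? T ⟧) ≤ ⟦ S ⊆? T ⟧ * 1 ^ ∣ T ─ S ∣ * M
      term S = begin
        m ^ suc t * (⟦ t <? ∣ S ∣ ⟧ * d S * 6 ^ ∣ S ∣ * ⟦ S ⊆? T ⟧)       ≡⟨ regroup (m ^ suc t) ⟦ t <? ∣ S ∣ ⟧ (d S) (6 ^ ∣ S ∣) ⟦ S ⊆? T ⟧ ⟩
        ⟦ S ⊆? T ⟧ * (⟦ t <? ∣ S ∣ ⟧ * (d S * 6 ^ ∣ S ∣ * m ^ suc t))     ≤⟨ *-monoʳ-≤ ⟦ S ⊆? T ⟧ (⟦⟧*-≤ (t <? ∣ S ∣) λ t<∣S∣ →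
                                                                              ≤-trans (*-monoʳ-≤ (d S * 6 ^ ∣ S ∣) (^-monoʳ-≤ m t<∣S∣)) (spread′ S)) ⟩
        ⟦ S ⊆? T ⟧ * M                                                    ≡⟨ cong (_* M) (*-identityʳ ⟦ S ⊆? T ⟧) ⟨
        ⟦ S ⊆? T ⟧ * 1 * M                                                ≡⟨ cong (λ e → ⟦ S ⊆? T ⟧ * e * M) (^-zeroˡ ∣ T ─ S ∣) ⟨
        ⟦ S ⊆? T ⟧ * 1 ^ ∣ T ─ S ∣ * M                                    ∎

    -- The nonempty subsets of `T` weigh at most M ((1 + 1/m)^|T| - 1) ≤ M / 7. The summand 7 * (M *
    -- p) added on both sides is the contribution of the empty set.
    ∑-w₂ : (T : Subset N) → ∣ T ∣ ≤ t → 7 * ∑ (subsets N) (λ S → w₂ S * 6 ^ ∣ S ∣ * ⟦ S ⊆? T ⟧) ≤ M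
    ∑-w₂ T ∣T∣≤t = *-cancelˡ-≤ p {{m^n≢0 m ∣ T ∣}} (+-cancelʳ-≤ (7 * (M * p)) _ _ (begin
      p * (7 * s) + 7 * (M * p)                                             ≡⟨ rearrange p s M ⟩
      7 * (p * s + M * p)                                                   ≡⟨ cong (λ e → 7 * (e + M * p)) (∑-*ˡ (subsets N) p _) ⟨
      7 * (∑ (subsets N) (λ S → p * (w₂ S * 6 ^ ∣ S ∣ * ⟦ S ⊆? T ⟧)) + M * p)
                                                                            ≤⟨ *-monoʳ-≤ 7 (+-mono-≤ (∑-mono (subsets N) term) (≤-reflexive (cong (M *_) (sym g⊥)))) ⟩
      7 * (∑ (subsets N) (λ S → M * (⟦ nonempty? S ⟧ * g S)) + M * g ⊥)     ≡⟨ cong (λ e → 7 * (e + M * g ⊥)) (∑-*ˡ (subsets N) M _) ⟩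
      7 * (M * ∑ (subsets N) (λ S → ⟦ nonempty? S ⟧ * g S) + M * g ⊥)       ≡⟨ cong (7 *_) (*-distribˡ-+ M _ (g ⊥)) ⟨
      7 * (M * (∑ (subsets N) (λ S → ⟦ nonempty? S ⟧ * g S) + g ⊥))         ≤⟨ *-monoʳ-≤ 7 (*-monoʳ-≤ M (≤-trans (∑-nonempty g) (∑-⊆ m T))) ⟩
      7 * (M * (m + 1) ^ ∣ T ∣)                                             ≡⟨ swap M _ ⟩
      M * (7 * (m + 1) ^ ∣ T ∣)                                             ≤⟨ *-monoʳ-≤ M (7*[m+1]^τ≤8*m^τ m ∣ T ∣ (≤-trans (*-monoʳ-≤ 8 ∣T∣≤t) 8t≤m)) ⟩
      M * (8 * p)                                                           ≡⟨ rearrange₂ M p ⟩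
      p * M + 7 * (M * p)                                                   ∎))
      where
      open ≤-Reasoning
      s p : ℕ
      s = ∑ (subsets N) (λ S → w₂ S * 6 ^ ∣ S ∣ * ⟦ S ⊆? T ⟧)
      p = m ^ ∣ T ∣
      g : Subset N → ℕ
      g S = ⟦ S ⊆? T ⟧ * m ^ ∣ T ─ S ∣
      g⊥ : g ⊥ ≡ p
      g⊥ = trans (cong₂ _*_ (⟦⟧-yes (⊥ ⊆? T) ⊥⊆) (cong (λ R → m ^ ∣ R ∣) (p─⊥≡p T))) (*-identityˡ p)
      rearrange : ∀ p s M → p * (7 * s) + 7 * (M * p) ≡ 7 * (p * s + M * p)
      rearrange = solve-∀
      rearrange₂ : ∀ M p → M * (8 * p) ≡ p * M + 7 * (M * p)
      rearrange₂ = solve-∀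
      swap : ∀ M x → 7 * (M * x) ≡ M * (7 * x)
      swap = solve-∀
      regroup : ∀ p b x y z → p * (b * x * y * z) ≡ z * (p * (b * (x * y)))
      regroup = solve-∀
      regroup₂ : ∀ a b p → p * (b * a) ≡ b * (a * p)
      regroup₂ = solve-∀
      regroup₃ : ∀ z b M q → z * (b * (M * q)) ≡ M * (b * (z * q))
      regroup₃ = solve-∀
      term : ∀ S → p * (w₂ S * 6 ^ ∣ S ∣ * ⟦ S ⊆? T ⟧) ≤ M * (⟦ nonempty? S ⟧ * g S)
      term S = begin
        p * (⟦ nonempty? S ⟧ * d S * 6 ^ ∣ S ∣ * ⟦ S ⊆? T ⟧)              ≡⟨ regroup p ⟦ nonempty? S ⟧ (d S) (6 ^ ∣ S ∣) ⟦ S ⊆? T ⟧ ⟩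
        ⟦ S ⊆? T ⟧ * (p * (⟦ nonempty? S ⟧ * (d S * 6 ^ ∣ S ∣)))          ≤⟨ guarded (S ⊆? T) ⟩
        ⟦ S ⊆? T ⟧ * (⟦ nonempty? S ⟧ * (M * m ^ ∣ T ─ S ∣))              ≡⟨ regroup₃ ⟦ S ⊆? T ⟧ ⟦ nonempty? S ⟧ M (m ^ ∣ T ─ S ∣) ⟩
        M * (⟦ nonempty? S ⟧ * (⟦ S ⊆? T ⟧ * m ^ ∣ T ─ S ∣))              ∎
        where
        guarded : (S⊆?T : Dec (S ⊆ T)) → ⟦ S⊆?T ⟧ * (p * (⟦ nonempty? S ⟧ * (d S * 6 ^ ∣ S ∣))) ≤
                                         ⟦ S⊆?T ⟧ * (⟦ nonempty? S ⟧ * (M * m ^ ∣ T ─ S ∣))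
        guarded (no _)    = z≤n
        guarded (yes S⊆T) = *-monoʳ-≤ 1 (begin
          p * (⟦ nonempty? S ⟧ * (d S * 6 ^ ∣ S ∣))                          ≡⟨ regroup₂ (d S * 6 ^ ∣ S ∣) ⟦ nonempty? S ⟧ p ⟩
          ⟦ nonempty? S ⟧ * (d S * 6 ^ ∣ S ∣ * p)                            ≡⟨ cong (λ e → ⟦ nonempty? S ⟧ * (d S * 6 ^ ∣ S ∣ * e)) p≡ ⟩
          ⟦ nonempty? S ⟧ * (d S * 6 ^ ∣ S ∣ * (m ^ ∣ S ∣ * m ^ ∣ T ─ S ∣))  ≡⟨ cong (⟦ nonempty? S ⟧ *_) (*-assoc (d S * 6 ^ ∣ S ∣) _ _) ⟨
          ⟦ nonempty? S ⟧ * (d S * 6 ^ ∣ S ∣ * m ^ ∣ S ∣ * m ^ ∣ T ─ S ∣)    ≤⟨ *-monoʳ-≤ ⟦ nonempty? S ⟧ (*-monoˡ-≤ (m ^ ∣ T ─ S ∣) (spread′ S)) ⟩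
          ⟦ nonempty? S ⟧ * (M * m ^ ∣ T ─ S ∣)                              ∎)
          where
          p≡ : p ≡ m ^ ∣ S ∣ * m ^ ∣ T ─ S ∣
          p≡ = trans (cong (m ^_) (∣T∣≡∣S∣+∣T─S∣ S T S⊆T)) (^-distribˡ-+-* m ∣ S ∣ ∣ T ─ S ∣)

    small? : (U : Subset N) (R : Subset N) → Dec (∣ R ∣ ≤ t × Any (_⊆ U ∪ R) F)
    small? U R = (∣ R ∣ ≤? t) ×-dec any? (_⊆? (U ∪ R)) F

    -- All possible short first fragments for U, whichever member they come from. The list depends
    -- on U alone, so the second round can also choose from the colouring only.
    small : Subset N → List (Subset N)
    small U = filter (small? U) (subsets N)

    module Colour (u v : Fin 6) (u≢v : u ≢ v) where

      τ₁ τ₂ : Vec (Fin 6) N → Subset N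
      τ₁ c = choose F (class c u)
      τ₂ c = choose (small (class c u)) (class c v)

      -- The bad fragments counted with their degrees: long ones in the first round, nonempty ones
      -- in the second.
      cost : Vec (Fin 6) N → ℕ
      cost c = ∑ (subsets N) (λ S → w₁ S * ⟦ S ⊆? τ₁ (recolour c S u) ⟧) +
               ∑ (subsets N) (λ S → w₂ S * ⟦ S ⊆? τ₂ (recolour c S v) ⟧)

      ∑-cost : 7 * ∑ (colourings N) cost ≤ 6 ^ N * (2 * M)
      ∑-cost = begin
        7 * ∑ (colourings N) cost          ≡⟨ cong (7 *_) (∑-+ (colourings N) c₁ c₂) ⟩
        7 * (∑ (colourings N) c₁ + ∑ (colourings N) c₂)             ≤⟨ *-monoʳ-≤ 7 (+-mono-≤ (∑-fragments w₁ u τ₁) (∑-fragments w₂ v τ₂)) ⟩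
        7 * (∑ (colourings N) s₁ + ∑ (colourings N) s₂)             ≡⟨ *-distribˡ-+ 7 (∑ (colourings N) s₁) (∑ (colourings N) s₂) ⟩
        7 * ∑ (colourings N) s₁ + 7 * ∑ (colourings N) s₂           ≡⟨ cong₂ _+_ (∑-*ˡ (colourings N) 7 s₁) (∑-*ˡ (colourings N) 7 s₂) ⟨
        ∑ (colourings N) (λ c → 7 * s₁ c) + ∑ (colourings N) (λ c → 7 * s₂ c)
                                           ≤⟨ +-mono-≤ (∑-mono (colourings N) (λ c → ∑-w₁ (τ₁ c) (∣choose∣≤ F (class c u) ∣A∣≤k)))
                                                       (∑-mono (colourings N) (λ c → ∑-w₂ (τ₂ c) (∣choose∣≤ (small (class c u)) (class c v)
                                                         λ T∈ → proj₁ (proj₂ (∈-filter⁻ (small? (class c u)) {xs = subsets N} T∈))))) ⟩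
        ∑ (colourings N) (λ _ → M) + ∑ (colourings N) (λ _ → M)     ≡⟨ cong₂ _+_ (∑-vecs-const (allFin 6) N M) (∑-vecs-const (allFin 6) N M) ⟩
        6 ^ N * M + 6 ^ N * M              ≡⟨ double (6 ^ N) M ⟩
        6 ^ N * (2 * M)                    ∎
        where
        open ≤-Reasoning
        c₁ c₂ s₁ s₂ : Vec (Fin 6) N → ℕ
        c₁ c = ∑ (subsets N) (λ S → w₁ S * ⟦ S ⊆? τ₁ (recolour c S u) ⟧)
        c₂ c = ∑ (subsets N) (λ S → w₂ S * ⟦ S ⊆? τ₂ (recolour c S v) ⟧)
        s₁ c = ∑ (subsets N) (λ S → w₁ S * 6 ^ ∣ S ∣ * ⟦ S ⊆? τ₁ c ⟧)
        s₂ c = ∑ (subsets N) (λ S → w₂ S * 6 ^ ∣ S ∣ * ⟦ S ⊆? τ₂ c ⟧)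
        double : ∀ x y → x * y + x * y ≡ x * (2 * y)
        double = solve-∀

      module _ (c : Vec (Fin 6) N) (uncovered : ¬ Any (_⊆ class c u ∪ class c v) F) where

        U V : Subset N
        U = class c u
        V = class c v

        bad : Subset N → ℕ
        bad S = ⟦ t <? ∣ S ∣ ⟧ * ⟦ S ⊆? τ₁ (recolour c S u) ⟧ + ⟦ nonempty? S ⟧ * ⟦ S ⊆? τ₂ (recolour c S v) ⟧

        -- If the first fragment of `A` is short and the second is empty, then V contains some R for
        -- which U ∪ R contains a member; so U ∪ V contains one, contrary to `uncovered`. Otherwise
        -- one of the two fragments is bad.
        cover : ∀ {A} → A ∈ F → ∃ λ S → S ⊆ A × 1 ≤ bad S
        cover {A} A∈F with fragment F U (A ─ U) (lose A∈F A⊆)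
          where
          A⊆ : A ⊆ U ∪ (A ─ U)
          A⊆ {x} x∈A with x ∈? U
          ... | yes x∈U = x∈p∪q⁺ (inj₁ x∈U)
          ... | no  x∉U = x∈p∪q⁺ (inj₂ (x∈p∧x∉q⇒x∈p─q x∈A x∉U))
        ... | S₁ , S₁⊆A─U , S₁⊆T , fits₁ with t <? ∣ S₁ ∣
        ...   | yes t<∣S₁∣ = S₁ , (λ x∈ → p─q⊆p A U (S₁⊆A─U x∈)) ,
                  ≤-trans (≤-reflexive (sym (cong₂ _*_ (⟦⟧-yes (t <? ∣ S₁ ∣) t<∣S₁∣) (⟦⟧-yes (S₁ ⊆? τ₁ (recolour c S₁ u)) S₁⊆τ₁)))) (m≤m+n _ _)
          where
          S₁⊆τ₁ : S₁ ⊆ τ₁ (recolour c S₁ u)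
          S₁⊆τ₁ = subst (λ Z → S₁ ⊆ choose F Z) (sym (class-recolour c S₁ u)) S₁⊆T
        ...   | no t≮∣S₁∣ with fragment (small U) V S₁ (lose (∈-filter⁺ (small? U) (∈-subsets S₁) (≮⇒≥ t≮∣S₁∣ , fits₁)) (q⊆p∪q V S₁))
        ...     | S₂ , S₂⊆S₁ , S₂⊆R , fits₂ with nonempty? S₂
        ...       | yes nonempty = S₂ , (λ x∈ → p─q⊆p A U (S₁⊆A─U (S₂⊆S₁ x∈))) ,
                      ≤-trans (≤-reflexive (sym (cong₂ _*_ (⟦⟧-yes (nonempty? S₂) nonempty) (⟦⟧-yes (S₂ ⊆? τ₂ (recolour c S₂ v)) S₂⊆τ₂)))) (m≤n+m _ (⟦ t <? ∣ S₂ ∣ ⟧ * ⟦ S₂ ⊆? τ₁ (recolour c S₂ u) ⟧))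
          where
          disjoint : Empty (S₂ ∩ U)
          disjoint (x , x∈) with x∈p∩q⁻ S₂ U x∈
          ... | x∈S₂ , x∈U = x∈p─q⇒x∉q A U (S₁⊆A─U (S₂⊆S₁ x∈S₂)) x∈U
          S₂⊆τ₂ : S₂ ⊆ τ₂ (recolour c S₂ v)
          S₂⊆τ₂ = subst₂ (λ U′ Z → S₂ ⊆ choose (small U′) Z) (sym (class-recolour-≢ c S₂ u≢v disjoint)) (sym (class-recolour c S₂ v)) S₂⊆R
        ...       | no empty = contradiction covered uncovered
          where
          covered : Any (_⊆ U ∪ V) F
          covered with find fits₂
          ... | R , R∈ , R⊆V∪S₂ = Any.map (λ B⊆ {x} x∈ → ∪-monoʳ U R⊆V (B⊆ x∈)) (proj₂ (proj₂ (∈-filter⁻ (small? U) {xs = subsets N} R∈)))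
            where
            R⊆V : R ⊆ V
            R⊆V x∈R with x∈p∪q⁻ V S₂ (R⊆V∪S₂ x∈R)
            ... | inj₁ x∈V  = x∈V
            ... | inj₂ x∈S₂ = contradiction (_ , x∈S₂) empty

        uncovered⇒M≤cost : M ≤ cost c
        uncovered⇒M≤cost = begin
          M                                                  ≤⟨ length≤∑-degree F bad cover ⟩
          ∑ (subsets N) (λ S → bad S * d S)                  ≡⟨ ∑-cong (subsets N) (λ S → regroup ⟦ t <? ∣ S ∣ ⟧ _ ⟦ nonempty? S ⟧ _ (d S)) ⟩
          ∑ (subsets N) (λ S → w₁ S * ⟦ S ⊆? τ₁ (recolour c S u) ⟧ + w₂ S * ⟦ S ⊆? τ₂ (recolour c S v) ⟧)
                                                             ≡⟨ ∑-+ (subsets N) _ _ ⟩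
          cost c                                             ∎
          where
          open ≤-Reasoning
          regroup : ∀ a b a′ b′ x → (a * b + a′ * b′) * x ≡ a * x * b + a′ * x * b′
          regroup = solve-∀

    open Colour using (cost; ∑-cost; uncovered⇒M≤cost)

    -- If every colouring failed for some pair, the three costs would add up to at least M
    -- everywhere, yet their average is at most 3 · 2M/7. The three members may all be the empty
    -- set; the condition ∣ S ∣ < n on kernels excludes this for links.
    three-disjoint : .{{_ : NonZero M}} →
      ¬ (∀ {A B C} → A ∈ F → B ∈ F → C ∈ F → ¬ (Empty (A ∩ B) × Empty (B ∩ C) × Empty (A ∩ C)))
    three-disjoint no-three = <⇒≱ 6<7 (*-cancelʳ-≤ 7 6 (6 ^ N * M) {{m*n≢0 (6 ^ N) M {{m^n≢0 6 N}}}} (begin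
      7 * (6 ^ N * M)                                      ≡⟨ cong (7 *_) (∑-vecs-const (allFin 6) N M) ⟨
      7 * ∑ (colourings N) (λ _ → M)                       ≤⟨ *-monoʳ-≤ 7 (∑-mono (colourings N) M≤) ⟩
      7 * ∑ (colourings N) (λ c → cost₁ c + cost₂ c + cost₃ c)
                                                           ≡⟨ cong (7 *_) (trans (∑-+ (colourings N) _ _) (cong (_+ ∑ (colourings N) cost₃) (∑-+ (colourings N) _ _))) ⟩
      7 * (∑ (colourings N) cost₁ + ∑ (colourings N) cost₂ + ∑ (colourings N) cost₃)
                                                           ≡⟨ distrib (∑ (colourings N) cost₁) (∑ (colourings N) cost₂) (∑ (colourings N) cost₃) ⟩
      7 * ∑ (colourings N) cost₁ + 7 * ∑ (colourings N) cost₂ + 7 * ∑ (colourings N) cost₃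
                                                           ≤⟨ +-mono-≤ (+-mono-≤ (∑-cost (# 0) (# 1) λ ()) (∑-cost (# 2) (# 3) λ ())) (∑-cost (# 4) (# 5) λ ()) ⟩
      6 ^ N * (2 * M) + 6 ^ N * (2 * M) + 6 ^ N * (2 * M)  ≡⟨ collect (6 ^ N) M ⟩
      6 * (6 ^ N * M)                                      ∎))
      where
      open ≤-Reasoning
      6<7 : 6 < 7
      6<7 = ≤-refl
      cost₁ cost₂ cost₃ : Vec (Fin 6) N → ℕ
      cost₁ = cost (# 0) (# 1) λ ()
      cost₂ = cost (# 2) (# 3) λ ()
      cost₃ = cost (# 4) (# 5) λ ()
      distrib : ∀ a b c → 7 * (a + b + c) ≡ 7 * a + 7 * b + 7 * c
      distrib = solve-∀
      collect : ∀ x y → x * (2 * y) + x * (2 * y) + x * (2 * y) ≡ 6 * (x * y)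
      collect = solve-∀
      separate : ∀ c {A B : Subset N} (u v u′ v′ : Fin 6) → u ≢ u′ × u ≢ v′ × v ≢ u′ × v ≢ v′ →
                 A ⊆ class c u ∪ class c v → B ⊆ class c u′ ∪ class c v′ → Empty (A ∩ B)
      separate c {A} {B} u v u′ v′ (uu′ , uv′ , vu′ , vv′) A⊆ B⊆ (x , x∈) with x∈p∩q⁻ A B x∈
      ... | x∈A , x∈B with x∈p∪q⁻ (class c u) _ (A⊆ x∈A) | x∈p∪q⁻ (class c u′) _ (B⊆ x∈B)
      ...   | inj₁ p | inj₁ q = uu′ (trans (sym (∈-class c p)) (∈-class c q))
      ...   | inj₁ p | inj₂ q = uv′ (trans (sym (∈-class c p)) (∈-class c q))
      ...   | inj₂ p | inj₁ q = vu′ (trans (sym (∈-class c p)) (∈-class c q))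
      ...   | inj₂ p | inj₂ q = vv′ (trans (sym (∈-class c p)) (∈-class c q))
      M≤ : ∀ c → M ≤ cost₁ c + cost₂ c + cost₃ c
      M≤ c with any? (_⊆? (class c (# 0) ∪ class c (# 1))) F
              | any? (_⊆? (class c (# 2) ∪ class c (# 3))) F
              | any? (_⊆? (class c (# 4) ∪ class c (# 5))) F
      ... | no ¬p | _     | _     = ≤-trans (uncovered⇒M≤cost (# 0) (# 1) (λ ()) c ¬p) (≤-trans (m≤m+n _ (cost₂ c)) (m≤m+n _ (cost₃ c)))
      ... | yes _ | no ¬p | _     = ≤-trans (uncovered⇒M≤cost (# 2) (# 3) (λ ()) c ¬p) (≤-trans (m≤n+m _ (cost₁ c)) (m≤m+n _ (cost₃ c)))
      ... | yes _ | yes _ | no ¬p = ≤-trans (uncovered⇒M≤cost (# 4) (# 5) (λ ()) c ¬p) (m≤n+m _ (cost₁ c + cost₂ c))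
      ... | yes p | yes q | yes r with find p | find q | find r
      ...   | A , A∈F , A⊆ | B , B∈F , B⊆ | C , C∈F , C⊆ = contradiction
              ( separate c (# 0) (# 1) (# 2) (# 3) ((λ ()) , (λ ()) , (λ ()) , (λ ())) A⊆ B⊆
              , separate c (# 2) (# 3) (# 4) (# 5) ((λ ()) , (λ ()) , (λ ()) , (λ ())) B⊆ C⊆
              , separate c (# 0) (# 1) (# 4) (# 5) ((λ ()) , (λ ()) , (λ ()) , (λ ())) A⊆ C⊆)
              (no-three A∈F B∈F C∈F)

  -- Passing to a spread link

  ∑-filter : {P : Pred X 0ℓ} (P? : Decidable P) (xs : List X) (f : X → ℕ) → ∑ (filter P? xs) f ≡ ∑ xs (λ x → ⟦ P? x ⟧ * f x)
  ∑-filter P? []       f = refl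
  ∑-filter P? (x ∷ xs) f with P? x
  ... | yes _ = cong₂ _+_ (sym (*-identityˡ (f x))) (∑-filter P? xs f)
  ... | no _  = ∑-filter P? xs f

  length-constant : {y : X} {xs : List X} → Unique xs → (∀ {x} → x ∈ xs → x ≡ y) → length xs ≤ 1
  length-constant []                    h = z≤n
  length-constant (_ ∷ [])              h = ≤-refl
  length-constant ((x≢x′ ∷ _) ∷ _ ∷ _) h = contradiction (trans (h (here refl)) (sym (h (there (here refl))))) x≢x′

  -- F is restricted to the link of a set S maximising degree F S * r ^ ∣ S ∣; maximality makes the link spread.
  module Link (F : List (Subset N)) (F! : Unique F) (n t m : ℕ) .{{_ : NonZero m}}
    (∣A∣≡n : ∀ {A} → A ∈ F → ∣ A ∣ ≡ n)
    (8t≤m : 8 * t ≤ m) (7*2^n≤m^1+t : 7 * 2 ^ n ≤ m ^ suc t)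
    (no-sunflower : ∀ {A B C} → A ∈ F → B ∈ F → C ∈ F → ∀ S → ∣ S ∣ < n → S ⊆ A → S ⊆ B → S ⊆ C →
                    ¬ (Empty ((A ─ S) ∩ (B ─ S)) × Empty ((B ─ S) ∩ (C ─ S)) × Empty ((A ─ S) ∩ (C ─ S)))) where

    r : ℕ
    r = 6 * m

    instance
      r≢0 : NonZero r
      r≢0 = m*n≢0 6 m

    φ : Subset N → ℕ
    φ S = degree F S * r ^ ∣ S ∣

    S* : Subset N
    S* = argmax φ ⊥ (subsets N)

    φ≤φS* : ∀ S → φ S ≤ φ S*
    φ≤φS* S = All.lookup (f[xs]≤f[argmax] {f = φ} ⊥ (subsets N)) (∈-subsets S)

    above link : List (Subset N)
    above = filter (S* ⊆?_) F
    link = map (_─ S*) above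

    length≤φS* : length F ≤ φ S*
    length≤φS* = begin
      length F                        ≡⟨ *-identityʳ (length F) ⟨
      length F * 1                    ≡⟨ ∑-const F 1 ⟨
      ∑ F (λ _ → 1)                   ≡⟨ ∑-cong F (λ A → ⟦⟧-yes (⊥ ⊆? A) ⊥⊆) ⟨
      degree F ⊥                      ≡⟨ *-identityʳ (degree F ⊥) ⟨
      degree F ⊥ * r ^ 0              ≡⟨ cong (λ e → degree F ⊥ * r ^ e) (∣⊥∣≡0 N) ⟨
      φ ⊥                             ≤⟨ φ≤φS* ⊥ ⟩
      φ S*                            ∎
      where open ≤-Reasoning

    length-above : length above ≡ degree F S*
    length-above = begin
      length above                          ≡⟨ *-identityʳ (length above) ⟨
      length above * 1                      ≡⟨ ∑-const above 1 ⟨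
      ∑ above (λ _ → 1)                     ≡⟨ ∑-filter (S* ⊆?_) F (λ _ → 1) ⟩
      ∑ F (λ A → ⟦ S* ⊆? A ⟧ * 1)           ≡⟨ ∑-cong F (λ A → *-identityʳ ⟦ S* ⊆? A ⟧) ⟩
      degree F S*                           ∎
      where open ≡-Reasoning

    degree-link : ∀ S → degree link S ≡ ∑ F (λ A → ⟦ S* ⊆? A ⟧ * ⟦ S ⊆? A ─ S* ⟧)
    degree-link S = trans (∑-map (_─ S*) above _) (∑-filter (S* ⊆?_) F _)

    -- A set meeting `S*` lies in no member of the link. For a disjoint `S`, the inequality φ (S* ∪
    -- S) ≤ φ S* divided by r ^ ∣ S* ∣ is the claim.
    spread : ∀ S → degree link S * r ^ ∣ S ∣ ≤ length link
    spread S with nonempty? (S ∩ S*)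
    ... | yes (x , x∈) = ≤-trans (≤-reflexive (cong (_* r ^ ∣ S ∣) (trans (degree-link S) (trans (∑-cong F vanish) (∑-0 F))))) z≤n
      where
      vanish : ∀ A → ⟦ S* ⊆? A ⟧ * ⟦ S ⊆? A ─ S* ⟧ ≡ 0
      vanish A = trans (cong (⟦ S* ⊆? A ⟧ *_) (⟦⟧-no (S ⊆? A ─ S*) λ S⊆ →
        x∈p─q⇒x∉q A S* (S⊆ (proj₁ (x∈p∩q⁻ S S* x∈))) (proj₂ (x∈p∩q⁻ S S* x∈)))) (*-zeroʳ ⟦ S* ⊆? A ⟧)
    ... | no empty = *-cancelʳ-≤ _ _ (r ^ ∣ S* ∣) {{m^n≢0 r ∣ S* ∣}} (begin
      degree link S * r ^ ∣ S ∣ * r ^ ∣ S* ∣                       ≤⟨ *-monoˡ-≤ (r ^ ∣ S* ∣) (*-monoˡ-≤ (r ^ ∣ S ∣) degree≤) ⟩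
      degree F (S* ∪ S) * r ^ ∣ S ∣ * r ^ ∣ S* ∣                   ≡⟨ regroup (degree F (S* ∪ S)) (r ^ ∣ S ∣) (r ^ ∣ S* ∣) ⟩
      degree F (S* ∪ S) * (r ^ ∣ S* ∣ * r ^ ∣ S ∣)                 ≡⟨ cong (degree F (S* ∪ S) *_) (^-distribˡ-+-* r ∣ S* ∣ ∣ S ∣) ⟨
      degree F (S* ∪ S) * r ^ (∣ S* ∣ + ∣ S ∣)                     ≤⟨ *-monoʳ-≤ (degree F (S* ∪ S)) (^-monoʳ-≤ r size≤) ⟩
      φ (S* ∪ S)                                                   ≤⟨ φ≤φS* (S* ∪ S) ⟩
      degree F S* * r ^ ∣ S* ∣                                     ≡⟨ cong (_* r ^ ∣ S* ∣) (trans (length-map (_─ S*) above) length-above) ⟨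
      length link * r ^ ∣ S* ∣                                     ∎)
      where
      open ≤-Reasoning
      regroup : ∀ a b c → a * b * c ≡ a * (c * b)
      regroup = solve-∀
      size≤ : ∣ S* ∣ + ∣ S ∣ ≤ ∣ S* ∪ S ∣
      size≤ = ≤-trans
        (+-monoʳ-≤ ∣ S* ∣ (p⊆q⇒∣p∣≤∣q∣ {p = S} {q = (S* ∪ S) ─ S*}
          λ x∈S → x∈p∧x∉q⇒x∈p─q (x∈p∪q⁺ (inj₂ x∈S)) λ x∈S* → empty (_ , x∈p∩q⁺ (x∈S , x∈S*))))
        (≤-reflexive (sym (∣T∣≡∣S∣+∣T─S∣ S* (S* ∪ S) (p⊆p∪q S))))
      degree≤ : degree link S ≤ degree F (S* ∪ S)
      degree≤ = ≤-trans (≤-reflexive (degree-link S)) (∑-mono F λ A → ⟦⟧*-≤ (S* ⊆? A) λ S*⊆A →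
        ⟦⟧-mono (S ⊆? A ─ S*) (S* ∪ S ⊆? A) λ S⊆ x∈ → union⊆ A S*⊆A S⊆ (x∈p∪q⁻ S* S x∈))
        where
        union⊆ : ∀ A {x} → S* ⊆ A → S ⊆ A ─ S* → x ∈ₛ S* ⊎ x ∈ₛ S → x ∈ₛ A
        union⊆ A S*⊆A S⊆ (inj₁ x∈) = S*⊆A x∈
        union⊆ A S*⊆A S⊆ (inj₂ x∈) = p─q⊆p A S* (S⊆ x∈)

    ∈-above : ∀ {A} → A ∈ above → A ∈ F × S* ⊆ A
    ∈-above = ∈-filter⁻ (S* ⊆?_)

    ∈-link : ∀ {B} → B ∈ link → ∃ λ A → (A ∈ F × S* ⊆ A) × B ≡ A ─ S*
    ∈-link B∈ with ∈-map⁻ (_─ S*) B∈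
    ... | A , A∈ , B≡ = A , ∈-above A∈ , B≡

    degree≤1 : ¬ ∣ S* ∣ < n → length above ≤ 1
    degree≤1 S*≮n = length-constant (Unique.filter⁺ (S* ⊆?_) F!) λ {A} A∈ →
      ⊆-antisym (A⊆S* A (∈-above A∈)) (proj₂ (∈-above A∈))
      where
      A⊆S* : ∀ A → A ∈ F × S* ⊆ A → A ⊆ S*
      A⊆S* A (A∈ , S*⊆A) {x} x∈A with x ∈? S*
      ... | yes x∈S* = x∈S*
      ... | no  x∉S* = contradiction (<-≤-trans (p⊂q⇒∣p∣<∣q∣ ((λ {y} → S*⊆A {y}) , x , x∈A , x∉S*)) (≤-reflexive (∣A∣≡n A∈))) S*≮n

    link-empty : ∣ S* ∣ < n → ¬ NonZero (length link)
    link-empty S*<n ≢0 = Spread.three-disjoint link n t m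
      (λ B∈ → let A , (A∈ , _) , B≡ = ∈-link B∈ in
        ≤-trans (≤-reflexive (cong ∣_∣ B≡)) (≤-trans (∣p─q∣≤∣p∣ A S*) (≤-reflexive (∣A∣≡n A∈))))
      spread 8t≤m 7*2^n≤m^1+t {{≢0}}
      λ A∈ B∈ C∈ disjoint → case (∈-link A∈ , ∈-link B∈ , ∈-link C∈) of λ
        { ((A , (A∈ , S*⊆A) , refl) , (B , (B∈ , S*⊆B) , refl) , (C , (C∈ , S*⊆C) , refl)) →
          no-sunflower A∈ B∈ C∈ S* S*<n S*⊆A S*⊆B S*⊆C disjoint }

    -- The maximum of `φ` dominates its value at ⊥, which is |F|. If |S*| < n, the link is empty and
    -- the maximum is 0; otherwise a member containing `S*` equals it, so the degree is at most 1.
    length≤ : length F ≤ r ^ n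
    length≤ with ∣ S* ∣ <? n
    ... | yes S*<n = ≤-trans length≤φS* (≤-trans (≤-reflexive (cong (_* r ^ ∣ S* ∣) degree≡0)) z≤n)
      where
      degree≡0 : degree F S* ≡ 0
      degree≡0 with length link in eq
      ... | zero  = trans (sym length-above) (trans (sym (length-map (_─ S*) above)) eq)
      ... | suc _ = contradiction (subst NonZero (sym eq) _) (link-empty S*<n)
    ... | no S*≮n with above in eq
    ...   | []    = ≤-trans length≤φS* (≤-trans (≤-reflexive (cong (_* r ^ ∣ S* ∣) (trans (sym length-above) (cong length eq)))) z≤n)
    ...   | A ∷ _ = begin
      length F                     ≤⟨ length≤φS* ⟩
      degree F S* * r ^ ∣ S* ∣     ≤⟨ *-mono-≤ (≤-trans (≤-reflexive (sym length-above)) (degree≤1 S*≮n)) (^-monoʳ-≤ r ∣S*∣≤n) ⟩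
      1 * r ^ n                    ≡⟨ *-identityˡ (r ^ n) ⟩
      r ^ n                        ∎
      where
      open ≤-Reasoning
      A∈ : A ∈ F × S* ⊆ A
      A∈ = ∈-above (subst (A ∈_) (sym eq) (here refl))
      ∣S*∣≤n : ∣ S* ∣ ≤ n
      ∣S*∣≤n = ≤-trans (p⊆q⇒∣p∣≤∣q∣ (proj₂ A∈)) (≤-reflexive (∣A∣≡n (proj₁ A∈)))

  -- From vectors to sets

  -- Points (i , a) of {1,…,n} × ℤ/D are encoded as combine i a : Fin (n * D).
  graph : ℤ/ D ^ n → Subset (n * D)
  graph x = concat (Vec.map ⁅_⁆ x)

  ∣++∣ : (p : Subset N) (q : Subset n) → ∣ p Vec.++ q ∣ ≡ ∣ p ∣ + ∣ q ∣
  ∣++∣ []            q = refl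
  ∣++∣ (outside ∷ p) q = ∣++∣ p q
  ∣++∣ (inside  ∷ p) q = cong suc (∣++∣ p q)

  ∣graph∣ : (x : ℤ/ D ^ n) → ∣ graph x ∣ ≡ n
  ∣graph∣ []      = refl
  ∣graph∣ (a ∷ x) = trans (∣++∣ ⁅ a ⁆ (graph x)) (cong₂ _+_ (∣⁅x⁆∣≡1 a) (∣graph∣ x))

  lookup-graph : (x : ℤ/ D ^ n) (i : Fin n) (a : Fin D) → lookup (graph x) (combine i a) ≡ lookup ⁅ lookup x i ⁆ a
  lookup-graph (b ∷ x) zero    a = lookup-++ˡ ⁅ b ⁆ (graph x) a
  lookup-graph (b ∷ x) (suc i) a = trans (lookup-++ʳ ⁅ b ⁆ (graph x) (combine i a)) (lookup-graph x i a)

  ∈-graph⁺ : (x : ℤ/ D ^ n) (i : Fin n) → combine i (lookup x i) ∈ₛ graph x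
  ∈-graph⁺ x i = lookup⇒[]= _ (graph x) (trans (lookup-graph x i _) ([]=⇒lookup (x∈⁅x⁆ (lookup x i))))

  ∈-graph⁻ : (x : ℤ/ D ^ n) (i : Fin n) {a : Fin D} → combine i a ∈ₛ graph x → a ≡ lookup x i
  ∈-graph⁻ x i a∈ = x∈⁅y⁆⇒x≡y (lookup x i) (lookup⇒[]= _ ⁅ lookup x i ⁆ (trans (sym (lookup-graph x i _)) ([]=⇒lookup a∈)))

  graph-injective : {x y : ℤ/ D ^ n} → graph x ≡ graph y → x ≡ y
  graph-injective {x = x} {y} eq = trans (sym (tabulate∘lookup x))
    (trans (tabulate-cong λ i → ∈-graph⁻ y i (subst (combine i (lookup x i) ∈ₛ_) eq (∈-graph⁺ x i))) (tabulate∘lookup y))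

  -- Equal vectors would have all n points of their graph in `S`, which is too small. If two vectors
  -- agree at i, their common point lies in `S` and hence in the third graph, so all three agree
  -- there.
  graph-sunflower : (x y z : ℤ/ D ^ n) (S : Subset (n * D)) → ∣ S ∣ < n → S ⊆ graph x → S ⊆ graph y → S ⊆ graph z →
    Empty ((graph x ─ S) ∩ (graph y ─ S)) → Empty ((graph y ─ S) ∩ (graph z ─ S)) → Empty ((graph x ─ S) ∩ (graph z ─ S)) →
    Sunflower x y z
  graph-sunflower {D = D} {n = n} x y z S ∣S∣<n S⊆x S⊆y S⊆z xy yz xz = record
    { x≢y = distinct xy ; y≢z = distinct yz ; x≢z = distinct xz ; coordinates = coordinate }
    where
    common : ∀ {v w : ℤ/ D ^ n} → Empty ((graph v ─ S) ∩ (graph w ─ S)) → ∀ {e} → e ∈ₛ graph v → e ∈ₛ graph w → e ∈ₛ S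
    common empty {e} e∈v e∈w with e ∈? S
    ... | yes e∈S = e∈S
    ... | no  e∉S = contradiction (e , x∈p∩q⁺ (x∈p∧x∉q⇒x∈p─q e∈v e∉S , x∈p∧x∉q⇒x∈p─q e∈w e∉S)) empty
    distinct : ∀ {v w : ℤ/ D ^ n} → Empty ((graph v ─ S) ∩ (graph w ─ S)) → v ≢ w
    distinct {v} empty refl = <⇒≱ ∣S∣<n (≤-trans (≤-reflexive (sym (∣graph∣ v))) (p⊆q⇒∣p∣≤∣q∣ λ e∈ → common {v} {v} empty e∈ e∈))
    agree : ∀ {u v w : ℤ/ D ^ n} → Empty ((graph u ─ S) ∩ (graph v ─ S)) → S ⊆ graph w →
            ∀ i → lookup u i ≡ lookup v i → lookup u i ≡ lookup w i
    agree {u} {v} {w} empty S⊆w i eq = ∈-graph⁻ w i (S⊆w (common {u} {v} empty (∈-graph⁺ u i)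
      (subst (λ a → combine i a ∈ₛ graph v) (sym eq) (∈-graph⁺ v i))))
    coordinate : ∀ i → (lookup x i ≡ lookup y i × lookup y i ≡ lookup z i) ⊎
                       (lookup x i ≢ lookup y i × lookup y i ≢ lookup z i × lookup x i ≢ lookup z i)
    coordinate i with lookup x i Fin.≟ lookup y i | lookup y i Fin.≟ lookup z i | lookup x i Fin.≟ lookup z i
    ... | yes x≡y | _       | _       = inj₁ (x≡y , trans (sym x≡y) (agree {x} {y} {z} xy S⊆z i x≡y))
    ... | no _    | yes y≡z | _       = inj₁ (sym (agree {y} {z} {x} yz S⊆x i y≡z) , y≡z)
    ... | no _    | no _    | yes x≡z = inj₁ (agree {x} {z} {y} xz S⊆y i x≡z , trans (sym (agree {x} {z} {y} xz S⊆y i x≡z)) x≡z)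
    ... | no x≢y  | no y≢z  | no x≢z  = inj₂ (x≢y , y≢z , x≢z)

  sunflower-free-bound : (F : Family D n) → SunflowerFree F → (t m : ℕ) .{{_ : NonZero m}} →
                         8 * t ≤ m → 7 * 2 ^ n ≤ m ^ suc t → ∥ F ∥ ≤ (6 * m) ^ n
  sunflower-free-bound {D = D} {n = n} F free t m 8t≤m 7*2^n≤m^1+t = ≤-trans
    (≤-reflexive (sym (length-map graph (members F))))
    (Link.length≤ (map graph (members F)) (Unique.map⁺ graph-injective (unique F)) n t m size 8t≤m 7*2^n≤m^1+t no-sunflower)
    where
    size : ∀ {A} → A ∈ map graph (members F) → ∣ A ∣ ≡ n
    size A∈ with ∈-map⁻ graph A∈
    ... | x , _ , refl = ∣graph∣ x
    no-sunflower : ∀ {A B C} → A ∈ map graph (members F) → B ∈ map graph (members F) → C ∈ map graph (members F) →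
      ∀ S → ∣ S ∣ < n → S ⊆ A → S ⊆ B → S ⊆ C →
      ¬ (Empty ((A ─ S) ∩ (B ─ S)) × Empty ((B ─ S) ∩ (C ─ S)) × Empty ((A ─ S) ∩ (C ─ S)))
    no-sunflower A∈ B∈ C∈ S ∣S∣<n S⊆A S⊆B S⊆C (AB , BC , AC) with ∈-map⁻ graph A∈ | ∈-map⁻ graph B∈ | ∈-map⁻ graph C∈
    ... | x , x∈ , refl | y , y∈ , refl | z , z∈ , refl = free x∈ y∈ z∈ (graph-sunflower x y z S ∣S∣<n S⊆A S⊆B S⊆C AB BC AC)

  -- Choice of parameters and the bound (C n / log n)ⁿ

  -- (1 + h)ᵏ ≤ 1 + x + x² for h = 1/n and x = k/n ≤ 1, cleared of denominators.
  [1+n]^k-bound : ∀ n k → k ≤ n → n * n * (n + 1) ^ k ≤ n ^ k * (n * n + k * n + k * k)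
  [1+n]^k-bound n zero    _   = ≤-reflexive (rearrange n)
    where
    rearrange : ∀ n → n * n * 1 ≡ 1 * (n * n + 0 * n + 0)
    rearrange = solve-∀
  [1+n]^k-bound n (suc k) k<n = begin
    n * n * ((n + 1) * (n + 1) ^ k)                          ≡⟨ rearrange n ((n + 1) ^ k) ⟩
    (n + 1) * (n * n * (n + 1) ^ k)                          ≤⟨ *-monoʳ-≤ (n + 1) ([1+n]^k-bound n k (<⇒≤ k<n)) ⟩
    (n + 1) * (n ^ k * (n * n + k * n + k * k))              ≡⟨ rearrange₂ n k (n ^ k) ⟩
    n ^ k * (n * (n * n + k * n + k * k + n + k) + k * k)    ≤⟨ *-monoʳ-≤ (n ^ k) (+-monoʳ-≤ (n * (n * n + k * n + k * k + n + k)) (*-monoˡ-≤ k (<⇒≤ k<n))) ⟩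
    n ^ k * (n * (n * n + k * n + k * k + n + k) + n * k)    ≤⟨ *-monoʳ-≤ (n ^ k) (m≤m+n _ n) ⟩
    n ^ k * (n * (n * n + k * n + k * k + n + k) + n * k + n) ≡⟨ rearrange₃ n k (n ^ k) ⟩
    n * n ^ k * (n * n + (1 + k) * n + (1 + k) * (1 + k))    ∎
    where
    open ≤-Reasoning
    rearrange : ∀ n x → n * n * ((n + 1) * x) ≡ (n + 1) * (n * n * x)
    rearrange = solve-∀
    rearrange₂ : ∀ n k x → (n + 1) * (x * (n * n + k * n + k * k)) ≡ x * (n * (n * n + k * n + k * k + n + k) + k * k)
    rearrange₂ = solve-∀
    rearrange₃ : ∀ n k x → x * (n * (n * n + k * n + k * k + n + k) + n * k + n) ≡ n * x * (n * n + (1 + k) * n + (1 + k) * (1 + k))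
    rearrange₃ = solve-∀

  [1+n]^n≤3*n^n : ∀ n → (n + 1) ^ n ≤ 3 * n ^ n
  [1+n]^n≤3*n^n zero      = s≤s z≤n
  [1+n]^n≤3*n^n n@(suc _) = *-cancelˡ-≤ (n * n) (begin
    n * n * (n + 1) ^ n                  ≤⟨ [1+n]^k-bound n n ≤-refl ⟩
    n ^ n * (n * n + n * n + n * n)      ≡⟨ rearrange (n ^ n) n ⟩
    n * n * (3 * n ^ n)                  ∎)
    where
    open ≤-Reasoning
    rearrange : ∀ x n → x * (n * n + n * n + n * n) ≡ n * n * (3 * x)
    rearrange = solve-∀

  n^n≤3^n*n! : ∀ n → n ^ n ≤ 3 ^ n * n !
  n^n≤3^n*n! zero    = s≤s z≤n
  n^n≤3^n*n! (suc n) = begin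
    suc n * suc n ^ n                    ≡⟨ cong (λ k → suc n * k ^ n) (+-comm 1 n) ⟩
    suc n * (n + 1) ^ n                  ≤⟨ *-monoʳ-≤ (suc n) ([1+n]^n≤3*n^n n) ⟩
    suc n * (3 * n ^ n)                  ≤⟨ *-monoʳ-≤ (suc n) (*-monoʳ-≤ 3 (n^n≤3^n*n! n)) ⟩
    suc n * (3 * (3 ^ n * n !))          ≡⟨ rearrange (suc n) (3 ^ n) (n !) ⟩
    3 * 3 ^ n * (suc n * n !)            ∎
    where
    open ≤-Reasoning
    rearrange : ∀ a b c → a * (3 * (b * c)) ≡ 3 * b * (a * c)
    rearrange = solve-∀

  L²≤3*2^L : ∀ L → L * L ≤ 3 * 2 ^ L
  L²≤3*2^L L = ≤-trans (≤-trans (m≤m+n (L * L) (2 * L)) (m≤m+n _ 3)) (stronger L)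
    where
    -- Doubling the left side exceeds its value at L + 1 by L², so this form is inductive.
    stronger : ∀ L → L * L + 2 * L + 3 ≤ 3 * 2 ^ L
    stronger zero    = ≤-refl
    stronger (suc L) = begin
      (1 + L) * (1 + L) + 2 * (1 + L) + 3            ≤⟨ m≤m+n _ (L * L) ⟩
      (1 + L) * (1 + L) + 2 * (1 + L) + 3 + L * L    ≡⟨ rearrange L ⟩
      2 * (L * L + 2 * L + 3)                        ≤⟨ *-monoʳ-≤ 2 (stronger L) ⟩
      2 * (3 * 2 ^ L)                                ≡⟨ swap (2 ^ L) ⟩
      3 * (2 * 2 ^ L)                                ∎
      where
      open ≤-Reasoning
      rearrange : ∀ L → (1 + L) * (1 + L) + 2 * (1 + L) + 3 + L * L ≡ 2 * (L * L + 2 * L + 3)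
      rearrange = solve-∀
      swap : ∀ x → 2 * (3 * x) ≡ 3 * (2 * x)
      swap = solve-∀

  n<2^n : ∀ n → n < 2 ^ n
  n<2^n zero    = s≤s z≤n
  n<2^n (suc n) = ≤-trans (+-mono-≤ (≤-trans (s≤s z≤n) (n<2^n n)) (n<2^n n)) (≤-reflexive (cong (2 ^ n +_) (sym (+-identityʳ _))))

  bitLength : ∀ n → 1 ≤ n → ∃ λ j → 2 ^ j ≤ n × n < 2 ^ suc j
  bitLength (suc zero)      _ = 0 , ≤-refl , ≤-refl
  bitLength (suc n@(suc _)) _ with bitLength n (s≤s z≤n)
  ... | j , 2^j≤n , n<2^[1+j] with suc n <? 2 ^ suc j
  ...   | yes 1+n<2^[1+j] = j , m≤n⇒m≤1+n 2^j≤n , 1+n<2^[1+j]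
  ...   | no  1+n≮2^[1+j] = suc j , ≮⇒≥ 1+n≮2^[1+j] ,
    ≤-<-trans n<2^[1+j] (^-monoʳ-< 2 (s≤s (s≤s z≤n)) (n<1+n (suc j)))

  -- With u just above n / L, the choice t = 2u, m = 64u gives 8t ≤ m and 2ⁿ ≤ (2^L)^u ≤ m^t. Then
  -- 6m ≤ 768 n / L, and nⁿ ≤ 3ⁿ n! turns 768 into 2304.
  ∥F∥*L^n≤ : ∀ {D n} (F : Family D n) → SunflowerFree F → ∀ j → 2 ^ j ≤ n →
             ∥ F ∥ * suc j ^ n ≤ 2304 ^ n * n !
  ∥F∥*L^n≤ {n = n} F free j 2^j≤n = begin
    ∥ F ∥ * L ^ n                    ≤⟨ *-monoˡ-≤ (L ^ n) (sunflower-free-bound F free (2 * u) m 8t≤m 7*2^n≤) ⟩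
    (6 * m) ^ n * L ^ n              ≡⟨ ^-distribʳ-* n (6 * m) L ⟨
    (6 * m * L) ^ n                  ≤⟨ ^-monoˡ-≤ n 6mL≤768n ⟩
    (768 * n) ^ n                    ≡⟨ ^-distribʳ-* n 768 n ⟩
    768 ^ n * n ^ n                  ≤⟨ *-monoʳ-≤ (768 ^ n) (n^n≤3^n*n! n) ⟩
    768 ^ n * (3 ^ n * n !)          ≡⟨ *-assoc (768 ^ n) (3 ^ n) (n !) ⟨
    768 ^ n * 3 ^ n * n !            ≡⟨ cong (_* n !) (^-distribʳ-* n 768 3) ⟨
    2304 ^ n * n !                   ∎
    where
    open ≤-Reasoning
    L u m : ℕ
    L = suc j
    u = suc (n / L)
    m = 64 * u
    L≤n : L ≤ n
    L≤n = ≤-trans (n<2^n j) 2^j≤n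
    uL≤2n : u * L ≤ 2 * n
    uL≤2n = ≤-trans (+-mono-≤ L≤n (m/n*n≤m n L)) (≤-reflexive (cong (n +_) (sym (+-identityʳ n))))
    n≤uL : n ≤ u * L
    n≤uL = ≤-trans (≤-reflexive (m≡m%n+[m/n]*n n L)) (+-monoˡ-≤ (n / L * L) (m%n≤n n L))
    rearrange₁ : ∀ u L → 6 * (64 * u) * L ≡ 384 * (u * L)
    rearrange₁ = solve-∀
    rearrange₂ : ∀ n → 384 * (2 * n) ≡ 768 * n
    rearrange₂ = solve-∀
    6mL≤768n : 6 * m * L ≤ 768 * n
    6mL≤768n = begin
      6 * (64 * u) * L     ≡⟨ rearrange₁ u L ⟩
      384 * (u * L)        ≤⟨ *-monoʳ-≤ 384 uL≤2n ⟩
      384 * (2 * n)        ≡⟨ rearrange₂ n ⟩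
      768 * n              ∎
    rearrange₃ : ∀ u → 8 * (2 * u) ≡ 16 * u
    rearrange₃ = solve-∀
    8t≤m : 8 * (2 * u) ≤ m
    8t≤m = ≤-trans (≤-reflexive (rearrange₃ u)) (*-monoˡ-≤ u (m≤m+n 16 48))
    2^L≤2uL : 2 ^ L ≤ 2 * (u * L)
    2^L≤2uL = *-monoʳ-≤ 2 (≤-trans 2^j≤n n≤uL)
    rearrange₄ : ∀ u L → 2 * (u * L) * (2 * (u * L)) ≡ 4 * (u * u) * (L * L)
    rearrange₄ = solve-∀
    rearrange₅ : ∀ u x → 4 * (u * u) * (3 * x) ≡ 12 * (u * u) * x
    rearrange₅ = solve-∀
    rearrange₆ : ∀ u → 12 * (u * u) + 4084 * (u * u) ≡ 64 * u * (64 * u * 1)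
    rearrange₆ = solve-∀
    -- Squaring 2^L ≤ 2uL and using L² ≤ 3 · 2^L lets a factor 2^L cancel; what remains is 12u²
    -- against 4096u².
    2^L≤m² : 2 ^ L ≤ m ^ 2
    2^L≤m² = *-cancelʳ-≤ _ _ (2 ^ L) {{m^n≢0 2 L}} (begin
      2 ^ L * 2 ^ L                        ≤⟨ *-mono-≤ 2^L≤2uL 2^L≤2uL ⟩
      2 * (u * L) * (2 * (u * L))          ≡⟨ rearrange₄ u L ⟩
      4 * (u * u) * (L * L)                ≤⟨ *-monoʳ-≤ (4 * (u * u)) (L²≤3*2^L L) ⟩
      4 * (u * u) * (3 * 2 ^ L)            ≡⟨ rearrange₅ u (2 ^ L) ⟩
      12 * (u * u) * 2 ^ L                 ≤⟨ *-monoˡ-≤ (2 ^ L) (m≤m+n (12 * (u * u)) (4084 * (u * u))) ⟩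
      (12 * (u * u) + 4084 * (u * u)) * 2 ^ L  ≡⟨ cong (_* 2 ^ L) (rearrange₆ u) ⟩
      m ^ 2 * 2 ^ L                        ∎)
    -- The extra factor m in the exponent `suc (2 * u)` pays for the 7.
    7*2^n≤ : 7 * 2 ^ n ≤ m ^ suc (2 * u)
    7*2^n≤ = *-mono-≤ {7} {m} (≤-trans (m≤m+n 7 57) (m≤m*n 64 u)) (begin
      2 ^ n                ≤⟨ ^-monoʳ-≤ 2 n≤uL ⟩
      2 ^ (u * L)          ≡⟨ cong (2 ^_) (*-comm u L) ⟩
      2 ^ (L * u)          ≡⟨ ^-*-assoc 2 L u ⟨
      (2 ^ L) ^ u          ≤⟨ ^-monoˡ-≤ u 2^L≤m² ⟩
      (m ^ 2) ^ u          ≡⟨ ^-*-assoc m 2 u ⟩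
      m ^ (2 * u)          ∎)

  -- Shifting L by a constant costs 2ⁿ when E ≤ L. When L < E, also n < 2^E, so the further factor
  -- Eⁿ is bounded by a constant depending on E only.
  [L+E]^n≤ : ∀ {n} L E → 1 ≤ L → 1 ≤ E → n < 2 ^ L → (L + E) ^ n ≤ E ^ (2 ^ E) * (2 ^ n * L ^ n)
  [L+E]^n≤ {n} L E@(suc _) 1≤L 1≤E n<2^L with E ≤? L
  ... | yes E≤L = begin
    (L + E) ^ n                      ≤⟨ ^-monoˡ-≤ n (+-monoʳ-≤ L E≤L) ⟩
    (L + L) ^ n                      ≡⟨ cong (λ k → (L + k) ^ n) (+-identityʳ L) ⟨
    (2 * L) ^ n                      ≡⟨ ^-distribʳ-* n 2 L ⟩
    2 ^ n * L ^ n                    ≤⟨ m≤n*m (2 ^ n * L ^ n) (E ^ (2 ^ E)) {{m^n≢0 E (2 ^ E)}} ⟩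
    E ^ (2 ^ E) * (2 ^ n * L ^ n)    ∎
    where open ≤-Reasoning
  ... | no E≰L = begin
    (L + E) ^ n                      ≤⟨ ^-monoˡ-≤ n (+-monoˡ-≤ E (≰⇒≥ E≰L)) ⟩
    (E + E) ^ n                      ≡⟨ cong (λ k → (E + k) ^ n) (+-identityʳ E) ⟨
    (2 * E) ^ n                      ≤⟨ ^-monoˡ-≤ n (m≤m*n (2 * E) L {{>-nonZero 1≤L}}) ⟩
    (2 * E * L) ^ n                  ≡⟨ ^-distribʳ-* n (2 * E) L ⟩
    (2 * E) ^ n * L ^ n              ≡⟨ cong (_* L ^ n) (^-distribʳ-* n 2 E) ⟩
    2 ^ n * E ^ n * L ^ n            ≡⟨ rearrange (2 ^ n) (E ^ n) (L ^ n) ⟩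
    E ^ n * (2 ^ n * L ^ n)          ≤⟨ *-monoˡ-≤ (2 ^ n * L ^ n) (^-monoʳ-≤ E (≤-trans (<⇒≤ n<2^L) (^-monoʳ-≤ 2 (≰⇒≥ E≰L)))) ⟩
    E ^ (2 ^ E) * (2 ^ n * L ^ n)    ∎
    where
    open ≤-Reasoning
    rearrange : ∀ a b c → a * b * c ≡ b * (a * c)
    rearrange = solve-∀

  ∥F∥*[L+E]^n≤ : ∀ {D n} (F : Family D n) → SunflowerFree F → ∀ j E → 1 ≤ E → 2 ^ j ≤ n → n < 2 ^ suc j →
                 ∥ F ∥ * (suc j + E) ^ n ≤ E ^ (2 ^ E) * (4608 ^ n * n !)
  ∥F∥*[L+E]^n≤ {n = n} F free j E 1≤E 2^j≤n n<2^[1+j] = begin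
    ∥ F ∥ * (suc j + E) ^ n                            ≤⟨ *-monoʳ-≤ ∥ F ∥ ([L+E]^n≤ (suc j) E (s≤s z≤n) 1≤E n<2^[1+j]) ⟩
    ∥ F ∥ * (E ^ (2 ^ E) * (2 ^ n * suc j ^ n))        ≡⟨ rearrange ∥ F ∥ (E ^ (2 ^ E)) (2 ^ n) (suc j ^ n) ⟩
    E ^ (2 ^ E) * (2 ^ n * (∥ F ∥ * suc j ^ n))        ≤⟨ *-monoʳ-≤ (E ^ (2 ^ E)) (*-monoʳ-≤ (2 ^ n) (∥F∥*L^n≤ F free j 2^j≤n)) ⟩
    E ^ (2 ^ E) * (2 ^ n * (2304 ^ n * n !))           ≡⟨ cong (E ^ (2 ^ E) *_) (*-assoc (2 ^ n) (2304 ^ n) (n !)) ⟨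
    E ^ (2 ^ E) * (2 ^ n * 2304 ^ n * n !)             ≡⟨ cong (λ k → E ^ (2 ^ E) * (k * n !)) (^-distribʳ-* n 2 2304) ⟨
    E ^ (2 ^ E) * (4608 ^ n * n !)                     ∎
    where
    open ≤-Reasoning
    rearrange : ∀ a b c d → a * (b * (c * d)) ≡ b * (c * (a * d))
    rearrange = solve-∀

open Combinatorics using (bitLength; ∥F∥*[L+E]^n≤)

open import Defs
open import Data.Nat.Base as ℕ using (ℕ; _!)
open import Data.Product using (∃; _×_)
open Estimates
open import Data.Integer.Base using (+_)
import Data.Integer.Base as ℤ
import Data.Integer.Properties as ℤ
open import Data.Nat.Base using (zero; suc; z≤n; s≤s)
import Data.Nat.Properties as ℕ
open import Data.Product using (_,_; proj₁; proj₂)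
open import Data.Rational.Base as ℚ
  using (ℚ; 0ℚ; 1ℚ; ½; ∣_∣; nonNegative)
  renaming (_+_ to _+ʳ_; _*_ to _*ʳ_; _-_ to _-ʳ_; -_ to -ʳ_; _/_ to _/ʳ_; _≤_ to _≤ʳ_; _<_ to _<ʳ_)
import Data.Rational.Properties as ℚ
open import Data.Rational.Solver using (module +-*-Solver)
open import Data.Rational.Unnormalised.Base as ℚᵘ using (mkℚᵘ)
import Data.Rational.Unnormalised.Properties as ℚᵘ
open import Data.Sum.Base using (_⊎_; inj₁; inj₂; [_,_]′)
open import Relation.Binary.PropositionalEquality
  using (_≡_; refl; sym; trans; cong; cong₂; subst; subst₂; module ≡-Reasoning)
open import Relation.Nullary using (¬_; yes; no; contradiction)
open import Relation.Nullary.Decidable using (True; toWitness)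

-- Eventual inequalities between rationals

Eventually : (ℕ → Set) → Set
Eventually P = ∃ λ N → ∀ k → N ℕ.≤ k → P k

ev-map : {P Q : ℕ → Set} → (∀ k → P k → Q k) → Eventually P → Eventually Q
ev-map f (N , p) = N , λ k N≤k → f k (p k N≤k)

ev-map₂ : {P Q R : ℕ → Set} → (∀ k → P k → Q k → R k) → Eventually P → Eventually Q → Eventually R
ev-map₂ f (N , p) (M , q) = N ℕ.⊔ M , λ k h →
  f k (p k (ℕ.≤-trans (ℕ.m≤m⊔n N M) h)) (q k (ℕ.≤-trans (ℕ.m≤n⊔m N M) h))

ev-≥ : ∀ K → Eventually (K ℕ.≤_)
ev-≥ K = K , λ _ h → h

toℚᵘ-fromℕʳ : ∀ n → ℚ.toℚᵘ (fromℕʳ n) ℚᵘ.≃ mkℚᵘ (+ n) 0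
toℚᵘ-fromℕʳ n = ℚ.toℚᵘ-fromℚᵘ (mkℚᵘ (+ n) 0)

fromℕʳ-+ : ∀ m n → fromℕʳ (m ℕ.+ n) ≡ fromℕʳ m +ʳ fromℕʳ n
fromℕʳ-+ m n = ℚ.toℚᵘ-injective (ℚᵘ.≃-trans (toℚᵘ-fromℕʳ (m ℕ.+ n)) (ℚᵘ.≃-sym
  (ℚᵘ.≃-trans (ℚ.toℚᵘ-homo-+ (fromℕʳ m) (fromℕʳ n))
  (ℚᵘ.≃-trans (ℚᵘ.+-cong (toℚᵘ-fromℕʳ m) (toℚᵘ-fromℕʳ n))
  (ℚᵘ.*≡* (cong (ℤ._* + 1) (cong₂ ℤ._+_ (ℤ.*-identityʳ (+ m)) (ℤ.*-identityʳ (+ n)))))))))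

fromℕʳ-* : ∀ m n → fromℕʳ (m ℕ.* n) ≡ fromℕʳ m *ʳ fromℕʳ n
fromℕʳ-* m n = ℚ.toℚᵘ-injective (ℚᵘ.≃-trans (toℚᵘ-fromℕʳ (m ℕ.* n)) (ℚᵘ.≃-sym
  (ℚᵘ.≃-trans (ℚ.toℚᵘ-homo-* (fromℕʳ m) (fromℕʳ n))
  (ℚᵘ.≃-trans (ℚᵘ.*-cong (toℚᵘ-fromℕʳ m) (toℚᵘ-fromℕʳ n))
  (ℚᵘ.*≡* (cong (ℤ._* + 1) (sym (ℤ.pos-* m n))))))))

fromℕʳ-cancel-< : ∀ {m n} → fromℕʳ m <ʳ fromℕʳ n → m ℕ.< n
fromℕʳ-cancel-< {m} {n} m<n with m ℕ.<? n
... | yes m<n′ = m<n′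
... | no  m≮n  = contradiction (ℚ.<-≤-trans m<n (fromℕʳ-mono (ℕ.≮⇒≥ m≮n))) (ℚ.<-irrefl refl)

0≤fromℕʳ : ∀ n → 0ℚ ≤ʳ fromℕʳ n
0≤fromℕʳ n = fromℕʳ-mono {0} {n} z≤n

0<fromℕʳ-suc : ∀ n → 0ℚ <ʳ fromℕʳ (suc n)
0<fromℕʳ-suc n = ℚ.<-≤-trans 0<1 (fromℕʳ-mono {1} {suc n} (s≤s z≤n))

≤-+ˡ : ∀ {a b} → 0ℚ ≤ʳ b → a ≤ʳ a +ʳ b
≤-+ˡ {a} {b} 0≤b = subst (_≤ʳ a +ʳ b) (ℚ.+-identityʳ a) (ℚ.+-monoʳ-≤ a 0≤b)

∣-∣≤⇒≤ : ∀ {a b ε} → ∣ a -ʳ b ∣ ≤ʳ ε → a ≤ʳ b +ʳ ε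
∣-∣≤⇒≤ {a} {b} {ε} h = ℚ.≤-trans
  (ℚ.≤-reflexive (solve 2 (λ a b → a := b :+ (a :- b)) refl a b))
  (ℚ.+-monoʳ-≤ b (ℚ.≤-trans (p≤∣p∣ (a -ʳ b)) h))
  where open +-*-Solver

∣-∣≤⇒≥ : ∀ {a b ε} → ∣ a -ʳ b ∣ ≤ʳ ε → b ≤ʳ a +ʳ ε
∣-∣≤⇒≥ {a} {b} h = ∣-∣≤⇒≤ (ℚ.≤-trans (ℚ.≤-reflexive (∣-∣-sym b a)) h)

-- Carrying bounds through the exponential

expTerm-mono : ∀ {p q} → 0ℚ ≤ʳ p → p ≤ʳ q → ∀ k → expTerm p k ≤ʳ expTerm q k
expTerm-mono 0≤p p≤q zero = ℚ.≤-refl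
expTerm-mono {p} {q} 0≤p p≤q (suc k) = *-mono-≤ʳ (0≤expTerm (ℚ.≤-trans 0≤p p≤q) k)
  (0≤* 0≤p 0≤u) (expTerm-mono 0≤p p≤q k) (ℚ.*-monoʳ-≤-nonNeg (+ 1 /ʳ suc k) {{nonNegative 0≤u}} p≤q)
  where
  0≤u : 0ℚ ≤ʳ + 1 /ʳ suc k
  0≤u = ℚ.<⇒≤ (0<1/suc k)

expSum-monoˡ : ∀ {p q} → 0ℚ ≤ʳ p → p ≤ʳ q → ∀ k → expSum p k ≤ʳ expSum q k
expSum-monoˡ 0≤p p≤q zero    = ℚ.≤-refl
expSum-monoˡ 0≤p p≤q (suc k) = ℚ.+-mono-≤ (expSum-monoˡ 0≤p p≤q k) (expTerm-mono 0≤p p≤q k)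

expSum-monoʳ : ∀ {p} → 0ℚ ≤ʳ p → ∀ {k l} → k ℕ.≤ l → expSum p k ≤ʳ expSum p l
expSum-monoʳ {p} 0≤p {k} k≤l = go (ℕ.≤⇒≤′ k≤l)
  where
  go : ∀ {l} → k ℕ.≤′ l → expSum p k ≤ʳ expSum p l
  go ℕ.≤′-refl           = ℚ.≤-refl
  go (ℕ.≤′-step {l} k≤l) = ℚ.≤-trans (go k≤l) (≤-+ˡ (0≤expTerm 0≤p l))

-- At nonnegative arguments the partial sums grow with the argument and with the number of terms, so
-- K terms at `b` already bound exp y from below.
log-lower : ∀ {x y} → IsLog y x → ∀ {b} → 0ℚ ≤ʳ b → Eventually (λ k → b ≤ʳ seq y k) →
            ∀ K ε → 0ℚ <ʳ ε → Eventually (λ k → expSum b K ≤ʳ seq x k +ʳ ε)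
log-lower {x} {y} is-log {b} 0≤b b≤y K ε 0<ε = ev-map₂
  (λ { k (b≤yₖ , K≤k) close → ℚ.≤-trans (expSum-monoʳ 0≤b K≤k) (ℚ.≤-trans (expSum-monoˡ 0≤b b≤yₖ k) (∣-∣≤⇒≤ {expSum (seq y k) k} {seq x k} close)) })
  (ev-map₂ (λ k → _,_) b≤y (ev-≥ K)) (exp-log is-log ε 0<ε)

halving-from : ∀ {b} (0≤b : 0ℚ ≤ʳ b) K → b +ʳ b ≤ʳ fromℕʳ (suc K) → Halving 0≤b K
halving-from {b} 0≤b K 2b≤ k K≤k = begin
  t *ʳ (b *ʳ u) +ʳ t *ʳ (b *ʳ u)    ≡⟨ solve 3 (λ t b u → t :* (b :* u) :+ t :* (b :* u) := t :* ((b :+ b) :* u)) refl t b u ⟩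
  t *ʳ ((b +ʳ b) *ʳ u)              ≤⟨ ℚ.*-monoˡ-≤-nonNeg t {{nonNegative (0≤expTerm 0≤b k)}}
                                         (ℚ.*-monoʳ-≤-nonNeg u {{nonNegative (ℚ.<⇒≤ (0<1/suc k))}}
                                           (ℚ.≤-trans 2b≤ (fromℕʳ-mono (s≤s K≤k)))) ⟩
  t *ʳ (fromℕʳ (suc k) *ʳ u)        ≡⟨ cong (t *ʳ_) (suc*1/suc k) ⟩
  t *ʳ 1ℚ                           ≡⟨ ℚ.*-identityʳ t ⟩
  t                                 ∎
  where
  open ℚ.≤-Reasoning
  open +-*-Solver
  t u : ℚ
  t = expTerm b k
  u = + 1 /ʳ suc k

-- From index K on each term at `b` is at most half the preceding one, so the remainder is at most
-- twice the first omitted term.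
expSum-tail : ∀ {b} (0≤b : 0ℚ ≤ʳ b) K → b +ʳ b ≤ʳ fromℕʳ (suc K) → ∀ {q} → ∣ q ∣ ≤ʳ b → ∀ k → K ℕ.≤ k →
              ∣ expSum q k -ʳ expSum q K ∣ ≤ʳ expTerm b K +ʳ expTerm b K
expSum-tail {b} 0≤b K 2b≤ {q} q≤b k K≤k = subst (λ i → ∣ expSum q i -ʳ expSum q K ∣ ≤ʳ expTerm b K +ʳ expTerm b K) (ℕ.m∸n+n≡m K≤k)
  (ℚ.≤-trans (≤-+ˡ (ℚ.+-mono-≤ (0≤expTerm 0≤b i) (0≤expTerm 0≤b i)))
    (tail 0≤b K (halving-from 0≤b K 2b≤) q≤b K ℕ.≤-refl (k ℕ.∸ K)))
  where
  i : ℕ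
  i = k ℕ.∸ K ℕ.+ K

log-upper : ∀ {x y} → IsLog y x → ∀ {b} → 0ℚ ≤ʳ b → Eventually (λ k → 0ℚ ≤ʳ seq y k) → Eventually (λ k → seq y k ≤ʳ b) →
            ∀ K → b +ʳ b ≤ʳ fromℕʳ (suc K) → ∀ ε → 0ℚ <ʳ ε →
            Eventually (λ k → seq x k ≤ʳ expSum b K +ʳ (expTerm b K +ʳ expTerm b K) +ʳ ε)
log-upper {x} {y} is-log {b} 0≤b 0≤y y≤b K 2b≤ ε 0<ε = ev-map₂
  (λ { k ((0≤yₖ , yₖ≤b) , K≤k) close → ℚ.≤-trans (∣-∣≤⇒≥ {expSum (seq y k) k} {seq x k} close) (ℚ.+-monoˡ-≤ ε
    (ℚ.≤-trans (expSum-monoˡ 0≤yₖ yₖ≤b k) (∣-∣≤⇒≤ {expSum b k} {expSum b K} (expSum-tail 0≤b K 2b≤ (ℚ.≤-reflexive (ℚ.0≤p⇒∣p∣≡p 0≤b)) k K≤k)))) })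
  (ev-map₂ (λ k → _,_) (ev-map₂ (λ k → _,_) 0≤y y≤b) (ev-≥ K)) (exp-log is-log ε 0<ε)

-- Order on Cauchy reals is not decidable; the overlapping alternatives are decided by comparing the
-- single rational f N with a + ε.
dichotomy : (f : ℕ → ℚ) (ε : ℚ) → (∃ λ N → ∀ k → N ℕ.≤ k → f k ≤ʳ f N +ʳ ε × f N ≤ʳ f k +ʳ ε) → ∀ a →
            Eventually (λ k → f k ≤ʳ a +ʳ ε +ʳ ε) ⊎ Eventually (λ k → a ≤ʳ f k)
dichotomy f ε (N , close) a with f N ℚ.≤? a +ʳ ε
... | yes fN≤ = inj₁ (N , λ k N≤k → ℚ.≤-trans (proj₁ (close k N≤k)) (ℚ.+-monoˡ-≤ ε fN≤))
... | no  fN≰ = inj₂ (N , λ k N≤k → cancel (ℚ.≤-trans (ℚ.<⇒≤ (ℚ.≰⇒> fN≰)) (proj₂ (close k N≤k))))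
  where
  open +-*-Solver
  cancel : ∀ {c} → a +ʳ ε ≤ʳ c +ʳ ε → a ≤ʳ c
  cancel {c} h = subst₂ _≤ʳ_ (p+ε-ε a) (p+ε-ε c) (ℚ.+-monoˡ-≤ (-ʳ ε) h)
    where
    p+ε-ε : ∀ p → p +ʳ ε +ʳ -ʳ ε ≡ p
    p+ε-ε p = solve 2 (λ p ε → p :+ ε :+ :- ε := p) refl p ε

dichotomy-seq : (x : ℝ) (a ε : ℚ) → 0ℚ <ʳ ε →
                Eventually (λ k → seq x k ≤ʳ a +ʳ ε +ʳ ε) ⊎ Eventually (λ k → a ≤ʳ seq x k)
dichotomy-seq x a ε 0<ε with cauchy x ε 0<ε
... | N , close = dichotomy (seq x) ε (N , λ k N≤k →
  ∣-∣≤⇒≤ {seq x k} {seq x N} (close k N N≤k ℕ.≤-refl) , ∣-∣≤⇒≤ {seq x N} {seq x k} (close N k ℕ.≤-refl N≤k)) a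

dichotomy-∣seq∣ : (x : ℝ) (a ε : ℚ) → 0ℚ <ʳ ε →
                  Eventually (λ k → ∣ seq x k ∣ ≤ʳ a +ʳ ε +ʳ ε) ⊎ Eventually (λ k → a ≤ʳ ∣ seq x k ∣)
dichotomy-∣seq∣ x a ε 0<ε with cauchy x ε 0<ε
... | N , close = dichotomy (λ k → ∣ seq x k ∣) ε (N , λ k N≤k →
  ∣∣-close {seq x k} {seq x N} (close k N N≤k ℕ.≤-refl) , ∣∣-close {seq x N} {seq x k} (close N k ℕ.≤-refl N≤k)) a
  where
  open +-*-Solver
  ∣∣-close : ∀ {p q} → ∣ p -ʳ q ∣ ≤ʳ ε → ∣ p ∣ ≤ʳ ∣ q ∣ +ʳ ε
  ∣∣-close {p} {q} h = ℚ.≤-trans (ℚ.≤-reflexive (cong ∣_∣ (solve 2 (λ p q → p := q :+ (p :- q)) refl p q)))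
    (ℚ.≤-trans (ℚ.∣p+q∣≤∣p∣+∣q∣ q (p -ʳ q)) (ℚ.+-monoʳ-≤ ∣ q ∣ h))

computed-≤ : (p q : ℚ) {_ : True (p ℚ.≤? q)} → p ≤ʳ q
computed-≤ p q {t} = toWitness t

computed-< : (p q : ℚ) {_ : True (p ℚ.<? q)} → p <ʳ q
computed-< p q {t} = toWitness t

+-cancelʳ-≤ʳ : ∀ c {a b} → a +ʳ c ≤ʳ b +ʳ c → a ≤ʳ b
+-cancelʳ-≤ʳ c {a} {b} h = subst₂ _≤ʳ_ (p+c-c a) (p+c-c b) (ℚ.+-monoˡ-≤ (-ʳ c) h)
  where
  open +-*-Solver
  p+c-c : ∀ p → p +ʳ c +ʳ -ʳ c ≡ p
  p+c-c p = solve 2 (λ p c → p :+ c :+ :- c := p) refl p c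

-- Keeping log log log n away from 0

-- eᵉ lies strictly between 15 and 16, so log log log n stays away from 0.
logloglog-not-small : ∀ n {x y z} → IsLog x (fromℕ n) → IsLog y x → IsLog z y →
                      ¬ Eventually (λ k → ∣ seq z k ∣ ≤ʳ + 1 /ʳ 4000)
logloglog-not-small n {x} {y} {z} n-x x-y y-z small = contradiction n<16 (ℕ.≤⇒≯ 15<n)
  where
  c δ : ℚ
  c = + 1 /ʳ 4000
  δ = + 1 /ʳ 2000
  0≤c : 0ℚ ≤ʳ c
  0≤c = computed-≤ _ _
  near-1 : Eventually (λ k → ∣ expSum (seq z k) k -ʳ 1ℚ ∣ ≤ʳ δ)
  -- The first partial sum is 1, and twice the next term at `c` is exactly `δ`; a further `δ` in
  -- `y-bounds` is the error of exp z ≈ y.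
  near-1 = ev-map₂ (λ k small 1≤k → expSum-tail 0≤c 1 (computed-≤ _ _) small k 1≤k) small (ev-≥ 1)
  y-bounds : Eventually (λ k → + 999 /ʳ 1000 ≤ʳ seq y k × seq y k ≤ʳ + 1001 /ʳ 1000)
  y-bounds = ev-map₂ (λ k near close →
    let ∣y-1∣≤ = triangle (seq y k) (expSum (seq z k) k) 1ℚ (ℚ.≤-trans (ℚ.≤-reflexive (∣-∣-sym (seq y k) (expSum (seq z k) k))) close) near
    in +-cancelʳ-≤ʳ (δ +ʳ δ) (∣-∣≤⇒≥ {seq y k} {1ℚ} ∣y-1∣≤) , ∣-∣≤⇒≤ {seq y k} {1ℚ} ∣y-1∣≤)
    near-1 (exp-log y-z δ (computed-< _ _))
  -- The bracket 19/7 < e < 11/4 leaves room for the errors, and its exponentials, about 15.09 and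
  -- 15.64, still lie between 15 and 16.
  x-lower : Eventually (λ k → + 19 /ʳ 7 ≤ʳ seq x k)
  x-lower = ev-map (λ k h → +-cancelʳ-≤ʳ δ (ℚ.≤-trans (computed-≤ (+ 19 /ʳ 7 +ʳ δ) (expSum (+ 999 /ʳ 1000) 7)) h))
    (log-lower x-y (computed-≤ _ _) (ev-map (λ _ → proj₁) y-bounds) 7 δ (computed-< _ _))
  x-upper : Eventually (λ k → seq x k ≤ʳ + 11 /ʳ 4)
  x-upper = ev-map (λ k h → ℚ.≤-trans h (computed-≤ _ _))
    (log-upper x-y {+ 1001 /ʳ 1000} (computed-≤ _ _) (ev-map (λ _ b → ℚ.≤-trans (computed-≤ _ _) (proj₁ b)) y-bounds) (ev-map (λ _ → proj₂) y-bounds)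
      5 (computed-≤ _ _) δ (computed-< _ _))
  ε : ℚ
  ε = + 1 /ʳ 100
  15<n : 15 ℕ.< n
  15<n = unpack (log-lower n-x (computed-≤ _ _) x-lower 9 ε (computed-< _ _)) λ N h → fromℕʳ-cancel-< (ℚ.≰⇒> λ n≤15 → ℚ.<-irrefl refl (ℚ.<-≤-trans (computed-< (fromℕʳ 15 +ʳ ε) (expSum (+ 19 /ʳ 7) 9))
    (ℚ.≤-trans (h N ℕ.≤-refl) (ℚ.+-monoˡ-≤ ε n≤15))))
  n<16 : n ℕ.< 16
  n<16 = unpack (log-upper n-x {+ 11 /ʳ 4} (computed-≤ _ _) (ev-map (λ _ → ℚ.≤-trans (computed-≤ _ _)) x-lower) x-upper 8 (computed-≤ _ _) ε (computed-< _ _)) λ N h → fromℕʳ-cancel-< (ℚ.≤-<-trans (h N ℕ.≤-refl) (computed-< _ _))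

-- The threshold 1/12000 is a third of 1/4000: the overlap of the dichotomy adds 2/12000.
logloglog-apart : ∀ n {x y z} → IsLog x (fromℕ n) → IsLog y x → IsLog z y →
                  Eventually (λ k → + 1 /ʳ 12000 ≤ʳ ∣ seq z k ∣)
logloglog-apart n {z = z} n-x x-y y-z = [ (λ small → contradiction small (logloglog-not-small n n-x x-y y-z)) , (λ apart → apart) ]′
  (dichotomy-∣seq∣ z (+ 1 /ʳ 12000) (+ 1 /ʳ 12000) (computed-< _ _))

-- Comparing log log n with the bit length of n

-- Two terms of the binomial expansion of (x + 1)^(k+1) / (k+1)!.
expTerm-shift : ∀ {x} → 0ℚ ≤ʳ x → ∀ k → expTerm x (suc k) +ʳ expTerm x k ≤ʳ expTerm (x +ʳ 1ℚ) (suc k)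
expTerm-shift {x} 0≤x zero = ℚ.≤-reflexive
  (solve 1 (λ x → con 1ℚ :* (x :* con 1ℚ) :+ con 1ℚ := con 1ℚ :* ((x :+ con 1ℚ) :* con 1ℚ)) refl x)
  where open +-*-Solver
expTerm-shift {x} 0≤x (suc k) = begin
  t *ʳ u′ *ʳ (x *ʳ v) +ʳ t *ʳ u′                    ≡⟨ cong (λ e → t *ʳ u′ *ʳ (x *ʳ v) +ʳ e) (sym (trans (cong (t *ʳ u′ *ʳ_) v-inverse) (ℚ.*-identityʳ _))) ⟩
  t *ʳ u′ *ʳ (x *ʳ v) +ʳ t *ʳ u′ *ʳ ((1ℚ +ʳ s) *ʳ v)
                                                    ≡⟨ solve 5 (λ t u x v s → t :* (x :* u) :* (x :* v) :+ t :* (x :* u) :* ((con 1ℚ :+ s) :* v) :=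
                                                         (t :* (x :* u) :* (x :+ con 1ℚ) :+ t :* (x :* (s :* u))) :* v) refl t u x v s ⟩
  (t *ʳ u′ *ʳ (x +ʳ 1ℚ) +ʳ t *ʳ (x *ʳ (s *ʳ u))) *ʳ v
                                                    ≡⟨ cong (λ e → (t *ʳ u′ *ʳ (x +ʳ 1ℚ) +ʳ t *ʳ (x *ʳ e)) *ʳ v) (suc*1/suc k) ⟩
  (t *ʳ u′ *ʳ (x +ʳ 1ℚ) +ʳ t *ʳ (x *ʳ 1ℚ)) *ʳ v     ≤⟨ ℚ.*-monoʳ-≤-nonNeg v {{nonNegative 0≤v}} (ℚ.+-monoʳ-≤ (t *ʳ u′ *ʳ (x +ʳ 1ℚ))
                                                         (ℚ.*-monoˡ-≤-nonNeg t {{nonNegative (0≤expTerm 0≤x k)}} x1≤x+1)) ⟩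
  (t *ʳ u′ *ʳ (x +ʳ 1ℚ) +ʳ t *ʳ (x +ʳ 1ℚ)) *ʳ v     ≡⟨ solve 4 (λ t u y v → (t :* u :* y :+ t :* y) :* v := (t :* u :+ t) :* (y :* v)) refl t u′ (x +ʳ 1ℚ) v ⟩
  (t *ʳ u′ +ʳ t) *ʳ ((x +ʳ 1ℚ) *ʳ v)                ≤⟨ ℚ.*-monoʳ-≤-nonNeg ((x +ʳ 1ℚ) *ʳ v) {{nonNegative (0≤* 0≤x+1 0≤v)}} (expTerm-shift 0≤x k) ⟩
  expTerm (x +ʳ 1ℚ) (suc (suc k))                   ∎
  where
  open ℚ.≤-Reasoning
  open +-*-Solver
  t u v s u′ : ℚ
  t = expTerm x k
  u = + 1 /ʳ suc k
  v = + 1 /ʳ suc (suc k)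
  s = fromℕʳ (suc k)
  u′ = x *ʳ u
  0≤v : 0ℚ ≤ʳ v
  0≤v = ℚ.<⇒≤ (0<1/suc (suc k))
  0≤x+1 : 0ℚ ≤ʳ x +ʳ 1ℚ
  0≤x+1 = ℚ.≤-trans 0≤x (≤-+ˡ (ℚ.<⇒≤ 0<1))
  x1≤x+1 : x *ʳ 1ℚ ≤ʳ x +ʳ 1ℚ
  x1≤x+1 = ℚ.≤-trans (ℚ.≤-reflexive (ℚ.*-identityʳ x)) (≤-+ˡ (ℚ.<⇒≤ 0<1))
  v-inverse : (1ℚ +ʳ s) *ʳ v ≡ 1ℚ
  v-inverse = trans (cong (_*ʳ v) (sym (fromℕʳ-+ 1 (suc k)))) (suc*1/suc (suc k))

-- The inequality 2 eˣ ≤ e^(x+1) for partial sums. One copy has a term fewer, hence the `suc L`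
-- terms needed for 2^L ≤ e^L.
expSum-shift : ∀ {x} → 0ℚ ≤ʳ x → ∀ k → expSum x (suc k) +ʳ expSum x k ≤ʳ expSum (x +ʳ 1ℚ) (suc k)
expSum-shift {x} 0≤x zero    = computed-≤ _ _
expSum-shift {x} 0≤x (suc k) = ℚ.≤-trans
  (ℚ.≤-reflexive (solve 4 (λ a b c d → (a :+ b) :+ (c :+ d) := (a :+ c) :+ (b :+ d)) refl (expSum x (suc k)) (expTerm x (suc k)) (expSum x k) (expTerm x k)))
  (ℚ.+-mono-≤ (expSum-shift 0≤x k) (expTerm-shift 0≤x k))
  where open +-*-Solver

2^L≤exp-L : ∀ L → fromℕʳ (2 ℕ.^ L) ≤ʳ expSum (fromℕʳ L) (suc L)
2^L≤exp-L zero    = computed-≤ _ _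
2^L≤exp-L (suc L) = begin
  fromℕʳ (2 ℕ.^ suc L)                                                ≡⟨ trans (cong (λ e → fromℕʳ (2 ℕ.^ L ℕ.+ e)) (ℕ.+-identityʳ _)) (fromℕʳ-+ (2 ℕ.^ L) (2 ℕ.^ L)) ⟩
  fromℕʳ (2 ℕ.^ L) +ʳ fromℕʳ (2 ℕ.^ L)                                ≤⟨ ℚ.+-mono-≤ (ℚ.≤-trans (2^L≤exp-L L) (expSum-monoʳ (0≤fromℕʳ L) (ℕ.n≤1+n (suc L)))) (2^L≤exp-L L) ⟩
  expSum (fromℕʳ L) (suc (suc L)) +ʳ expSum (fromℕʳ L) (suc L)        ≤⟨ expSum-shift (0≤fromℕʳ L) (suc L) ⟩
  expSum (fromℕʳ L +ʳ 1ℚ) (suc (suc L))                               ≡⟨ cong (λ e → expSum e (suc (suc L))) (trans (ℚ.+-comm (fromℕʳ L) 1ℚ) (sym (fromℕʳ-+ 1 L))) ⟩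
  expSum (fromℕʳ (suc L)) (suc (suc L))                               ∎
  where open ℚ.≤-Reasoning

-- If loglog n exceeded β = L/B + B, then log n ≥ β²/2 ≥ L and n ≥ 2ᴸ.
loglog-upper : ∀ n L B {x y} → n ℕ.< 2 ℕ.^ L → IsLog x (fromℕ n) → IsLog y x → 0ℚ <ʳ fromℕʳ B →
               Eventually (λ k → seq y k ≤ʳ fromℕʳ L *ʳ recip (fromℕʳ B) +ʳ fromℕʳ B +ʳ ½ +ʳ ½)
loglog-upper n L B {x} {y} n<2^L n-x x-y 0<B = [ (λ y≤ → y≤) , (λ β≤y → contradiction n<2^L (ℕ.≤⇒≯ (ℕ.s≤s⁻¹ (2^L<1+n β≤y)))) ]′
  (dichotomy-seq y β ½ (computed-< _ _))
  where
  open +-*-Solver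
  ℓ b r β : ℚ
  ℓ = fromℕʳ L
  b = fromℕʳ B
  r = recip b
  β = ℓ *ʳ r +ʳ b
  0≤ℓr : 0ℚ ≤ʳ ℓ *ʳ r
  0≤ℓr = 0≤* (0≤fromℕʳ L) (ℚ.<⇒≤ (recip-pos 0<B))
  0≤b : 0ℚ ≤ʳ b
  0≤b = ℚ.<⇒≤ 0<B
  0≤β : 0ℚ ≤ʳ β
  0≤β = ℚ.≤-trans 0≤ℓr (≤-+ˡ 0≤b)
  -- The mixed product in β²/2 is (L/B) · B = L. The constant term 1 is kept as well, to pay for the
  -- error 1 in `ℓ≤x`.
  ℓ+1≤exp-β : ℓ +ʳ 1ℚ ≤ʳ expSum β 3
  ℓ+1≤exp-β = begin
    ℓ +ʳ 1ℚ                                         ≡⟨ cong (_+ʳ 1ℚ) (sym (trans (cong (ℓ *ʳ_) (recip-inverse 0<B)) (ℚ.*-identityʳ ℓ))) ⟩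
    ℓ *ʳ (b *ʳ r) +ʳ 1ℚ                             ≤⟨ ≤-+ˡ (ℚ.+-mono-≤ 0≤β (0≤* (ℚ.<⇒≤ (computed-< 0ℚ ½)) (ℚ.+-mono-≤ (0≤* 0≤ℓr 0≤ℓr) (0≤* 0≤b 0≤b)))) ⟩
    ℓ *ʳ (b *ʳ r) +ʳ 1ℚ +ʳ (β +ʳ ½ *ʳ (ℓ *ʳ r *ʳ (ℓ *ʳ r) +ʳ b *ʳ b))
                                                    ≡⟨ solve 3 (λ ℓ b r → ℓ :* (b :* r) :+ con 1ℚ :+ ((ℓ :* r :+ b) :+ con ½ :* (ℓ :* r :* (ℓ :* r) :+ b :* b)) :=
                                                         con 0ℚ :+ con 1ℚ :+ con 1ℚ :* ((ℓ :* r :+ b) :* con 1ℚ) :+ con 1ℚ :* ((ℓ :* r :+ b) :* con 1ℚ) :* ((ℓ :* r :+ b) :* con ½)) refl ℓ b r ⟩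
    expSum β 3                                      ∎
    where open ℚ.≤-Reasoning
  module _ (β≤y : Eventually (λ k → β ≤ʳ seq y k)) where
    ℓ≤x : Eventually (λ k → ℓ ≤ʳ seq x k)
    ℓ≤x = ev-map (λ k h → +-cancelʳ-≤ʳ 1ℚ (ℚ.≤-trans ℓ+1≤exp-β h)) (log-lower x-y 0≤β β≤y 3 1ℚ 0<1)
    2^L<1+n : 2 ℕ.^ L ℕ.< suc n
    2^L<1+n = unpack (log-lower n-x (0≤fromℕʳ L) ℓ≤x (suc L) ½ (computed-< _ _)) λ N h →
      fromℕʳ-cancel-< (ℚ.≤-<-trans (ℚ.≤-trans (2^L≤exp-L L) (h N ℕ.≤-refl))
        (ℚ.<-≤-trans (ℚ.+-monoʳ-< (fromℕʳ n) (computed-< ½ 1ℚ)) (ℚ.≤-reflexive (trans (ℚ.+-comm (fromℕʳ n) 1ℚ) (sym (fromℕʳ-+ 1 n))))))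

-- Powers, quotients and the final comparison

infixr 8 _^ʳ_

_^ʳ_ : ℚ → ℕ → ℚ
q ^ʳ zero  = 1ℚ
q ^ʳ suc n = q *ʳ q ^ʳ n

seq-^ : ∀ x n k → seq (x ^ n) k ≡ seq x k ^ʳ n
seq-^ x zero    k = refl
seq-^ x (suc n) k = cong (seq x k *ʳ_) (seq-^ x n k)

fromℕʳ-^ : ∀ m n → fromℕʳ (m ℕ.^ n) ≡ fromℕʳ m ^ʳ n
fromℕʳ-^ m zero    = refl
fromℕʳ-^ m (suc n) = trans (fromℕʳ-* m (m ℕ.^ n)) (cong (fromℕʳ m *ʳ_) (fromℕʳ-^ m n))

^ʳ-distrib-* : ∀ p q n → (p *ʳ q) ^ʳ n ≡ p ^ʳ n *ʳ q ^ʳ n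
^ʳ-distrib-* p q zero    = refl
^ʳ-distrib-* p q (suc n) = trans (cong (p *ʳ q *ʳ_) (^ʳ-distrib-* p q n))
  (solve 4 (λ p q x y → p :* q :* (x :* y) := p :* x :* (q :* y)) refl p q (p ^ʳ n) (q ^ʳ n))
  where open +-*-Solver

1^ʳ : ∀ n → 1ℚ ^ʳ n ≡ 1ℚ
1^ʳ zero    = refl
1^ʳ (suc n) = trans (ℚ.*-identityˡ _) (1^ʳ n)

0≤^ʳ : ∀ {p} → 0ℚ ≤ʳ p → ∀ n → 0ℚ ≤ʳ p ^ʳ n
0≤^ʳ 0≤p zero    = ℚ.<⇒≤ 0<1
0≤^ʳ 0≤p (suc n) = 0≤* 0≤p (0≤^ʳ 0≤p n)

^ʳ-mono-≤ : ∀ {p q} → 0ℚ ≤ʳ p → p ≤ʳ q → ∀ n → p ^ʳ n ≤ʳ q ^ʳ n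
^ʳ-mono-≤ 0≤p p≤q zero    = ℚ.≤-refl
^ʳ-mono-≤ 0≤p p≤q (suc n) = *-mono-≤ʳ (ℚ.≤-trans 0≤p p≤q) (0≤^ʳ 0≤p n) p≤q (^ʳ-mono-≤ 0≤p p≤q n)

square : ∀ q → ∣ q ∣ *ʳ ∣ q ∣ ≡ q *ʳ (q *ʳ 1ℚ)
square q with ℚ.∣p∣≡p∨∣p∣≡-p q
... | inj₁ ∣q∣≡q  = trans (cong₂ _*ʳ_ ∣q∣≡q ∣q∣≡q) (cong (q *ʳ_) (sym (ℚ.*-identityʳ q)))
... | inj₂ ∣q∣≡-q = trans (cong₂ _*ʳ_ ∣q∣≡-q ∣q∣≡-q) (solve 1 (λ q → :- q :* :- q := q :* (q :* con 1ℚ)) refl q)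
  where open +-*-Solver

bounded-above : (x : ℝ) → ∃ λ A → Eventually (λ k → seq x k ≤ʳ fromℕʳ (suc A))
bounded-above x = unpack (bounded (cauchy x)) λ { b (_ , N , x≤b) →
  unpack (archimedean b) λ A b≤A → A , N , λ k N≤k →
    ℚ.≤-trans (p≤∣p∣ (seq x k)) (ℚ.≤-trans (x≤b k N≤k) (ℚ.≤-trans b≤A (fromℕʳ-mono {A} {suc A} (ℕ.n≤1+n A)))) }

eventually-0< : ∀ {x} → 0ℝ < x → Eventually (λ k → 0ℚ <ʳ seq x k)
eventually-0< {x} (ε , 0<ε , N , h) = N , λ k N≤k → ℚ.<-≤-trans 0<ε (subst (_≤ʳ seq x k) (ℚ.+-identityˡ ε) (h k N≤k))

≤-power : ∀ {x κ ν w : ℝ} {x′ κ′ ν′ ρ : ℚ} → (∀ k → seq x k ≡ x′) → (∀ k → seq κ k ≡ κ′) → (∀ k → seq ν k ≡ ν′) →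
          0ℚ ≤ʳ κ′ → 0ℚ ≤ʳ ν′ → 0ℚ ≤ʳ ρ → ∀ n → x′ ≤ʳ κ′ *ʳ ν′ *ʳ ρ ^ʳ n → Eventually (λ k → ρ ≤ʳ seq w k) →
          x ≤ κ * ν * w ^ n
≤-power {x} {κ} {ν} {w} {x′} {κ′} {ν′} {ρ} x≡ κ≡ ν≡ 0≤κ′ 0≤ν′ 0≤ρ n x′≤ ρ≤w ε 0<ε = ev-map bound ρ≤w
  where
  open ℚ.≤-Reasoning
  bound : ∀ k → ρ ≤ʳ seq w k → seq x k ≤ʳ seq κ k *ʳ seq ν k *ʳ seq (w ^ n) k +ʳ ε
  bound k ρ≤wₖ = begin
    seq x k                                          ≡⟨ x≡ k ⟩
    x′                                               ≤⟨ x′≤ ⟩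
    κ′ *ʳ ν′ *ʳ ρ ^ʳ n                               ≤⟨ ℚ.*-monoˡ-≤-nonNeg (κ′ *ʳ ν′) {{nonNegative (0≤* 0≤κ′ 0≤ν′)}} (^ʳ-mono-≤ 0≤ρ ρ≤wₖ n) ⟩
    κ′ *ʳ ν′ *ʳ seq w k ^ʳ n                         ≡⟨ cong₂ _*ʳ_ (cong₂ _*ʳ_ (κ≡ k) (ν≡ k)) (seq-^ w n k) ⟨
    seq κ k *ʳ seq ν k *ʳ seq (w ^ n) k              ≤⟨ ≤-+ˡ (ℚ.<⇒≤ 0<ε) ⟩
    seq κ k *ʳ seq ν k *ʳ seq (w ^ n) k +ʳ ε         ∎

-- Eventually z² ≥ δ² and 0 < αy ≤ aβ, and `ρ` is δ² / (aβ). Bounding |z| rather than z covers the n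
-- for which log log log n is negative.
ratio-lower : ∀ α y z (0<αy : 0ℝ < α * y) {a β δ ρ : ℚ} → 0ℚ ≤ʳ a → 0ℚ ≤ʳ δ → 0ℚ ≤ʳ ρ → ρ *ʳ (a *ʳ β) ≡ δ *ʳ δ →
              Eventually (λ k → seq α k ≤ʳ a) → Eventually (λ k → 0ℚ <ʳ seq y k) → Eventually (λ k → seq y k ≤ʳ β) →
              Eventually (λ k → δ ≤ʳ ∣ seq z k ∣) → Eventually (λ k → ρ ≤ʳ seq (z ^ 2 / (α * y) [ 0<αy ]) k)
ratio-lower α y z 0<αy {a} {β} {δ} {ρ} 0≤a 0≤δ 0≤ρ ρaβ≡δδ α≤a 0<y y≤β δ≤z = ev-map₂ bound
  (ev-map₂ (λ _ → _,_) α≤a (eventually-0< {α * y} 0<αy))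
  (ev-map₂ (λ _ → _,_) (ev-map₂ (λ _ → _,_) 0<y y≤β) δ≤z)
  where
  open ℚ.≤-Reasoning
  bound : ∀ k → seq α k ≤ʳ a × 0ℚ <ʳ seq α k *ʳ seq y k → (0ℚ <ʳ seq y k × seq y k ≤ʳ β) × δ ≤ʳ ∣ seq z k ∣ →
          ρ ≤ʳ seq z k *ʳ (seq z k *ʳ 1ℚ) *ʳ recip (seq α k *ʳ seq y k)
  bound k (αₖ≤a , 0<q) ((0<yₖ , yₖ≤β) , δ≤zₖ) = begin
    ρ                                                ≡⟨ ℚ.*-identityʳ ρ ⟨
    ρ *ʳ 1ℚ                                          ≡⟨ cong (ρ *ʳ_) (recip-inverse 0<q) ⟨
    ρ *ʳ (q *ʳ recip q)                              ≡⟨ ℚ.*-assoc ρ q (recip q) ⟨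
    ρ *ʳ q *ʳ recip q                                ≤⟨ ℚ.*-monoʳ-≤-nonNeg (recip q) {{nonNegative (ℚ.<⇒≤ (recip-pos 0<q))}} ρq≤ ⟩
    seq z k *ʳ (seq z k *ʳ 1ℚ) *ʳ recip q            ∎
    where
    q : ℚ
    q = seq α k *ʳ seq y k
    ρq≤ : ρ *ʳ q ≤ʳ seq z k *ʳ (seq z k *ʳ 1ℚ)
    ρq≤ = begin
      ρ *ʳ q                         ≤⟨ ℚ.*-monoˡ-≤-nonNeg ρ {{nonNegative 0≤ρ}} (*-mono-≤ʳ 0≤a (ℚ.<⇒≤ 0<yₖ) αₖ≤a yₖ≤β) ⟩
      ρ *ʳ (a *ʳ β)                  ≡⟨ ρaβ≡δδ ⟩
      δ *ʳ δ                         ≤⟨ *-mono-≤ʳ (ℚ.0≤∣p∣ (seq z k)) 0≤δ δ≤zₖ δ≤zₖ ⟩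
      ∣ seq z k ∣ *ʳ ∣ seq z k ∣     ≡⟨ square (seq z k) ⟩
      seq z k *ʳ (seq z k *ʳ 1ℚ)     ∎

-- The number B is chosen so large that loglog n ≤ (L + E) / B yields (logloglog n)² / (α loglog n) ≥ G / (L + E).
module Bound (α : ℝ) (1<α : 1ℝ < α) (A B G c : ℕ)
  (α≤A : Eventually (λ k → seq α k ≤ʳ fromℕʳ (suc A)))
  (B≡ : B ≡ suc c ℕ.* (suc c ℕ.* (suc A ℕ.* suc G)))
  (apart : ∀ n {x y z} → IsLog x (fromℕ n) → IsLog y x → IsLog z y → Eventually (λ k → + 1 /ʳ suc c ≤ʳ ∣ seq z k ∣))
  (family-bound : ∀ {D n} (F : Family D n) → SunflowerFree F → ∀ j E → 1 ℕ.≤ E → 2 ℕ.^ j ℕ.≤ n → n ℕ.< 2 ℕ.^ suc j →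
                  ∥ F ∥ ℕ.* (suc j ℕ.+ E) ℕ.^ n ℕ.≤ E ℕ.^ (2 ℕ.^ E) ℕ.* (suc G ℕ.^ n ℕ.* n !)) where

  -- `E` turns the bound L/B + B + 1 on log log n into exactly (L + E)/B. `K` is the constant that
  -- absorbs the n whose bit length is below `E`.
  E K : ℕ
  E = B ℕ.* B ℕ.+ B
  K = E ℕ.^ (2 ℕ.^ E)

  1≤B : 1 ℕ.≤ B
  1≤B = subst (1 ℕ.≤_) (sym B≡) (s≤s z≤n)

  1≤E : 1 ℕ.≤ E
  1≤E = ℕ.≤-trans 1≤B (ℕ.m≤n+m B (B ℕ.* B))

  1≤K : 1 ℕ.≤ K
  1≤K = ℕ.m^n>0 E {{ℕ.>-nonZero 1≤E}} (2 ℕ.^ E)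

  0<K : 0ℝ < fromℕ K
  0<K = 1ℚ , 0<1 , 0 , λ _ _ → ℚ.≤-trans (ℚ.≤-reflexive (ℚ.+-identityˡ 1ℚ)) (fromℕʳ-mono {1} {K} 1≤K)

  a b g γ γ⁻¹ b⁻¹ : ℚ
  a   = fromℕʳ (suc A)
  b   = fromℕʳ B
  g   = fromℕʳ (suc G)
  γ   = fromℕʳ (suc c)
  γ⁻¹ = + 1 /ʳ suc c
  b⁻¹ = recip b

  0<b : 0ℚ <ʳ b
  0<b = ℚ.<-≤-trans 0<1 (fromℕʳ-mono {1} {B} 1≤B)

  b≡ : b ≡ γ *ʳ (γ *ʳ (a *ʳ g))
  b≡ = trans (cong fromℕʳ B≡) (trans (fromℕʳ-* (suc c) (suc c ℕ.* (suc A ℕ.* suc G))) (cong (γ *ʳ_)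
    (trans (fromℕʳ-* (suc c) (suc A ℕ.* suc G)) (cong (γ *ʳ_) (fromℕʳ-* (suc A) (suc G))))))

  module At (L : ℕ) where

    s s⁻¹ β ρ : ℚ
    s   = fromℕʳ (suc L ℕ.+ E)
    s⁻¹ = recip s
    β   = fromℕʳ (suc L) *ʳ b⁻¹ +ʳ b +ʳ ½ +ʳ ½
    ρ   = g *ʳ s⁻¹

    s*s⁻¹≡1 : s *ʳ s⁻¹ ≡ 1ℚ
    s*s⁻¹≡1 = recip-inverse (0<fromℕʳ-suc (L ℕ.+ E))

    0≤s⁻¹ : 0ℚ ≤ʳ s⁻¹
    0≤s⁻¹ = ℚ.<⇒≤ (recip-pos (0<fromℕʳ-suc (L ℕ.+ E)))

    0≤ρ : 0ℚ ≤ʳ ρ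
    0≤ρ = 0≤* (0≤fromℕʳ (suc G)) 0≤s⁻¹

    β≡s/b : β ≡ s *ʳ b⁻¹
    β≡s/b = begin
      ℓ *ʳ b⁻¹ +ʳ b +ʳ ½ +ʳ ½                          ≡⟨ solve 3 (λ ℓ b r → ℓ :* r :+ b :+ con ½ :+ con ½ := ℓ :* r :+ b :* con 1ℚ :+ con 1ℚ) refl ℓ b b⁻¹ ⟩
      ℓ *ʳ b⁻¹ +ʳ b *ʳ 1ℚ +ʳ 1ℚ                        ≡⟨ cong (λ e → ℓ *ʳ b⁻¹ +ʳ b *ʳ e +ʳ e) (recip-inverse 0<b) ⟨
      ℓ *ʳ b⁻¹ +ʳ b *ʳ (b *ʳ b⁻¹) +ʳ b *ʳ b⁻¹          ≡⟨ solve 3 (λ ℓ b r → ℓ :* r :+ b :* (b :* r) :+ b :* r := (ℓ :+ (b :* b :+ b)) :* r) refl ℓ b b⁻¹ ⟩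
      (ℓ +ʳ (b *ʳ b +ʳ b)) *ʳ b⁻¹                      ≡⟨ cong (_*ʳ b⁻¹) (trans (fromℕʳ-+ (suc L) E) (cong (ℓ +ʳ_) (trans (fromℕʳ-+ (B ℕ.* B) B) (cong (_+ʳ b) (fromℕʳ-* B B))))) ⟨
      s *ʳ b⁻¹                                         ∎
      where
      open ≡-Reasoning
      open +-*-Solver
      ℓ : ℚ
      ℓ = fromℕʳ (suc L)

    -- This equation dictates the value of `B`: the factor s cancels, and a · g / b must be 1/γ².
    ρaβ≡ : ρ *ʳ (a *ʳ β) ≡ γ⁻¹ *ʳ γ⁻¹
    ρaβ≡ = begin
      ρ *ʳ (a *ʳ β)                                    ≡⟨ cong (λ e → ρ *ʳ (a *ʳ e)) β≡s/b ⟩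
      g *ʳ s⁻¹ *ʳ (a *ʳ (s *ʳ b⁻¹))                    ≡⟨ solve 5 (λ g s s⁻¹ a r → g :* s⁻¹ :* (a :* (s :* r)) := (s :* s⁻¹) :* (a :* g :* r)) refl g s s⁻¹ a b⁻¹ ⟩
      (s *ʳ s⁻¹) *ʳ (a *ʳ g *ʳ b⁻¹)                    ≡⟨ cong (_*ʳ (a *ʳ g *ʳ b⁻¹)) (trans s*s⁻¹≡1 (sym (cong₂ _*ʳ_ (suc*1/suc c) (suc*1/suc c)))) ⟩
      (γ *ʳ γ⁻¹ *ʳ (γ *ʳ γ⁻¹)) *ʳ (a *ʳ g *ʳ b⁻¹)      ≡⟨ solve 5 (λ γ δ a g r → (γ :* δ :* (γ :* δ)) :* (a :* g :* r) := δ :* δ :* ((γ :* (γ :* (a :* g))) :* r)) refl γ γ⁻¹ a g b⁻¹ ⟩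
      γ⁻¹ *ʳ γ⁻¹ *ʳ ((γ *ʳ (γ *ʳ (a *ʳ g))) *ʳ b⁻¹)    ≡⟨ cong (λ e → γ⁻¹ *ʳ γ⁻¹ *ʳ (e *ʳ b⁻¹)) b≡ ⟨
      γ⁻¹ *ʳ γ⁻¹ *ʳ (b *ʳ b⁻¹)                         ≡⟨ cong (γ⁻¹ *ʳ γ⁻¹ *ʳ_) (recip-inverse 0<b) ⟩
      γ⁻¹ *ʳ γ⁻¹ *ʳ 1ℚ                                 ≡⟨ ℚ.*-identityʳ _ ⟩
      γ⁻¹ *ʳ γ⁻¹                                       ∎
      where
      open ≡-Reasoning
      open +-*-Solver

    size≤ : ∀ f n → f ℕ.* (suc L ℕ.+ E) ℕ.^ n ℕ.≤ K ℕ.* (suc G ℕ.^ n ℕ.* n !) →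
            fromℕʳ f ≤ʳ fromℕʳ K *ʳ fromℕʳ (n !) *ʳ ρ ^ʳ n
    size≤ f n h = begin
      fromℕʳ f                                                    ≡⟨ ℚ.*-identityʳ _ ⟨
      fromℕʳ f *ʳ 1ℚ                                              ≡⟨ cong (fromℕʳ f *ʳ_) (trans (sym (^ʳ-distrib-* s s⁻¹ n)) (trans (cong (_^ʳ n) s*s⁻¹≡1) (1^ʳ n))) ⟨
      fromℕʳ f *ʳ (s ^ʳ n *ʳ s⁻¹ ^ʳ n)                            ≡⟨ ℚ.*-assoc (fromℕʳ f) _ _ ⟨
      fromℕʳ f *ʳ s ^ʳ n *ʳ s⁻¹ ^ʳ n                              ≡⟨ cong (_*ʳ s⁻¹ ^ʳ n) (trans (fromℕʳ-* f ((suc L ℕ.+ E) ℕ.^ n)) (cong (fromℕʳ f *ʳ_) (fromℕʳ-^ (suc L ℕ.+ E) n))) ⟨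
      fromℕʳ (f ℕ.* (suc L ℕ.+ E) ℕ.^ n) *ʳ s⁻¹ ^ʳ n              ≤⟨ ℚ.*-monoʳ-≤-nonNeg (s⁻¹ ^ʳ n) {{nonNegative (0≤^ʳ 0≤s⁻¹ n)}} (fromℕʳ-mono {f ℕ.* (suc L ℕ.+ E) ℕ.^ n} {K ℕ.* (suc G ℕ.^ n ℕ.* n !)} h) ⟩
      fromℕʳ (K ℕ.* (suc G ℕ.^ n ℕ.* n !)) *ʳ s⁻¹ ^ʳ n            ≡⟨ cong (_*ʳ s⁻¹ ^ʳ n) (trans (fromℕʳ-* K (suc G ℕ.^ n ℕ.* n !)) (cong (fromℕʳ K *ʳ_) (trans (fromℕʳ-* (suc G ℕ.^ n) (n !)) (cong (_*ʳ fromℕʳ (n !)) (fromℕʳ-^ (suc G) n))))) ⟩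
      fromℕʳ K *ʳ (g ^ʳ n *ʳ fromℕʳ (n !)) *ʳ s⁻¹ ^ʳ n            ≡⟨ solve 4 (λ k x f y → k :* (x :* f) :* y := k :* f :* (x :* y)) refl (fromℕʳ K) (g ^ʳ n) (fromℕʳ (n !)) (s⁻¹ ^ʳ n) ⟩
      fromℕʳ K *ʳ fromℕʳ (n !) *ʳ (g ^ʳ n *ʳ s⁻¹ ^ʳ n)            ≡⟨ cong (fromℕʳ K *ʳ fromℕʳ (n !) *ʳ_) (^ʳ-distrib-* g s⁻¹ n) ⟨
      fromℕʳ K *ʳ fromℕʳ (n !) *ʳ ρ ^ʳ n                          ∎
      where
      open ℚ.≤-Reasoning
      open +-*-Solver

  main : ∀ {D n} → 1 ℕ.≤ n → (F : Family D n) → SunflowerFree F → ∀ {x y z} →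
         IsLog x (fromℕ n) → IsLog y x → (y-z : IsLog z y) →
         fromℕ ∥ F ∥ ≤ fromℕ K * fromℕ (n !) * (z ^ 2 / (α * y) [ *-pos α y (1<⇒0< α 1<α) (positive-arg y-z) ]) ^ n
  main {n = n} 1≤n F free {x} {y} {z} n-x x-y y-z = unpack (bitLength n 1≤n) λ { j (2^j≤n , n<2^[1+j]) →
    ≤-power {fromℕ ∥ F ∥} {fromℕ K} {fromℕ (n !)} (λ _ → refl) (λ _ → refl) (λ _ → refl) (0≤fromℕʳ K) (0≤fromℕʳ (n !)) (At.0≤ρ j) n
      (At.size≤ j ∥ F ∥ n (family-bound F free j E 1≤E 2^j≤n n<2^[1+j]))
      (ratio-lower α y z 0<α*y (0≤fromℕʳ (suc A)) (ℚ.<⇒≤ (0<1/suc c)) (At.0≤ρ j) (At.ρaβ≡ j)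
        α≤A (eventually-0< {y} (positive-arg y-z)) (loglog-upper n (suc j) B n<2^[1+j] n-x x-y 0<b) (apart n n-x x-y y-z)) }
    where
    0<α*y : 0ℝ < α * y
    0<α*y = *-pos α y (1<⇒0< α 1<α) (positive-arg y-z)

theorem1p7 : (α : ℝ) (1<α : 1ℝ < α) →
    ∃ λ (K : ℝ) → 0ℝ < K ×
    ((D n : ℕ) → 2 ℕ.< D → 1 ℕ.≤ n →
    (F : Family D n) → SunflowerFree F →
    (log-n loglog-n logloglog-n : ℝ) →
    IsLog log-n (fromℕ n) →
    IsLog loglog-n log-n →
    (is-log³ : IsLog logloglog-n loglog-n) →
    fromℕ ∥ F ∥ ≤
    K * fromℕ (n !) *
    (logloglog-n ^ 2 / (α * loglog-n) [ *-pos α loglog-n (1<⇒0< α 1<α) (positive-arg is-log³) ]) ^ n)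
theorem1p7 α 1<α = fromℕ K , 0<K , λ _ _ _ 1≤n F free _ _ _ n-x x-y y-z → main 1≤n F free n-x x-y y-z
  where
  A : ℕ
  A = proj₁ (bounded-above α)
  -- The constants are 4608 from the family bound and 12000 from the gap around 0, passed as
  -- predecessors. Only `A` depends on `α`, and nothing depends on D, n or the family.
  open Bound α 1<α A (12000 ℕ.* (12000 ℕ.* (suc A ℕ.* 4608))) 4607 11999 (proj₂ (bounded-above α)) refl logloglog-apart ∥F∥*[L+E]^n≤
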